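{- Let $\mathbf d$ be any degree sequence such that $\delta_a^{\mathrm t}=1$ and $\delta_a^{\mathrm h}=2$ for all hyperarcs $a\in A$, and $|\{v\in V: d_v^{\mathrm{out}}>0\}|=2$. Then for $k\to\infty$ the double hyperarc shuffling method with $k$ steps on the space $\mathcal H^{\mathrm{stub}}_{s}(\mathbf d)$ samples uniformly from that space; that is, for every initial directed hypergraph $H_0\in\mathcal H^{\mathrm{stub}}_{s}(\mathbf d)$, the outcome $H_k$ of the method converges in distribution, as $k\to\infty$, to the uniform distribution on $\mathcal H^{\mathrm{stub}}_{s}(\mathbf d)$.
   Context: **Directed hypergraphs.** A directed hypergraph $H=(V,A)$ consists of a finite vertex set $V$ and a finite multiset $A=A(H)$ of hyperarcs; a hyperarc is a pair $a=(a^{\mathrm t},a^{\mathrm h})$ of multisets of elements of $V$ (its tail and head). $m_s(v)$ denotes the multiplicity of $v$ in a multiset $s$, and $\uplus$ is multiset union with multiplicities added. A hyperarc $a$ is a self-loop if $a^{\mathrm t}=a^{\mathrm h}$; it is degenerate if some vertex has multiplicity at least $2$ in $a^{\mathrm t}$ or in $a^{\mathrm h}$. Two hyperarcs $a_1,a_2$ of $H$ are multi-hyperarcs if $a_1^{\mathrm t}=a_2^{\mathrm t}$ and $a_1^{\mathrm h}=a_2^{\mathrm h}$. **Degrees.** $d_v^{\mathrm{in}}=\sum_{a\in A}m_{a^{\mathrm h}}(v)$, $d_v^{\mathrm{out}}=\sum_{a\in A}m_{a^{\mathrm t}}(v)$, $\delta_a^{\mathrm t}=|a^{\mathrm t}|$,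 $\delta_a^{\mathrm h}=|a^{\mathrm h}|$ (cardinalities with multiplicity). The degree sequence is $\mathbf d=(\mathbf d_V,\boldsymbol\delta_A)$ with $\mathbf d_V=((d_v^{\mathrm{in}},d_v^{\mathrm{out}}))_{v\in V}$ and $\boldsymbol\delta_A=((\delta_a^{\mathrm t},\delta_a^{\mathrm h}))_{a\in A}$ (considered up to reordering). A degree sequence includes the vertex set $V$. **Stub-labeled hypergraphs.** Each vertex $v$ has $d_v^{\mathrm{out}}$ distinct out-stubs and $d_v^{\mathrm{in}}$ distinct in-stubs. In a stub-labeled directed hypergraph the tail (head) of every hyperarc is a set of out-stubs (in-stubs), every out-stub lies in exactly one tail and every in-stub in exactly one head; two stub-labeled directed hypergraphs are the same iff their collections of linked stubs are the same. Self-loops, degenerate hyperarcs and multi-hyperarcs are determined using only the underlying vertices (each stub replaced by its vertex). **Space.** $\mathcal H^{\mathrm{stub}}_s(\mathbf d)$ is the set of all stub-labeled directed hypergraphs with degree sequence $\mathbf d$ that contain no degenerate hyperarcs and no multi-hyperarcs (self-loops are allowed). **Double hyperarc shuffle.** For two distinct hyperarcs $a,b$ of $H$ (distinct elements of the multiset $A(H)$), $S(a,b)$ is the set of pairs $(\hat a,\hat b)$ with $a^{\mathrm t}\uplus b^{\mathrm t}=\hat a^{\mathrm t}\uplus\hat b^{\mathrm t}$, $a^{\mathrm h}\uplus b^{\mathrm h}=\hat a^{\mathrm h}\uplus\hat b^{\mathrm h}$, $(\delta_a^{\mathrm t},\delta_a^{\mathrm h})=(\delta_{\hat a}^{\mathrm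 t},\delta_{\hat a}^{\mathrm h})$, $(\delta_b^{\mathrm t},\delta_b^{\mathrm h})=(\delta_{\hat b}^{\mathrm t},\delta_{\hat b}^{\mathrm h})$; for stub-labeled hypergraphs tails and heads here are sets of stubs. The shuffle $s(a,b|H)$ picks $(\hat a,\hat b)\in S(a,b)$ uniformly at random and outputs $H'$ with $A(H')=(A(H)\setminus\{a,b\})\uplus\{\hat a,\hat b\}$. **Double hyperarc shuffling method with $k$ steps** on a space $\mathcal H$, from $H_0\in\mathcal H$: for $i=0,1,\dots,k-1$, pick an unordered pair of distinct hyperarcs $a_i,b_i$ of $H_i$ uniformly at random, perform $s(a_i,b_i|H_i)$ (all choices independent), and let $H_{i+1}$ be the result if it lies in $\mathcal H$, and $H_{i+1}=H_i$ otherwise. The outcome is $H_k$. -}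

module Defs where

open import Data.Bool.Base using (if_then_else_)
open import Data.Fin.Base using (Fin; zero; suc; splitAt)
import Data.Fin.Properties as Fin
open import Data.Fin.Subset using (Subset; inside; outside; _∩_; ∣_∣)
open import Data.Fin.Subset.Properties using (_∈?_)
import Data.Bool.Properties as Bool
open import Data.Integer.Base using (+_)
open import Data.List.Base as List
  using (List; []; _∷_; _++_; [_]; filter; deduplicate; cartesianProduct;
         cartesianProductWith; allFin; concatMap; length)
import Data.List.Membership.Propositional as L
open import Data.List.Membership.DecPropositional using () renaming (_∈?_ to mem?)
open import Data.List.Membership.Propositional.Properties
  using (∈-∃++; ∈-filter⁺; ∈-cartesianProduct⁺; ∈-cartesianProductWith⁺)
open import Data.List.Relation.Binary.Permutation.Propositional
  using (_↭_; ↭-refl; ↭-sym; ↭-trans; prep)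
open import Data.List.Relation.Binary.Permutation.Propositional.Properties
  using (∈-resp-↭; shift; drop-∷; ¬x∷xs↭[])
open import Data.List.Relation.Unary.All as ListAll using ()
import Data.List.Relation.Unary.All.Properties as ListAll
open import Data.List.Relation.Unary.AllPairs as AllPairs using ([]; _∷_)
open import Data.List.Relation.Unary.Any as ListAny using (here; there)
import Data.List.Relation.Unary.Any.Properties as ListAny
open import Data.List.Relation.Unary.Unique.Propositional using (Unique)
import Data.List.Relation.Unary.Unique.DecPropositional as DecUnique
import Data.List.Relation.Unary.Unique.DecSetoid.Properties as DecSetoidUnique
import Data.List.Relation.Unary.Unique.Propositional.Properties as Unique
open import Data.Nat.Base as ℕ using (ℕ; zero; suc; _≥_)
import Data.Nat.Properties as ℕ
open import Data.Product.Base using (_×_; _,_; proj₁; proj₂; ∃-syntax)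
open import Data.Product.Properties using () renaming (≡-dec to ×-≡-dec)
open import Data.Rational.Base as ℚ using (ℚ; 0ℚ; 1ℚ)
open import Data.Sum.Base using (_⊎_; [_,_]′)
open import Data.Vec.Base
  using (Vec; []; _∷_; map; lookup; tabulate; toList; count; sum; zipWith; _[_]≔_)
open import Data.Vec.Properties using (∷-injective) renaming (≡-dec to Vec-≡-dec)
open import Data.Vec.Relation.Unary.All as All using (All)
open import Data.Vec.Relation.Unary.Any as Any using (Any)
open import Function.Base using (_∘_; const)
open import Level using (0ℓ)
open import Relation.Binary.Bundles using (DecSetoid)
open import Relation.Binary.Definitions using (DecidableEquality)
import Relation.Binary.Definitions as Binary
open import Relation.Binary.PropositionalEquality using (_≡_; refl)
open import Relation.Nullary.Decidable
  using (yes; no; does; map′; ¬?; _×-dec_; _⊎-dec_)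
open import Relation.Nullary.Negation using (¬_)
open import Relation.Unary using (Decidable)

↭-dec : ∀ {A : Set} → DecidableEquality A → Binary.Decidable (_↭_ {A = A})
↭-dec _≟_ [] []      = yes ↭-refl
↭-dec _≟_ [] (y ∷ ys) = no (¬x∷xs↭[] ∘ ↭-sym)
↭-dec _≟_ (x ∷ xs) ys with mem? _≟_ x ys
... | no x∉ys = no λ p → x∉ys (∈-resp-↭ p (here refl))
... | yes x∈ys with as , bs , refl ← ∈-∃++ x∈ys =
  map′ (λ p → ↭-trans (prep x p) (↭-sym (shift x as bs)))
       (λ p → drop-∷ (↭-trans p (shift x as bs)))
       (↭-dec _≟_ xs (as ++ bs))

-- A multiset of elements of Fin n, as its vector of multiplicities.
Multiset : ℕ → Set
Multiset n = Vec ℕ n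

infixl 6 _⊎ᵐ_
_⊎ᵐ_ : ∀ {n} → Multiset n → Multiset n → Multiset n
_⊎ᵐ_ = zipWith ℕ._+_

fromSubset : ∀ {n} → Subset n → Multiset n
fromSubset = map λ b → if b then 1 else 0

-- A hyperarc is a pair (tail , head).
Hyperarc : ℕ → Set
Hyperarc n = Multiset n × Multiset n

Degenerate : ∀ {n} → Hyperarc n → Set
Degenerate (t , h) = Any (2 ℕ.≤_) t ⊎ Any (2 ℕ.≤_) h

degenerate? : ∀ {n} → Decidable (Degenerate {n})
degenerate? (t , h) = Any.any? (2 ℕ.≤?_) t ⊎-dec Any.any? (2 ℕ.≤?_) h

record DegreeSequence : Set where
  field
    vertices : ℕ
    arcs     : ℕ
    dⁱⁿ dᵒᵘᵗ : Vec ℕ vertices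
    -- (δᵗ , δʰ) for each hyperarc; the order is irrelevant, see HasArcDegrees.
    δ        : Vec (ℕ × ℕ) arcs

-- When vertex v has lookup d v stubs, the stubs are numbered consecutively by
-- Fin (sum d), those of vertex 0 first; owner gives the vertex of a stub.
owner : ∀ {n} (d : Vec ℕ n) → Fin (sum d) → Fin n
owner (x ∷ d) s = [ const zero , suc ∘ owner d ]′ (splitAt x s)

stubsOf : ∀ {n} (d : Vec ℕ n) → Fin n → Subset (sum d)
stubsOf d v = tabulate λ s → does (owner d s Fin.≟ v)

-- The multiset of vertices obtained by replacing each stub by its vertex.
owners : ∀ {n} (d : Vec ℕ n) → Subset (sum d) → Multiset n
owners d S = tabulate λ v → ∣ S ∩ stubsOf d v ∣

vectors : ∀ {A : Set} → List A → ∀ n → List (Vec A n)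
vectors xs zero    = [ [] ]
vectors xs (suc n) = cartesianProductWith _∷_ xs (vectors xs n)

subsets : ∀ n → List (Subset n)
subsets = vectors (inside ∷ outside ∷ [])

∈-vectors : ∀ {A : Set} {xs : List A} → (∀ x → x L.∈ xs) →
            ∀ {n} (v : Vec A n) → v L.∈ vectors xs n
∈-vectors all []      = here refl
∈-vectors all (x ∷ v) = ∈-cartesianProductWith⁺ _∷_ (all x) (∈-vectors all v)

vectors-unique : ∀ {A : Set} {xs : List A} → Unique xs → ∀ n → Unique (vectors xs n)
vectors-unique u zero    = ListAll.[] ∷ []
vectors-unique u (suc n) =
  Unique.cartesianProductWith⁺ _∷_ ∷-injective u (vectors-unique u n)

∈-subsets : ∀ {n} (S : Subset n) → S L.∈ subsets n
∈-subsets = ∈-vectors λ where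
  inside  → here refl
  outside → there (here refl)

subsets-unique : ∀ n → Unique (subsets n)
subsets-unique = vectors-unique (((λ ()) ListAll.∷ ListAll.[]) ∷ ListAll.[] ∷ [])

-- Finitely supported distributions, as lists of weighted outcomes. Outcomes
-- may be repeated; only the probabilities Pr are meaningful.
Dist : Set → Set
Dist A = List (ℚ × A)

point : ∀ {A : Set} → A → Dist A
point x = [ 1ℚ , x ]

-- Uniform over the positions of a list, hence over its elements when they are
-- pairwise distinct. The empty list yields total mass 0.
uniform : ∀ {A : Set} → List A → Dist A
uniform []       = []
uniform (x ∷ xs) = List.map (+ 1 ℚ./ suc (length xs) ,_) (x ∷ xs)

infixl 1 _>>=_
_>>=_ : ∀ {A B : Set} → Dist A → (A → Dist B) → Dist B
D >>= f = concatMap (λ (p , x) → List.map (λ (q , y) → p ℚ.* q , y) (f x)) D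

Pr : ∀ {A : Set} {P : A → Set} → Decidable P → Dist A → ℚ
Pr P? D = List.foldr ℚ._+_ 0ℚ (List.map proj₁ (filter (P? ∘ proj₂) D))

-- Convergence in distribution on a discrete space whose points are the classes
-- of a decidable equivalence: pointwise convergence of the probabilities. These
-- are rational, so rational ε suffice.
ConvergesInDistribution : ∀ {A : Set} {_≈_ : A → A → Set} → Binary.Decidable _≈_ →
                          (ℕ → Dist A) → Dist A → Set
ConvergesInDistribution {A} _≈?_ X μ =
  ∀ (x : A) (ε : ℚ) → 0ℚ ℚ.< ε →
  ∃[ K ] ∀ k → k ≥ K → ℚ.∣ Pr (x ≈?_) (X k) ℚ.- Pr (x ≈?_) μ ∣ ℚ.< ε

module _ (d : DegreeSequence) where
  open DegreeSequence d

  StubHyperarc : Set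
  StubHyperarc = Subset (sum dᵒᵘᵗ) × Subset (sum dⁱⁿ)

  tail : StubHyperarc → Subset (sum dᵒᵘᵗ)
  tail = proj₁

  head : StubHyperarc → Subset (sum dⁱⁿ)
  head = proj₂

  underlying : StubHyperarc → Hyperarc vertices
  underlying a = owners dᵒᵘᵗ (tail a) , owners dⁱⁿ (head a)

  degrees : StubHyperarc → ℕ × ℕ
  degrees a = ∣ tail a ∣ , ∣ head a ∣

  _≟ₐ_ : DecidableEquality StubHyperarc
  _≟ₐ_ = ×-≡-dec (Vec-≡-dec Bool._≟_) (Vec-≡-dec Bool._≟_)

  -- A collection of hyperarcs is a vector considered up to _≈_, that is, up to
  -- reordering. Positions are the distinct elements of the multiset A(H).
  Hypergraph : Set
  Hypergraph = Vec StubHyperarc arcs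

  infix 4 _≈_ _≈?_
  _≈_ : Hypergraph → Hypergraph → Set
  H ≈ G = toList H ↭ toList G

  _≈?_ : Binary.Decidable _≈_
  H ≈? G = ↭-dec _≟ₐ_ (toList H) (toList G)

  -- Since vertex v owns exactly dᵒᵘᵗ(v) out-stubs and dⁱⁿ(v) in-stubs, this
  -- already forces H to have the vertex degrees prescribed by d.
  StubLabeled : Hypergraph → Set
  StubLabeled H = (∀ s → count (λ a → s ∈? tail a) H ≡ 1)
                × (∀ s → count (λ a → s ∈? head a) H ≡ 1)

  HasArcDegrees : Hypergraph → Set
  HasArcDegrees H = toList (map degrees H) ↭ toList δ

  NoDegenerate : Hypergraph → Set
  NoDegenerate H = All (λ a → ¬ Degenerate (underlying a)) H

  NoMulti : Hypergraph → Set
  NoMulti H = Unique (toList (map underlying H))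

  InSpace : Hypergraph → Set
  InSpace H = StubLabeled H × HasArcDegrees H × NoDegenerate H × NoMulti H

  inSpace? : Decidable InSpace
  inSpace? H =
    (Fin.all? (λ s → count (λ a → s ∈? tail a) H ℕ.≟ 1) ×-dec
     Fin.all? (λ s → count (λ a → s ∈? head a) H ℕ.≟ 1)) ×-dec
    ↭-dec (×-≡-dec ℕ._≟_ ℕ._≟_) (toList (map degrees H)) (toList δ) ×-dec
    All.all? (λ a → ¬? (degenerate? (underlying a))) H ×-dec
    DecUnique.unique? (×-≡-dec (Vec-≡-dec ℕ._≟_) (Vec-≡-dec ℕ._≟_))
                      (toList (map underlying H))

  hyperarcs : List StubHyperarc
  hyperarcs = cartesianProduct (subsets _) (subsets _)

  ∈-hyperarcs : ∀ a → a L.∈ hyperarcs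
  ∈-hyperarcs a = ∈-cartesianProduct⁺ (∈-subsets (tail a)) (∈-subsets (head a))

  hyperarcs-unique : Unique hyperarcs
  hyperarcs-unique = Unique.cartesianProduct⁺ (subsets-unique _) (subsets-unique _)

  space : List Hypergraph
  space = deduplicate _≈?_ (filter inSpace? (vectors hyperarcs arcs))

  space-sound : ListAll.All InSpace space
  space-sound = ListAll.deduplicate⁺ _≈?_
    (ListAll.all-filter inSpace? (vectors hyperarcs arcs))

  space-complete : ∀ {H} → InSpace H → ListAny.Any (H ≈_) space
  space-complete {H} H∈ℋ =
    ListAny.deduplicate⁺ _≈?_ (λ y≈x H≈x → ↭-trans H≈x (↭-sym y≈x))
      (ListAny.map ≡⇒≈
        (∈-filter⁺ inSpace? (∈-vectors ∈-hyperarcs H) H∈ℋ))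
    where
    ≡⇒≈ : ∀ {G} → H ≡ G → H ≈ G
    ≡⇒≈ refl = ↭-refl

  space-unique : AllPairs.AllPairs (λ H G → ¬ H ≈ G) space
  space-unique = DecSetoidUnique.deduplicate-! ≈-decSetoid
    (filter inSpace? (vectors hyperarcs arcs))
    where
    ≈-decSetoid : DecSetoid 0ℓ 0ℓ
    ≈-decSetoid = record
      { Carrier = Hypergraph
      ; _≈_ = _≈_
      ; isDecEquivalence = record
        { isEquivalence = record { refl = ↭-refl ; sym = ↭-sym ; trans = ↭-trans }
        ; _≟_ = _≈?_
        }
      }

  IsShuffle : StubHyperarc → StubHyperarc → StubHyperarc × StubHyperarc → Set
  IsShuffle a b (â , b̂) =
      fromSubset (tail a) ⊎ᵐ fromSubset (tail b) ≡ fromSubset (tail â) ⊎ᵐ fromSubset (tail b̂)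
    × fromSubset (head a) ⊎ᵐ fromSubset (head b) ≡ fromSubset (head â) ⊎ᵐ fromSubset (head b̂)
    × degrees a ≡ degrees â
    × degrees b ≡ degrees b̂

  isShuffle? : ∀ a b → Decidable (IsShuffle a b)
  isShuffle? a b (â , b̂) =
    Vec-≡-dec ℕ._≟_ _ _ ×-dec Vec-≡-dec ℕ._≟_ _ _ ×-dec
    ×-≡-dec ℕ._≟_ ℕ._≟_ _ _ ×-dec ×-≡-dec ℕ._≟_ ℕ._≟_ _ _

  S : StubHyperarc → StubHyperarc → List (StubHyperarc × StubHyperarc)
  S a b = filter (isShuffle? a b) (cartesianProduct hyperarcs hyperarcs)

  S-unique : ∀ a b → Unique (S a b)
  S-unique a b = Unique.filter⁺ (isShuffle? a b)
    (Unique.cartesianProduct⁺ hyperarcs-unique hyperarcs-unique)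

  -- Each unordered pair of distinct positions, once. It is harmless to order
  -- the pair, as S b a is S a b with the components swapped.
  pairs : List (Fin arcs × Fin arcs)
  pairs = filter (λ (i , j) → i Fin.<? j) (cartesianProduct (allFin arcs) (allFin arcs))

  step : Hypergraph → Dist Hypergraph
  step H = do
    (i , j) ← uniform pairs
    (â , b̂) ← uniform (S (lookup H i) (lookup H j))
    let H′ = H [ i ]≔ â [ j ]≔ b̂
    point (if does (inSpace? H′) then H′ else H)

  -- The distribution of H_k. (The method presupposes at least two hyperarcs.)
  method : Hypergraph → ℕ → Dist Hypergraph
  method H₀ zero    = point H₀
  method H₀ (suc k) = method H₀ k >>= step

{-# OPTIONS --safe #-}

-- Call the two vertices that own out-stubs colours. A hypergraph of the space is a
-- graph on the vertices whose edges are the heads of the hyperarcs, each edge having the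
-- colour of its tail; no edge is a loop and parallel edges have distinct colours. Forgetting
-- the colours leaves a loopless multigraph with multiplicities at most 2, fixed degrees, and
-- at most as many doubled edges as there are edges of either colour.
--
-- Let M ≠ N be two such multigraphs, and let v have an edge va with M < N and an edge vb with
-- N < M. The degrees of a and b agree in M and N, so some z has
-- M az + N bz > M bz + N az; hence va, bz can replace vb, az in M, or vb, az can replace
-- va, bz in N. This brings M and N closer and is admissible unless it creates one doubled
-- edge too many. If this obstructs every such choice, then the multigraph that is 1
-- wherever M and N differ is admissible and lies strictly between them, and one recurses.
-- Each switch lifts to the space after at most two exchanges of colours, and hypergraphs
-- with the same multigraph are connected by exchanging colours and stubs. So the chain is
-- irreducible, even on vectors of hyperarcs.
--
-- The chain can stay put, so from every state it reaches a given one in exactly t steps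
-- with probability at least some c > 0, and averaging over t steps shrinks the oscillation of
-- a function on the states by a factor 1 - c. The limit is the mean over all vectors, which
-- the chain preserves because shuffles are symmetric; it equals the mean over the space
-- because every point of the space is represented by the same number of vectors.

module Submission where

-- Trading head stubs keeps the colours of both arcs, so a switch of the multigraph is realised by
-- one shuffle only if, on each side of its square, some colour lies on the edge given up and not on
-- the edge created. This can fail only if both edges are single, and exactly then does that side of
-- the switch raise the number of doubled edges. So `cost` has two uses: it keeps the multigraph
-- admissible, and the room it reserves provides an undoubled edge of the other colour with which to
-- undo the jam. Some switches are found in the target graph and run backwards, hence a switch and
-- its inverse must have the same cost. Graphs are symmetric matrices of multiplicities. Sums run
-- over ordered pairs, so every edge counts twice, and identities are kept additive because
-- subtraction on naturals truncates. On the analytic side no transition matrix is formed: the chain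
-- acts on functions, and a lower bound on a probability is expressed by testing nonnegative
-- functions.

open import Data.Fin.Base using (Fin)
open import Data.Nat.Base using (ℕ)

-- Finite sums of natural numbers.

module FiniteSums where

  open import Data.Bool.Base using (if_then_else_)
  open import Data.Fin.Base using (Fin; zero; suc)
  import Data.Fin.Properties as Fin
  open import Data.Nat.Base using (ℕ; zero; suc; _+_; _*_; _∸_; _≤_; _<_; z≤n)
  import Data.Nat.Properties as ℕ
  open import Data.Nat.Tactic.RingSolver using (solve-∀)
  open import Data.Product.Base using (_,_; ∃-syntax)
  open import Algebra.Properties.Semiring.Sum ℕ.+-*-semiring
    using (sum; sum-cong-≗; sum-replicate-zero; ∑-distrib-+; *-distribʳ-sum)
  open import Relation.Binary.PropositionalEquality
    using (_≡_; _≢_; refl; sym; trans; cong; cong₂; subst; module ≡-Reasoning)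
  open import Relation.Nullary.Decidable using (yes; no; does)
  open import Relation.Nullary.Negation using (contradiction)

  private variable
    m n : ℕ

  sum-mono-≤ : (f g : Fin n → ℕ) → (∀ i → f i ≤ g i) → sum f ≤ sum g
  sum-mono-≤ {zero}  f g f≤g = z≤n
  sum-mono-≤ {suc n} f g f≤g =
    ℕ.+-mono-≤ (f≤g zero) (sum-mono-≤ (λ i → f (suc i)) (λ i → g (suc i)) (λ i → f≤g (suc i)))

  sum-<⇒∃ : (f g : Fin n → ℕ) → sum f < sum g → ∃[ i ] f i < g i
  sum-<⇒∃ f g Σf<Σg with Fin.any? (λ i → f i ℕ.<? g i)
  ... | yes p = p
  ... | no ¬p = contradiction Σf<Σg
    (ℕ.≤⇒≯ (sum-mono-≤ g f λ i → ℕ.≮⇒≥ λ lt → ¬p (i , lt)))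

  term≤sum : (f : Fin n → ℕ) (i : Fin n) → f i ≤ sum f
  term≤sum f zero    = ℕ.m≤m+n _ _
  term≤sum f (suc i) = ℕ.≤-trans (term≤sum (λ j → f (suc j)) i) (ℕ.m≤n+m _ _)

  -- Adding the foreign value on both sides records a change at one index without truncated
  -- subtraction; the later bookkeeping identities follow this form.
  sum-differ-at : (f g : Fin n → ℕ) (i : Fin n) → (∀ j → j ≢ i → f j ≡ g j) →
                  sum f + g i ≡ sum g + f i
  sum-differ-at f g zero f≗g = begin
    (f zero + sum f′) + g zero  ≡⟨ cong (λ s → (f zero + s) + g zero)
                                      (sum-cong-≗ {x = f′} {g′} λ j → f≗g (suc j) λ ()) ⟩
    (f zero + sum g′) + g zero  ≡⟨ lemma (f zero) (sum g′) (g zero) ⟩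
    (g zero + sum g′) + f zero  ∎
    where
    open ≡-Reasoning
    f′ = λ j → f (suc j)
    g′ = λ j → g (suc j)
    lemma : ∀ a b c → (a + b) + c ≡ (c + b) + a
    lemma = solve-∀
  sum-differ-at f g (suc i) f≗g = begin
    (f zero + sum f′) + g (suc i)  ≡⟨ ℕ.+-assoc (f zero) _ _ ⟩
    f zero + (sum f′ + g (suc i))  ≡⟨ cong₂ _+_ (f≗g zero λ ())
                                       (sum-differ-at f′ g′ i λ j j≢i → f≗g (suc j) λ { refl → j≢i refl }) ⟩
    g zero + (sum g′ + f (suc i))  ≡⟨ ℕ.+-assoc (g zero) _ _ ⟨
    (g zero + sum g′) + f (suc i)  ∎
    where
    open ≡-Reasoning
    f′ = λ j → f (suc j)
    g′ = λ j → g (suc j)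

  sum-differ-at₂ : (f g : Fin n → ℕ) {i j : Fin n} → i ≢ j →
                   (∀ k → k ≢ i → k ≢ j → f k ≡ g k) →
                   sum f + (g i + g j) ≡ sum g + (f i + f j)
  sum-differ-at₂ f g {i} {j} i≢j f≗g =
    ℕ.+-cancelʳ-≡ (sum h) _ _ (begin
      (sum f + (g i + g j)) + sum h  ≡⟨ l₁ (sum f) (g i) (g j) (sum h) ⟩
      (sum f + g i) + (sum h + g j)  ≡⟨ cong (λ s → (sum f + s) + (sum h + g j)) hi ⟨
      (sum f + h i) + (sum h + g j)  ≡⟨ cong₂ _+_ (sum-differ-at f h i f≗h) (sum-differ-at h g j h≗g) ⟩
      (sum h + f i) + (sum g + h j)  ≡⟨ cong (λ s → (sum h + f i) + (sum g + s)) (hj) ⟩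
      (sum h + f i) + (sum g + f j)  ≡⟨ l₂ (sum h) (f i) (sum g) (f j) ⟩
      (sum g + (f i + f j)) + sum h  ∎)
    where
    open ≡-Reasoning
    -- The hybrid `h` takes `g` at `i` and `f` elsewhere, so each passage, from `f` to `h` and from
    -- `h` to `g`, changes one index only.
    h : _ → ℕ
    h k = if does (k Fin.≟ i) then g k else f k
    hi : h i ≡ g i
    hi with i Fin.≟ i
    ... | yes _ = refl
    ... | no ¬p = contradiction refl ¬p
    hj : h j ≡ f j
    hj with j Fin.≟ i
    ... | yes refl = contradiction refl i≢j
    ... | no _ = refl
    f≗h : ∀ k → k ≢ i → f k ≡ h k
    f≗h k k≢i with k Fin.≟ i
    ... | yes p = contradiction p k≢i
    ... | no _ = refl
    h≗g : ∀ k → k ≢ j → h k ≡ g k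
    h≗g k k≢j with k Fin.≟ i
    ... | yes p = refl
    ... | no ¬p = f≗g k ¬p k≢j
    l₁ : ∀ a b c d → (a + (b + c)) + d ≡ (a + b) + (d + c)
    l₁ = solve-∀
    l₂ : ∀ a b c d → (a + b) + (c + d) ≡ (c + (b + d)) + a
    l₂ = solve-∀

  kron : Fin n → Fin n → ℕ
  kron i j = if does (i Fin.≟ j) then 1 else 0

  kron-refl : (i : Fin n) → kron i i ≡ 1
  kron-refl i with i Fin.≟ i
  ... | yes _ = refl
  ... | no ¬p = contradiction refl ¬p

  kron-≢ : {i j : Fin n} → i ≢ j → kron i j ≡ 0
  kron-≢ {i = i} {j} i≢j with i Fin.≟ j
  ... | yes p = contradiction p i≢j
  ... | no _ = refl

  kron>0⇒≡ : {i j : Fin n} → 0 < kron i j → i ≡ j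
  kron>0⇒≡ {i = i} {j} p with i Fin.≟ j
  ... | yes q = q
  ... | no _ = contradiction p λ ()

  sum-kron-* : (i : Fin n) (f : Fin n → ℕ) → sum (λ j → kron i j * f j) ≡ f i
  sum-kron-* {n} i f = begin
    sum (λ j → kron i j * f j)                        ≡⟨ ℕ.+-identityʳ _ ⟨
    sum (λ j → kron i j * f j) + 0                    ≡⟨ sum-differ-at (λ j → kron i j * f j) (λ _ → 0) i
                                                       (λ j j≢i → cong (_* f j) (kron-≢ (λ p → j≢i (sym p)))) ⟩
    sum {n} (λ _ → 0) + kron i i * f i                ≡⟨ cong₂ _+_ (sum-replicate-zero n) (cong (_* f i) (kron-refl i)) ⟩
    f i + 0                                        ≡⟨ ℕ.+-identityʳ _ ⟩
    f i                                            ∎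
    where open ≡-Reasoning

  sum-kron : (i : Fin n) → sum (kron i) ≡ 1
  sum-kron i = trans (sum-cong-≗ {x = kron i} λ j → sym (ℕ.*-identityʳ (kron i j))) (sum-kron-* i (λ _ → 1))

  sum² : (Fin m → Fin n → ℕ) → ℕ
  sum² F = sum λ x → sum (F x)

  sum²-cong : {F G : Fin m → Fin n → ℕ} → (∀ x y → F x y ≡ G x y) → sum² F ≡ sum² G
  sum²-cong {F = F} {G} e = sum-cong-≗ {x = λ x → sum (F x)} λ x → sum-cong-≗ {x = F x} (e x)

  sum²-+ : (F G : Fin m → Fin n → ℕ) → sum² (λ x y → F x y + G x y) ≡ sum² F + sum² G
  sum²-+ F G = trans
    (sum-cong-≗ {x = λ x → sum λ y → F x y + G x y} λ x → ∑-distrib-+ (F x) (G x))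
    (∑-distrib-+ (λ x → sum (F x)) (λ x → sum (G x)))

  sum²-*ʳ : (F : Fin m → Fin n → ℕ) (c : ℕ) → sum² (λ x y → F x y * c) ≡ sum² F * c
  sum²-*ʳ F c = trans
    (sum-cong-≗ {x = λ x → sum λ y → F x y * c} λ x → sym (*-distribʳ-sum c (F x)))
    (sym (*-distribʳ-sum c (λ x → sum (F x))))

  sum²-mono-≤ : (F G : Fin m → Fin n → ℕ) → (∀ x y → F x y ≤ G x y) → sum² F ≤ sum² G
  sum²-mono-≤ F G F≤G = sum-mono-≤ _ _ λ x → sum-mono-≤ (F x) (G x) (F≤G x)

  sum²-<⇒∃ : (F G : Fin m → Fin n → ℕ) → sum² F < sum² G → ∃[ x ] ∃[ y ] F x y < G x y
  sum²-<⇒∃ F G lt with x , lt′ ← sum-<⇒∃ _ _ lt = x , sum-<⇒∃ (F x) (G x) lt′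


  -- If no `j` compensated, `f` with its deficit at `i` filled up would still lie below `g`
  -- pointwise, although its sum already exceeds that of `f`.
  sum-≡⇒∃> : (f g : Fin n → ℕ) → sum f ≡ sum g → ∀ {i} → f i < g i → ∃[ j ] g j < f j
  sum-≡⇒∃> f g Σf≡Σg {i} fi<gi with Fin.any? (λ j → g j ℕ.<? f j)
  ... | yes p = p
  ... | no ¬p = contradiction Σf≡Σg (ℕ.<⇒≢ (begin-strict
    sum f                                    <⟨ ℕ.m<m+n (sum f) (ℕ.m<n⇒0<n∸m fi<gi) ⟩
    sum f + (g i ∸ f i)                      ≡⟨ cong (sum f +_) (sum-kron-* i (λ _ → g i ∸ f i)) ⟨
    sum f + sum (λ j → kron i j * (g i ∸ f i))  ≡⟨ ∑-distrib-+ f _ ⟨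
    sum (λ j → f j + kron i j * (g i ∸ f i))    ≤⟨ sum-mono-≤ _ g pointwise ⟩
    sum g                                    ∎))
    where
    open ℕ.≤-Reasoning
    pointwise : ∀ j → f j + kron i j * (g i ∸ f i) ≤ g j
    pointwise j with i Fin.≟ j
    ... | yes refl = ℕ.≤-reflexive (trans (cong (f i +_) (ℕ.*-identityˡ _)) (ℕ.m+[n∸m]≡n (ℕ.<⇒≤ fi<gi)))
    ... | no _ = ℕ.≤-trans (ℕ.≤-reflexive (ℕ.+-identityʳ _)) (ℕ.≮⇒≥ λ lt → ¬p (j , lt))

  sum-zero⇒ : (f : Fin n → ℕ) → sum f ≡ 0 → ∀ i → f i ≡ 0
  sum-zero⇒ f e i = ℕ.n≤0⇒n≡0 (subst (f i ≤_) e (term≤sum f i))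

  sum²-zero⇒ : (F : Fin m → Fin n → ℕ) → sum² F ≡ 0 → ∀ x y → F x y ≡ 0
  sum²-zero⇒ F e x = sum-zero⇒ (F x) (sum-zero⇒ _ e x)

  sum-mono-< : (f g : Fin n → ℕ) → (∀ i → f i ≤ g i) → ∀ {i} → f i < g i → sum f < sum g
  sum-mono-< f g f≤g fi<gi = ℕ.≤∧≢⇒< (sum-mono-≤ f g f≤g) λ e →
    let j , gj<fj = sum-≡⇒∃> f g e fi<gi in ℕ.<⇒≱ gj<fj (f≤g j)

  sum²-mono-< : (F G : Fin m → Fin n → ℕ) → (∀ x y → F x y ≤ G x y) → ∀ {x y} → F x y < G x y → sum² F < sum² G
  sum²-mono-< F G F≤G {x} lt = sum-mono-< _ _ (λ x → sum-mono-≤ (F x) (G x) (F≤G x)) {x} (sum-mono-< (F x) (G x) (F≤G x) lt)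

  sum²-≡⇒∃> : (F G : Fin m → Fin n → ℕ) → sum² F ≡ sum² G → ∀ {x y} → F x y < G x y → ∃[ x ] ∃[ y ] G x y < F x y
  sum²-≡⇒∃> F G e lt with Fin.any? (λ x → Fin.any? λ y → G x y ℕ.<? F x y)
  ... | yes p = p
  ... | no ¬p = contradiction e (ℕ.<⇒≢ (sum²-mono-< F G (λ x y → ℕ.≮⇒≥ λ gt → ¬p (x , y , gt)) lt))

-- Indicator matrices of edges, and the square on which a switch acts.

module Edges where

  open import Data.Fin.Base using (Fin)
  import Data.Fin.Properties as Fin
  open import Data.Nat.Base using (ℕ; _+_; _*_; _<_)
  import Data.Nat.Properties as ℕ
  open import Data.Nat.Tactic.RingSolver using (solve-∀)
  open import Data.Product.Base using (_×_; _,_)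
  open import Data.Sum.Base using (_⊎_; inj₁; inj₂)
  open import Algebra.Properties.Semiring.Sum ℕ.+-*-semiring
    using (sum; sum-cong-≗; ∑-distrib-+; *-distribˡ-sum; *-distribʳ-sum)
  open import Relation.Binary.PropositionalEquality
    using (_≡_; _≢_; refl; sym; trans; cong; cong₂; subst; ≢-sym; module ≡-Reasoning)
  open import Relation.Nullary.Decidable using (Dec; yes; no; _×-dec_; _⊎-dec_)
  open import Relation.Nullary.Negation using (¬_; contradiction)
  open FiniteSums

  private variable
    m n : ℕ

  Symmetric : (Fin n → Fin n → ℕ) → Set
  Symmetric F = ∀ x y → F x y ≡ F y x

  -- The adjacency matrix of the single edge `a`-`b`. Both orders are counted, so its total is 2,
  -- and a loop has the entry 2.
  ind : (a b x y : Fin n) → ℕ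
  ind a b x y = kron a x * kron b y + kron a y * kron b x

  Edge : (a b x y : Fin n) → Set
  Edge a b x y = (x ≡ a × y ≡ b) ⊎ (x ≡ b × y ≡ a)

  edge? : (a b x y : Fin n) → Dec (Edge a b x y)
  edge? a b x y = (x Fin.≟ a ×-dec y Fin.≟ b) ⊎-dec (x Fin.≟ b ×-dec y Fin.≟ a)

  edge-sym : {a b x y : Fin n} → Edge a b x y → Edge x y a b
  edge-sym (inj₁ (refl , refl)) = inj₁ (refl , refl)
  edge-sym (inj₂ (refl , refl)) = inj₂ (refl , refl)

  edge-trans : {a b c d x y : Fin n} → Edge a b c d → Edge c d x y → Edge a b x y
  edge-trans (inj₁ (refl , refl)) e = e
  edge-trans (inj₂ (refl , refl)) (inj₁ (refl , refl)) = inj₂ (refl , refl)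
  edge-trans (inj₂ (refl , refl)) (inj₂ (refl , refl)) = inj₁ (refl , refl)

  edge-resp : {F : Fin n → Fin n → ℕ} → Symmetric F →
              ∀ {a b x y} → Edge a b x y → F x y ≡ F a b
  edge-resp symF (inj₁ (refl , refl)) = refl
  edge-resp symF (inj₂ (refl , refl)) = symF _ _

  ind-sym : (a b : Fin n) → Symmetric (ind a b)
  ind-sym a b x y = ℕ.+-comm (kron a x * kron b y) (kron a y * kron b x)

  ind-comm : (a b x y : Fin n) → ind a b x y ≡ ind b a x y
  ind-comm a b x y = lemma (kron a x) (kron b y) (kron a y) (kron b x)
    where
    lemma : ∀ p q r s → p * q + r * s ≡ s * r + q * p
    lemma = solve-∀

  ind-resp : {a b c d : Fin n} → Edge a b c d → ∀ x y → ind a b x y ≡ ind c d x y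
  ind-resp (inj₁ (refl , refl)) x y = refl
  ind-resp {a = a} {b} (inj₂ (refl , refl)) x y = ind-comm a b x y

  ind-self : {a b : Fin n} → a ≢ b → ind a b a b ≡ 1
  ind-self {a = a} {b} a≢b
    rewrite kron-refl a | kron-refl b | kron-≢ a≢b = refl

  ind-edge : {a b x y : Fin n} → a ≢ b → Edge a b x y → ind a b x y ≡ 1
  ind-edge {a = a} {b} a≢b e = trans (edge-resp (ind-sym a b) e) (ind-self a≢b)

  ind-loop : (a : Fin n) → ind a a a a ≡ 2
  ind-loop a rewrite kron-refl a = refl

  ind-¬edge : {a b x y : Fin n} → ¬ Edge a b x y → ind a b x y ≡ 0
  ind-¬edge {a = a} {b} {x} {y} ¬e with a Fin.≟ x | b Fin.≟ y | a Fin.≟ y | b Fin.≟ x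
  ... | yes refl | yes refl | _        | _        = contradiction (inj₁ (refl , refl)) ¬e
  ... | yes _    | no _     | yes refl | yes refl = contradiction (inj₂ (refl , refl)) ¬e
  ... | no _     | _        | yes refl | yes refl = contradiction (inj₂ (refl , refl)) ¬e
  ... | yes _    | no _     | no _     | _        = refl
  ... | yes _    | no _     | yes _    | no _     = refl
  ... | no _     | _        | no _     | _        = refl
  ... | no _     | _        | yes _    | no _     = refl

  ind>0⇒edge : {a b x y : Fin n} → 0 < ind a b x y → Edge a b x y
  ind>0⇒edge {a = a} {b} {x} {y} p with edge? a b x y
  ... | yes e = e
  ... | no ¬e = contradiction p (subst (λ k → ¬ 0 < k) (sym (ind-¬edge ¬e)) λ ())

  sum-ind : (a b x : Fin n) → sum (ind a b x) ≡ kron a x + kron b x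
  sum-ind a b x = begin
    sum (ind a b x)                                            ≡⟨ ∑-distrib-+ (λ y → kron a x * kron b y) (λ y → kron a y * kron b x) ⟩
    sum (λ y → kron a x * kron b y) + sum (λ y → kron a y * kron b x)      ≡⟨ cong₂ _+_ (sym (*-distribˡ-sum (kron a x) (kron b))) (sym (*-distribʳ-sum (kron b x) (kron a))) ⟩
    kron a x * sum (kron b) + sum (kron a) * kron b x                      ≡⟨ cong₂ (λ p q → kron a x * p + q * kron b x) (sum-kron b) (sum-kron a) ⟩
    kron a x * 1 + 1 * kron b x                                      ≡⟨ cong₂ _+_ (ℕ.*-identityʳ (kron a x)) (ℕ.*-identityˡ (kron b x)) ⟩
    kron a x + kron b x                                              ∎
    where open ≡-Reasoning

  sum²-ind : (a b : Fin n) → sum² (ind a b) ≡ 2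
  sum²-ind a b = begin
    sum (λ x → sum (ind a b x))    ≡⟨ sum-cong-≗ {x = λ x → sum (ind a b x)} (sum-ind a b) ⟩
    sum (λ x → kron a x + kron b x)      ≡⟨ ∑-distrib-+ (kron a) (kron b) ⟩
    sum (kron a) + sum (kron b)          ≡⟨ cong₂ _+_ (sum-kron a) (sum-kron b) ⟩
    2                              ∎
    where open ≡-Reasoning

  sum²-ind-* : (a b : Fin n) (c : ℕ) → sum² (λ x y → ind a b x y * c) ≡ 2 * c
  sum²-ind-* a b c = trans (sum²-*ʳ (ind a b) c) (cong (_* c) (sum²-ind a b))

  -- The corners of the 4-cycle `v`, `a`, `z`, `b`. A switch trades its opposite sides `v b`, `a z`
  -- for the other two, `v a`, `b z`.
  record Distinct (v a b z : Fin n) : Set where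
    field
      v≢a : v ≢ a
      v≢b : v ≢ b
      v≢z : v ≢ z
      a≢b : a ≢ b
      a≢z : a ≢ z
      b≢z : b ≢ z

  distinct-swap : {v a b z : Fin n} → Distinct v a b z → Distinct v b a z
  distinct-swap D = record
    { v≢a = v≢b ; v≢b = v≢a ; v≢z = v≢z ; a≢b = ≢-sym a≢b ; a≢z = b≢z ; b≢z = a≢z }
    where open Distinct D

  module _ {v a b z : Fin n} (D : Distinct v a b z) where
    open Distinct D

    record Values (x y : Fin n) (p q r s : ℕ) : Set where
      constructor values
      field
        va : ind v a x y ≡ p
        vb : ind v b x y ≡ q
        az : ind a z x y ≡ r
        bz : ind b z x y ≡ s

    -- Distinct corners make the four sides different edges, so a pair lies on at most one of them;
    -- each case carries all four indicator values for rewriting.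
    data Position (x y : Fin n) : Set where
      on-va : Edge v a x y → Values x y 1 0 0 0 → Position x y
      on-vb : Edge v b x y → Values x y 0 1 0 0 → Position x y
      on-az : Edge a z x y → Values x y 0 0 1 0 → Position x y
      on-bz : Edge b z x y → Values x y 0 0 0 1 → Position x y
      off   : Values x y 0 0 0 0 → Position x y

    private
      vavb : ¬ Edge v a v b
      vavb (inj₁ (_ , b≡a)) = a≢b (sym b≡a)
      vavb (inj₂ (v≡a , _)) = v≢a v≡a
      vaaz : ¬ Edge v a a z
      vaaz (inj₁ (a≡v , _)) = v≢a (sym a≡v)
      vaaz (inj₂ (_ , z≡v)) = v≢z (sym z≡v)
      vabz : ¬ Edge v a b z
      vabz (inj₁ (b≡v , _)) = v≢b (sym b≡v)
      vabz (inj₂ (_ , z≡v)) = v≢z (sym z≡v)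
      vbaz : ¬ Edge v b a z
      vbaz (inj₁ (a≡v , _)) = v≢a (sym a≡v)
      vbaz (inj₂ (_ , z≡v)) = v≢z (sym z≡v)
      vbbz : ¬ Edge v b b z
      vbbz (inj₁ (b≡v , _)) = v≢b (sym b≡v)
      vbbz (inj₂ (_ , z≡v)) = v≢z (sym z≡v)
      azbz : ¬ Edge a z b z
      azbz (inj₁ (b≡a , _)) = a≢b (sym b≡a)
      azbz (inj₂ (b≡z , _)) = b≢z b≡z

      other : ∀ {a b c d x y : Fin n} → ¬ Edge a b c d → Edge a b x y → ind c d x y ≡ 0
      other ¬e e = ind-¬edge λ e′ → ¬e (edge-trans e (edge-sym e′))

      other′ : ∀ {a b c d x y : Fin n} → ¬ Edge c d a b → Edge a b x y → ind c d x y ≡ 0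
      other′ ¬e e = ind-¬edge λ e′ → ¬e (edge-trans e′ (edge-sym e))

    position-va : ∀ {x y} → Edge v a x y → Values x y 1 0 0 0
    position-va e = values (ind-edge v≢a e) (other vavb e) (other vaaz e) (other vabz e)

    position-vb : ∀ {x y} → Edge v b x y → Values x y 0 1 0 0
    position-vb e = values (other′ vavb e) (ind-edge v≢b e) (other vbaz e) (other vbbz e)

    position-az : ∀ {x y} → Edge a z x y → Values x y 0 0 1 0
    position-az e = values (other′ vaaz e) (other′ vbaz e) (ind-edge a≢z e) (other azbz e)

    position-bz : ∀ {x y} → Edge b z x y → Values x y 0 0 0 1
    position-bz e = values (other′ vabz e) (other′ vbbz e) (other′ azbz e) (ind-edge b≢z e)

    position : ∀ x y → Position x y
    position x y with edge? v a x y | edge? v b x y | edge? a z x y | edge? b z x y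
    ... | yes e | _ | _ | _ = on-va e (position-va e)
    ... | no _ | yes e | _ | _ = on-vb e (position-vb e)
    ... | no _ | no _ | yes e | _ = on-az e (position-az e)
    ... | no _ | no _ | no _ | yes e = on-bz e (position-bz e)
    ... | no p | no q | no r | no s =
      off (values (ind-¬edge p) (ind-¬edge q) (ind-¬edge r) (ind-¬edge s))

    -- Once each matrix is supplemented on the four sides by the values of the other, both agree
    -- everywhere. Every side occurs as two ordered pairs, whence the factor 2.
    sum²-differ-at-square : (F G : Fin n → Fin n → ℕ) → Symmetric F → Symmetric G →
      (∀ x y → Values x y 0 0 0 0 → F x y ≡ G x y) →
      sum² F + 2 * ((G v a + G v b) + (G a z + G b z)) ≡
      sum² G + 2 * ((F v a + F v b) + (F a z + F b z))
    sum²-differ-at-square F G symF symG F≗G =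
      trans (sym (expand F G)) (trans (sum²-cong pointwise) (expand G F))
      where
      weight : (Fin n → Fin n → ℕ) → Fin n → Fin n → ℕ
      weight H x y = (ind v a x y * H v a + ind v b x y * H v b)
                   + (ind a z x y * H a z + ind b z x y * H b z)
      expand : ∀ H K → sum² (λ x y → H x y + weight K x y) ≡
                       sum² H + 2 * ((K v a + K v b) + (K a z + K b z))
      expand H K = begin
        sum² (λ x y → H x y + weight K x y)  ≡⟨ sum²-+ H (weight K) ⟩
        sum² H + sum² (weight K)             ≡⟨ cong (sum² H +_) (sum²-+ (λ x y → ind v a x y * K v a + ind v b x y * K v b) _) ⟩
        sum² H + (sum² (λ x y → ind v a x y * K v a + ind v b x y * K v b) +
                  sum² (λ x y → ind a z x y * K a z + ind b z x y * K b z))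
          ≡⟨ cong₂ (λ p q → sum² H + (p + q)) (sum²-+ (λ x y → ind v a x y * K v a) _) (sum²-+ (λ x y → ind a z x y * K a z) _) ⟩
        sum² H + ((sum² (λ x y → ind v a x y * K v a) + sum² (λ x y → ind v b x y * K v b)) +
                  (sum² (λ x y → ind a z x y * K a z) + sum² (λ x y → ind b z x y * K b z)))
          ≡⟨ cong₂ (λ p q → sum² H + (p + q))
               (cong₂ _+_ (sum²-ind-* v a (K v a)) (sum²-ind-* v b (K v b)))
               (cong₂ _+_ (sum²-ind-* a z (K a z)) (sum²-ind-* b z (K b z))) ⟩
        sum² H + ((2 * K v a + 2 * K v b) + (2 * K a z + 2 * K b z))
          ≡⟨ cong (sum² H +_) (factor (K v a) (K v b) (K a z) (K b z)) ⟩
        sum² H + 2 * ((K v a + K v b) + (K a z + K b z)) ∎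
        where
        open ≡-Reasoning
        factor : ∀ p q r s → (2 * p + 2 * q) + (2 * r + 2 * s) ≡ 2 * ((p + q) + (r + s))
        factor = solve-∀
      pointwise : ∀ x y → F x y + weight G x y ≡ G x y + weight F x y
      pointwise x y with position x y
      ... | on-va e (values p q r s) rewrite p | q | r | s | edge-resp symF e | edge-resp symG e = l (F v a) (G v a)
        where
        l : ∀ f g → f + ((1 * g + 0) + 0) ≡ g + ((1 * f + 0) + 0)
        l = solve-∀
      ... | on-vb e (values p q r s) rewrite p | q | r | s | edge-resp symF e | edge-resp symG e = l (F v b) (G v b)
        where
        l : ∀ f g → f + (1 * g + 0) ≡ g + (1 * f + 0)
        l = solve-∀
      ... | on-az e (values p q r s) rewrite p | q | r | s | edge-resp symF e | edge-resp symG e = l (F a z) (G a z)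
        where
        l : ∀ f g → f + (1 * g + 0) ≡ g + (1 * f + 0)
        l = solve-∀
      ... | on-bz e (values p q r s) rewrite p | q | r | s | edge-resp symF e | edge-resp symG e = l (F b z) (G b z)
        where
        l : ∀ f g → f + (1 * g) ≡ g + (1 * f)
        l = solve-∀
      ... | off o@(values p q r s) rewrite p | q | r | s = cong (_+ 0) (F≗G x y o)

-- Connectivity under switches of multigraphs with boundedly many doubled edges.

module Multigraphs where

  open import Data.Fin.Base using (Fin; zero; suc)
  import Data.Fin.Properties as Fin
  open import Data.Nat.Base using (ℕ; zero; suc; _+_; _*_; _∸_; _≤_; _<_; z≤n; s≤s; ∣_-_∣; s≤s⁻¹)
  import Data.Nat.Properties as ℕ
  open import Data.Nat.Tactic.RingSolver using (solve-∀)
  open import Data.Product.Base using (_×_; _,_; ∃-syntax)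
  open import Data.Sum.Base using (_⊎_; inj₁; inj₂)
  open import Algebra.Properties.Semiring.Sum ℕ.+-*-semiring using (sum; sum-cong-≗; ∑-distrib-+)
  open import Relation.Binary.PropositionalEquality
    using (_≡_; _≢_; refl; sym; trans; cong; cong₂; subst; subst₂; ≢-sym; module ≡-Reasoning)
  open import Relation.Nullary.Decidable using (Dec; yes; no; ¬?; _×-dec_; decidable-stable)
  open import Relation.Nullary.Negation using (¬_; contradiction)
  open FiniteSums
  open Edges

  dbl : ℕ → ℕ
  dbl 2 = 1
  dbl _ = 0

  -- The price of moving one unit from `q` to `p`: for entries that stay at most 2, the number of
  -- doubled entries rises exactly when both are 1.
  both1 : ℕ → ℕ → ℕ
  both1 1 1 = 1
  both1 _ _ = 0

  both1-< : ∀ {p q} → q ≤ 2 → p < q → both1 p q ≡ 0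
  both1-< {0} _ _ = refl
  both1-< {1} {1} _ (s≤s ())
  both1-< {1} {suc (suc _)} _ _ = refl
  both1-< {suc (suc _)} _ _ = refl

  -- Moving one unit of multiplicity from q to p.
  dbl-transfer : ∀ {p q q′} → p ≤ 1 → q ≤ 2 → q ≡ suc q′ →
                 (dbl (suc p) + dbl q′) + both1 q′ (suc p) ≡ (dbl p + dbl q) + both1 p q
  dbl-transfer {0} {1} _ _ refl = refl
  dbl-transfer {0} {2} _ _ refl = refl
  dbl-transfer {1} {1} _ _ refl = refl
  dbl-transfer {1} {2} _ _ refl = refl
  dbl-transfer {_} {suc (suc (suc _))} _ (s≤s (s≤s ())) _
  dbl-transfer {suc (suc _)} (s≤s ()) _ _

  module _ {n : ℕ} where

    Graph : Set
    Graph = Fin n → Fin n → ℕ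

    doubles : Graph → ℕ
    doubles M = sum² λ x y → dbl (M x y)

    infix 4 _≐_
    _≐_ : Graph → Graph → Set
    M ≐ N = ∀ x y → M x y ≡ N x y

    -- Every doubled pair is counted twice by doubles, and hence by B.
    record Admissible (deg : Fin n → ℕ) (B : ℕ) (M : Graph) : Set where
      field
        symmetric : Symmetric M
        loopless  : ∀ x → M x x ≡ 0
        bounded   : ∀ x y → M x y ≤ 2
        degree    : ∀ x → sum (M x) ≡ deg x
        doubles≤  : doubles M ≤ B

    -- A switch needs room for every pair it doubles, even if it also undoubles others;
    -- thus a switch and its inverse cost the same.
    cost : Graph → (v a b z : Fin n) → ℕ
    cost M v a b z = doubles M + 2 * (both1 (M v a) (M v b) + both1 (M b z) (M a z))

    -- In additive form the equation itself forces `v b` and `a z` to be present in `M`.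
    record Switch (B : ℕ) (M M′ : Graph) : Set where
      constructor switch
      field
        {v a b z} : Fin n
        distinct : Distinct v a b z
        equation : ∀ x y → M′ x y + (ind v b x y + ind a z x y) ≡ M x y + (ind v a x y + ind b z x y)
        cost≤    : cost M v a b z ≤ B

    module Switched {M M′ : Graph} {v a b z : Fin n} (D : Distinct v a b z)
      (equation : ∀ x y → M′ x y + (ind v b x y + ind a z x y) ≡ M x y + (ind v a x y + ind b z x y)) where

      private
        inc : ∀ {x y p q r s} → Values D x y p q r s → M′ x y + (q + r) ≡ M x y + (p + s)
        inc {x} {y} (values p q r s) = subst₂ _≡_ (cong₂ (λ i j → M′ x y + (i + j)) q r)
                                                  (cong₂ (λ i j → M x y + (i + j)) p s) (equation x y)

      va : M′ v a ≡ suc (M v a)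
      va = trans (sym (ℕ.+-identityʳ _)) (trans (inc (position-va D (inj₁ (refl , refl)))) (ℕ.+-comm _ 1))

      bz : M′ b z ≡ suc (M b z)
      bz = trans (sym (ℕ.+-identityʳ _)) (trans (inc (position-bz D (inj₁ (refl , refl)))) (ℕ.+-comm _ 1))

      vb : M v b ≡ suc (M′ v b)
      vb = sym (trans (ℕ.+-comm 1 _) (trans (inc (position-vb D (inj₁ (refl , refl)))) (ℕ.+-identityʳ _)))

      az : M a z ≡ suc (M′ a z)
      az = sym (trans (ℕ.+-comm 1 _) (trans (inc (position-az D (inj₁ (refl , refl)))) (ℕ.+-identityʳ _)))

      off-square : ∀ x y → Values D x y 0 0 0 0 → M′ x y ≡ M x y
      off-square x y o = ℕ.+-cancelʳ-≡ 0 _ _ (inc o)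

      sum²-switched : (H : Fin n → Fin n → ℕ → ℕ) → (∀ x y k → H x y k ≡ H y x k) →
        Symmetric M → Symmetric M′ →
        sum² (λ x y → H x y (M′ x y)) + 2 * ((H v a (M v a) + H v b (M v b)) + (H a z (M a z) + H b z (M b z))) ≡
        sum² (λ x y → H x y (M x y)) + 2 * ((H v a (M′ v a) + H v b (M′ v b)) + (H a z (M′ a z) + H b z (M′ b z)))
      sum²-switched H symH symM symM′ = sum²-differ-at-square D _ _
        (λ x y → trans (symH x y _) (cong (H y x) (symM′ x y)))
        (λ x y → trans (symH x y _) (cong (H y x) (symM x y)))
        (λ x y o → cong (H x y) (off-square x y o))

      -- On each side of the square, `dbl-transfer` balances the doubled entries and the price of
      -- the transfer against those of the transfer back.
      cost-inverse : Symmetric M → Symmetric M′ → (∀ x y → M x y ≤ 2) → (∀ x y → M′ x y ≤ 2) →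
                     cost M′ v b a z ≡ cost M v a b z
      cost-inverse symM symM′ M≤2 M′≤2 = ℕ.+-cancelʳ-≡ (2 * old) _ _ (begin
        (doubles M′ + 2 * (both1 (M′ v b) (M′ v a) + both1 (M′ a z) (M′ b z))) + 2 * old
          ≡⟨ l₁ (doubles M′) (both1 (M′ v b) (M′ v a) + both1 (M′ a z) (M′ b z)) old ⟩
        (doubles M′ + 2 * old) + 2 * (both1 (M′ v b) (M′ v a) + both1 (M′ a z) (M′ b z))
          ≡⟨ cong (_+ 2 * (both1 (M′ v b) (M′ v a) + both1 (M′ a z) (M′ b z)))
               (sum²-switched (λ _ _ → dbl) (λ _ _ _ → refl) symM symM′) ⟩
        (doubles M + 2 * ((dbl (M′ v a) + dbl (M′ v b)) + (dbl (M′ a z) + dbl (M′ b z))))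
          + 2 * (both1 (M′ v b) (M′ v a) + both1 (M′ a z) (M′ b z))
          ≡⟨ l₂ (doubles M) (dbl (M′ v a)) (dbl (M′ v b)) (dbl (M′ a z)) (dbl (M′ b z)) (both1 (M′ v b) (M′ v a)) (both1 (M′ a z) (M′ b z)) ⟩
        doubles M + 2 * (((dbl (M′ v a) + dbl (M′ v b)) + both1 (M′ v b) (M′ v a))
                       + ((dbl (M′ b z) + dbl (M′ a z)) + both1 (M′ a z) (M′ b z)))
          ≡⟨ cong₂ (λ p q → doubles M + 2 * (p + q)) (transfer va vb) (transfer bz az) ⟩
        doubles M + 2 * (((dbl (M v a) + dbl (M v b)) + both1 (M v a) (M v b))
                       + ((dbl (M b z) + dbl (M a z)) + both1 (M b z) (M a z)))
          ≡⟨ l₃ (doubles M) (dbl (M v a)) (dbl (M v b)) (dbl (M a z)) (dbl (M b z)) (both1 (M v a) (M v b)) (both1 (M b z) (M a z)) ⟩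
        (doubles M + 2 * (both1 (M v a) (M v b) + both1 (M b z) (M a z))) + 2 * old ∎)
        where
        open ≡-Reasoning
        old = (dbl (M v a) + dbl (M v b)) + (dbl (M a z) + dbl (M b z))
        transfer : ∀ {x y x′ y′} → M′ x y ≡ suc (M x y) → M x′ y′ ≡ suc (M′ x′ y′) →
                   (dbl (M′ x y) + dbl (M′ x′ y′)) + both1 (M′ x′ y′) (M′ x y) ≡
                   (dbl (M x y) + dbl (M x′ y′)) + both1 (M x y) (M x′ y′)
        transfer {x} {y} {x′} {y′} e e′ rewrite e =
          dbl-transfer (s≤s⁻¹ (subst (_≤ 2) e (M′≤2 x y))) (M≤2 x′ y′) e′
        l₁ : ∀ d p s → (d + 2 * p) + 2 * s ≡ (d + 2 * s) + 2 * p
        l₁ = solve-∀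
        l₂ : ∀ d p q r s t u → (d + 2 * ((p + q) + (r + s))) + 2 * (t + u) ≡ d + 2 * (((p + q) + t) + ((s + r) + u))
        l₂ = solve-∀
        l₃ : ∀ d p q r s t u → d + 2 * (((p + q) + t) + ((s + r) + u)) ≡ (d + 2 * (t + u)) + 2 * ((p + q) + (r + s))
        l₃ = solve-∀

    module _ {deg : Fin n → ℕ} {B : ℕ} where
      open Admissible

      private
        Adm = Admissible deg B

      switch-inverse : ∀ {M M′} → Adm M → Adm M′ → Switch B M M′ → Switch B M′ M
      switch-inverse {M} {M′} AM AM′ (switch D eq c) =
        switch (distinct-swap D) (λ x y → sym (eq x y))
          (subst (_≤ B) (sym (cost-inverse (symmetric AM) (symmetric AM′) (bounded AM) (bounded AM′))) c)
        where open Switched {M} {M′} D eq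

      -- An off-diagonal pair appears in both orders, so one strict increase already contributes 2.
      doubles-grow : ∀ {M N x y} → x ≢ y → (∀ x y → dbl (M x y) ≤ dbl (N x y)) → Symmetric M → Symmetric N →
                     dbl (M x y) < dbl (N x y) → doubles M + 2 ≤ doubles N
      doubles-grow {M} {N} {x} {y} x≢y M≤N symM symN lt = begin
        doubles M + 2                                 ≡⟨ cong (doubles M +_) (sum²-ind x y) ⟨
        doubles M + sum² (ind x y)                    ≡⟨ sum²-+ (λ p q → dbl (M p q)) (ind x y) ⟨
        sum² (λ p q → dbl (M p q) + ind x y p q)      ≤⟨ sum²-mono-≤ _ _ pointwise ⟩
        doubles N                                     ∎
        where
        open ℕ.≤-Reasoning
        pointwise : ∀ p q → dbl (M p q) + ind x y p q ≤ dbl (N p q)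
        pointwise p q with edge? x y p q
        ... | yes e rewrite ind-edge x≢y e | edge-resp symM e | edge-resp symN e = subst (_≤ dbl (N x y)) (ℕ.+-comm 1 _) lt
        ... | no ¬e rewrite ind-¬edge ¬e = subst (_≤ dbl (N p q)) (sym (ℕ.+-identityʳ _)) (M≤N p q)

      dist : Graph → Graph → ℕ
      dist M N = sum² λ x y → ∣ M x y - N x y ∣

      dist-comm : ∀ M N → dist M N ≡ dist N M
      dist-comm M N = sum²-cong λ x y → ℕ.∣-∣-comm (M x y) (N x y)

      private
        ∣-∣-up : ∀ {m n} → m < n → suc ∣ suc m - n ∣ ≡ ∣ m - n ∣
        ∣-∣-up {zero}  {suc n} _ = refl
        ∣-∣-up {suc m} {suc n} (s≤s lt) = ∣-∣-up lt

        ∣-∣-down : ∀ {m n} → n ≤ m → suc ∣ m - n ∣ ≡ ∣ suc m - n ∣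
        ∣-∣-down {m} {zero} _ = cong suc (ℕ.∣-∣-identityʳ m)
        ∣-∣-down {suc m} {suc n} (s≤s le) = ∣-∣-down le

        ∣-∣-suc : ∀ m n → ∣ suc m - n ∣ ≤ suc ∣ m - n ∣
        ∣-∣-suc m zero = s≤s (ℕ.≤-reflexive (sym (ℕ.∣-∣-identityʳ m)))
        ∣-∣-suc zero (suc n) = ℕ.m≤n⇒m≤1+n (ℕ.m≤n⇒m≤1+n ℕ.≤-refl)
        ∣-∣-suc (suc m) (suc n) = ∣-∣-suc m n

        ∣-∣-sucˡ : ∀ m n → ∣ m - n ∣ ≤ suc ∣ suc m - n ∣
        ∣-∣-sucˡ m n = begin
          ∣ m - n ∣              ≡⟨ ℕ.∣-∣-comm m n ⟩
          ∣ n - m ∣              ≤⟨ lemma n m ⟩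
          suc ∣ n - suc m ∣      ≡⟨ cong suc (ℕ.∣-∣-comm n (suc m)) ⟩
          suc ∣ suc m - n ∣      ∎
          where
          open ℕ.≤-Reasoning
          lemma : ∀ n m → ∣ n - m ∣ ≤ suc ∣ n - suc m ∣
          lemma zero m = ℕ.m≤n⇒m≤1+n (ℕ.n≤1+n m)
          lemma (suc n) zero = ℕ.≤-reflexive (cong suc (sym (ℕ.∣-∣-identityʳ n)))
          lemma (suc n) (suc m) = lemma n m

        -- The hypothesis says that the surplus of the entry to be lowered plus the deficit of the
        -- entry to be raised is positive. So one of the two changes goes towards its target and
        -- gains 1, while the other loses at most 1.
        transfer-closer : ∀ p q r s → r + q < suc p + s →
                          ∣ p - r ∣ + ∣ suc q - s ∣ ≤ ∣ suc p - r ∣ + ∣ q - s ∣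
        transfer-closer p q r s lt with r ℕ.≤? p
        ... | yes r≤p = begin
          ∣ p - r ∣ + ∣ suc q - s ∣      ≤⟨ ℕ.+-monoʳ-≤ ∣ p - r ∣ (∣-∣-suc q s) ⟩
          ∣ p - r ∣ + suc ∣ q - s ∣      ≡⟨ ℕ.+-suc _ _ ⟩
          suc ∣ p - r ∣ + ∣ q - s ∣      ≡⟨ cong (_+ ∣ q - s ∣) (∣-∣-down r≤p) ⟩
          ∣ suc p - r ∣ + ∣ q - s ∣      ∎
          where open ℕ.≤-Reasoning
        ... | no r≰p = begin
          ∣ p - r ∣ + ∣ suc q - s ∣            ≤⟨ ℕ.+-monoˡ-≤ _ (∣-∣-sucˡ p r) ⟩
          suc ∣ suc p - r ∣ + ∣ suc q - s ∣    ≡⟨ ℕ.+-suc _ _ ⟨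
          ∣ suc p - r ∣ + suc ∣ suc q - s ∣    ≡⟨ cong (∣ suc p - r ∣ +_) (∣-∣-up q<s) ⟩
          ∣ suc p - r ∣ + ∣ q - s ∣            ∎
          where
          open ℕ.≤-Reasoning
          q<s : q < s
          q<s = ℕ.+-cancelˡ-< r q s (ℕ.<-≤-trans lt (ℕ.+-monoˡ-≤ s (ℕ.≰⇒> r≰p)))

      module _ {M N : Graph} (AM : Adm M) (AN : Adm N) {v a b z : Fin n}
        (va : M v a < N v a) (vb : N v b < M v b) (az : M b z < M a z)
        (toward : N a z + M b z < M a z + N b z) (z≢b : z ≢ b)
        (c : doubles M + 2 * both1 (M v a) (M v b) ≤ B) where

        private
          D : Distinct v a b z
          D = record
            { v≢a = λ { refl → ℕ.n≮0 (subst (M v v <_) (loopless AN v) va) }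
            ; v≢b = λ { refl → ℕ.n≮0 (subst (N v v <_) (loopless AM v) vb) }
            -- For `z` equal to `v`, adding the inequalities `va` and `vb` gives the reverse of
            -- `toward`.
            ; v≢z = λ { refl → ℕ.<-asym toward (subst₂ _<_ (cong₂ _+_ (symmetric AM v a) (symmetric AN v b))
                           (trans (ℕ.+-comm (N v a) (M v b)) (trans (cong₂ _+_ (symmetric AM v b) (symmetric AN v a)) (ℕ.+-comm (M b v) (N a v)))) (ℕ.+-mono-< va vb)) }
            ; a≢b = λ { refl → ℕ.<-asym va vb }
            ; a≢z = λ { refl → ℕ.n≮0 (subst (M b a <_) (loopless AM a) az) }
            ; b≢z = ≢-sym z≢b
            }

          added removed : Fin n → Fin n → ℕ
          added   x y = ind v a x y + ind b z x y
          removed x y = ind v b x y + ind a z x y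

          M′ : Graph
          M′ x y = (M x y + added x y) ∸ removed x y

          removable : ∀ x y → removed x y ≤ M x y + added x y
          removable x y with position D x y
          ... | on-va e (values p q r s) rewrite q | r = z≤n
          ... | on-vb e (values p q r s) rewrite q | r | edge-resp (symmetric AM) e = ℕ.m≤n⇒m≤n+o _ (ℕ.m<n⇒0<n vb)
          ... | on-az e (values p q r s) rewrite q | r | edge-resp (symmetric AM) e = ℕ.m≤n⇒m≤n+o _ (ℕ.m<n⇒0<n az)
          ... | on-bz e (values p q r s) rewrite q | r = z≤n
          ... | off (values p q r s) rewrite q | r = z≤n

          eq : ∀ x y → M′ x y + removed x y ≡ M x y + added x y
          eq x y = ℕ.m∸n+n≡m (removable x y)

          open Switched {M} {M′} D eq renaming (va to va′; vb to vb′; az to az′; bz to bz′)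

          symM′ : Symmetric M′
          symM′ x y = cong₂ _∸_ (cong₂ _+_ (symmetric AM x y) (cong₂ _+_ (ind-sym v a x y) (ind-sym b z x y)))
                                (cong₂ _+_ (ind-sym v b x y) (ind-sym a z x y))

          -- The raised entries stay bounded because `M v a < N v a` and `M b z < M a z`, where the
          -- larger values are at most 2.
          bounded′ : ∀ x y → M′ x y ≤ 2
          bounded′ x y with position D x y
          ... | on-va e _ = subst (_≤ 2) (trans (sym va′) (sym (edge-resp symM′ e))) (ℕ.≤-trans va (bounded AN v a))
          ... | on-vb e _ = subst (_≤ 2) (sym (edge-resp symM′ e)) (ℕ.≤-trans (ℕ.n≤1+n _) (subst (_≤ 2) vb′ (bounded AM v b)))
          ... | on-az e _ = subst (_≤ 2) (sym (edge-resp symM′ e)) (ℕ.≤-trans (ℕ.n≤1+n _) (subst (_≤ 2) az′ (bounded AM a z)))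
          ... | on-bz e _ = subst (_≤ 2) (trans (sym bz′) (sym (edge-resp symM′ e))) (ℕ.≤-trans az (bounded AM a z))
          ... | off o = subst (_≤ 2) (sym (off-square x y o)) (bounded AM x y)

          degree′ : ∀ x → sum (M′ x) ≡ sum (M x)
          degree′ x = ℕ.+-cancelʳ-≡ ((kron v x + kron b x) + (kron a x + kron z x)) _ _ (begin
            sum (M′ x) + ((kron v x + kron b x) + (kron a x + kron z x))   ≡⟨ cong (sum (M′ x) +_) (sum-inds v b a z) ⟨
            sum (M′ x) + sum (removed x)                       ≡⟨ ∑-distrib-+ (M′ x) (removed x) ⟨
            sum (λ y → M′ x y + removed x y)                   ≡⟨ sum-cong-≗ (eq x) ⟩
            sum (λ y → M x y + added x y)                      ≡⟨ ∑-distrib-+ (M x) (added x) ⟩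
            sum (M x) + sum (added x)                          ≡⟨ cong (sum (M x) +_) (sum-inds v a b z) ⟩
            sum (M x) + ((kron v x + kron a x) + (kron b x + kron z x))    ≡⟨ cong (sum (M x) +_) (l (kron v x) (kron a x) (kron b x) (kron z x)) ⟩
            sum (M x) + ((kron v x + kron b x) + (kron a x + kron z x))    ∎)
            where
            open ≡-Reasoning
            sum-inds : ∀ a b c d → sum (λ y → ind a b x y + ind c d x y) ≡ (kron a x + kron b x) + (kron c x + kron d x)
            sum-inds a b c d = trans (∑-distrib-+ (ind a b x) (ind c d x)) (cong₂ _+_ (sum-ind a b x) (sum-ind c d x))
            l : ∀ p q r s → (p + q) + (r + s) ≡ (p + r) + (q + s)
            l = solve-∀

          -- At `z` the raised entry is smaller than the lowered one, so by `both1-<` only the side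
          -- at `v` has a price.
          cost′ : cost M v a b z ≤ B
          cost′ = subst (_≤ B) (cong (λ k → doubles M + 2 * k)
            (trans (sym (ℕ.+-identityʳ _)) (cong (both1 (M v a) (M v b) +_) (sym (both1-< (bounded AM a z) az))))) c

          adm : Adm M′
          adm = record
            { symmetric = symM′
            ; loopless  = λ x → trans (off-square x x (loop-off x)) (loopless AM x)
            ; bounded   = bounded′
            ; degree    = λ x → trans (degree′ x) (degree AM x)
            ; doubles≤  = ℕ.≤-trans (ℕ.m≤m+n _ _)
                (subst (_≤ B) (sym (cost-inverse (symmetric AM) symM′ (bounded AM) bounded′)) cost′)
            }
            where
            open Distinct D
            loop : ∀ {a b x : Fin n} → a ≢ b → ind a b x x ≡ 0
            loop {a} {b} {x} a≢b = ind-¬edge {a = a} {b} {x} {x} λ { (inj₁ (refl , refl)) → a≢b refl ; (inj₂ (refl , refl)) → a≢b refl }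
            loop-off : ∀ x → Values D x x 0 0 0 0
            loop-off x = values (loop v≢a) (loop v≢b) (loop a≢z) (loop b≢z)

          -- The entries at `v a` and `v b` each move one unit towards `N`, and by `transfer-closer`
          -- the two entries at `z` together do not get worse.
          closer : dist M′ N < dist M N
          closer = ℕ.+-cancelʳ-< (2 * old) _ _ (begin-strict
            dist M′ N + 2 * old  ≡⟨ sum²-switched (λ x y k → ∣ k - N x y ∣) (λ x y k → cong (∣ k -_∣) (symmetric AN x y)) (symmetric AM) symM′ ⟩
            dist M N + 2 * new   <⟨ ℕ.+-monoʳ-< (dist M N) (ℕ.*-monoʳ-< 2 new<old) ⟩
            dist M N + 2 * old   ∎)
            where
            open ℕ.≤-Reasoning
            old = (∣ M v a - N v a ∣ + ∣ M v b - N v b ∣) + (∣ M a z - N a z ∣ + ∣ M b z - N b z ∣)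
            new = (∣ M′ v a - N v a ∣ + ∣ M′ v b - N v b ∣) + (∣ M′ a z - N a z ∣ + ∣ M′ b z - N b z ∣)
            va< : ∣ M′ v a - N v a ∣ < ∣ M v a - N v a ∣
            va< = ℕ.≤-reflexive (trans (cong (λ k → suc ∣ k - N v a ∣) va′) (∣-∣-up va))
            vb< : ∣ M′ v b - N v b ∣ < ∣ M v b - N v b ∣
            vb< = ℕ.≤-reflexive (trans (∣-∣-down (s≤s⁻¹ (subst (N v b <_) vb′ vb))) (cong (∣_- N v b ∣) (sym vb′)))
            azbz≤ : ∣ M′ a z - N a z ∣ + ∣ M′ b z - N b z ∣ ≤ ∣ M a z - N a z ∣ + ∣ M b z - N b z ∣
            azbz≤ = subst₂ (λ p q → ∣ M′ a z - N a z ∣ + ∣ q - N b z ∣ ≤ ∣ p - N a z ∣ + ∣ M b z - N b z ∣) (sym az′) (sym bz′)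
              (transfer-closer (M′ a z) (M b z) (N a z) (N b z) (subst (λ k → N a z + M b z < k + N b z) az′ toward))
            new<old : new < old
            new<old = ℕ.+-mono-<-≤ (ℕ.+-mono-< va< vb<) azbz≤

        improve : ∃[ M′ ] Adm M′ × Switch B M M′ × dist M′ N < dist M N
        improve = M′ , adm , switch D eq cost′ , closer

      infix 4 _⇝_
      -- `same` absorbs pointwise equality of matrices, and `_then_` lets a connection grow at
      -- either end.
      data _⇝_ : Graph → Graph → Set where
        same   : ∀ {M N} → M ≐ N → M ⇝ N
        switch : ∀ {M N} → Adm M → Adm N → Switch B M N → M ⇝ N
        _then_ : ∀ {M K N} → M ⇝ K → K ⇝ N → M ⇝ N

      private
        find-z : ∀ {M N} → Adm M → Adm N → ∀ {v a b} → M v a < N v a → N v b < M v b →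
                 ∃[ z ] z ≢ a × z ≢ b × N a z + M b z < M a z + N b z
        find-z {M} {N} AM AN {v} {a} {b} va vb = found
          where
          -- The correction terms make `F` and `G` equal at `a` and at `b`, so that the index found
          -- is neither of them; they add the same total to both sums.
          F G : Fin n → ℕ
          F z = (M a z + N b z) + (kron a z * M a b + kron b z * N a b)
          G z = (N a z + M b z) + (kron a z * N a b + kron b z * M a b)
          v≢a : v ≢ a
          v≢a refl = ℕ.n≮0 (subst (M v v <_) (loopless AN v) va)
          v≢b : v ≢ b
          v≢b refl = ℕ.n≮0 (subst (N v v <_) (loopless AM v) vb)
          a≢b : a ≢ b
          a≢b refl = ℕ.<-asym va vb
          away : ∀ {z} → a ≢ z → b ≢ z → ∀ p q k → k + (kron a z * p + kron b z * q) ≡ k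
          away a≢z b≢z p q k rewrite kron-≢ a≢z | kron-≢ b≢z = ℕ.+-identityʳ k
          sum-expand : ∀ (P Q : Graph) p q → sum (λ z → (P a z + Q b z) + (kron a z * p + kron b z * q)) ≡ (sum (P a) + sum (Q b)) + (p + q)
          sum-expand P Q p q = trans (∑-distrib-+ (λ z → P a z + Q b z) (λ z → kron a z * p + kron b z * q))
            (cong₂ _+_ (∑-distrib-+ (P a) (Q b))
              (trans (∑-distrib-+ (λ z → kron a z * p) (λ z → kron b z * q))
                     (cong₂ _+_ (sum-kron-* a (λ _ → p)) (sum-kron-* b (λ _ → q)))))
          ΣF≡ΣG : sum F ≡ sum G
          ΣF≡ΣG = trans (sum-expand M N (M a b) (N a b)) (trans
            (cong₂ _+_ (cong₂ _+_ (trans (degree AM a) (sym (degree AN a))) (trans (degree AN b) (sym (degree AM b))))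
                       (ℕ.+-comm (M a b) (N a b)))
            (sym (sum-expand N M (N a b) (M a b))))
          Fv<Gv : F v < G v
          Fv<Gv = subst₂ _<_ (sym (away (≢-sym v≢a) (≢-sym v≢b) _ _ _)) (sym (away (≢-sym v≢a) (≢-sym v≢b) _ _ _))
            (ℕ.+-mono-< (subst₂ _<_ (symmetric AM v a) (symmetric AN v a) va)
                        (subst₂ _<_ (symmetric AN v b) (symmetric AM v b) vb))
          found : ∃[ z ] z ≢ a × z ≢ b × N a z + M b z < M a z + N b z
          found with z , lt ← sum-≡⇒∃> F G ΣF≡ΣG Fv<Gv = z , z≢a , z≢b , subst₂ _<_ (away (≢-sym z≢a) (≢-sym z≢b) _ _ _) (away (≢-sym z≢a) (≢-sym z≢b) _ _ _) lt
            where
            z≢a : z ≢ a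
            z≢a refl = ℕ.<⇒≢ lt Ga≡Fa
              where
              Ga≡Fa : G a ≡ F a
              Ga≡Fa rewrite kron-refl a | kron-≢ (≢-sym a≢b) | loopless AM a | loopless AN a
                | symmetric AM b a | symmetric AN b a = l (M a b) (N a b)
                where
                l : ∀ p q → p + (1 * q + 0) ≡ q + (1 * p + 0)
                l = solve-∀
            z≢b : z ≢ b
            z≢b refl = ℕ.<⇒≢ lt Gb≡Fb
              where
              Gb≡Fb : G b ≡ F b
              Gb≡Fb rewrite kron-refl b | kron-≢ a≢b | loopless AM b | loopless AN b = l (M a b) (N a b)
                where
                l : ∀ p q → (q + 0) + (1 * p) ≡ (p + 0) + (1 * q)
                l = solve-∀

        -- Room is required in both graphs, because only the later choice of `z` decides whether `M`
        -- or `N` is the one to be changed.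
        Allowed : Graph → Graph → Fin n → Fin n → Fin n → Set
        Allowed M N v a b = M v a < N v a × N v b < M v b
                          × doubles M + 2 * both1 (M v a) (M v b) ≤ B
                          × doubles N + 2 * both1 (N v b) (N v a) ≤ B

        allowed? : ∀ M N v a b → Dec (Allowed M N v a b)
        allowed? M N v a b = M v a ℕ.<? N v a ×-dec N v b ℕ.<? M v b ×-dec _ ℕ.≤? B ×-dec _ ℕ.≤? B

        allowed-step : ∀ {M N} → Adm M → Adm N → ∀ {v a b} → Allowed M N v a b →
          (∃[ M′ ] Adm M′ × Switch B M M′ × dist M′ N < dist M N) ⊎
          (∃[ N′ ] Adm N′ × Switch B N N′ × dist M N′ < dist M N)
        allowed-step {M} {N} AM AN {v} {a} {b} (va , vb , cM , cN)
          with z , z≢a , z≢b , toward ← find-z AM AN va vb | M b z ℕ.<? M a z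
        ... | yes az = inj₁ (improve AM AN va vb az toward z≢b cM)
        -- Now `M a z` is at most `M b z`, so `toward` forces `N a z < N b z`, and `N` can be
        -- improved with the roles of `a` and `b` exchanged.
        ... | no ¬az =
          let N′ , AN′ , s , closer = improve AN AM vb va bz
                (subst₂ _<_ (ℕ.+-comm (N a z) (M b z)) (ℕ.+-comm (M a z) (N b z)) toward) z≢a cN
          in inj₂ (N′ , AN′ , s , subst₂ _<_ (dist-comm N′ M) (dist-comm N M) closer)
          where
          bz : N a z < N b z
          bz = ℕ.+-cancelˡ-< (M b z) _ _ (ℕ.<-≤-trans (subst (_< M a z + N b z) (ℕ.+-comm (N a z) (M b z)) toward)
                                                     (ℕ.+-monoˡ-≤ (N b z) (ℕ.≮⇒≥ ¬az)))

        -- One of the two rows at `v` is already 1 wherever they differ. Merging leaves that row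
        -- unchanged and therefore keeps the degree of `v`.
        Mixed : Graph → Graph → Fin n → Set
        Mixed M N v = (∀ x → M v x ≢ N v x → M v x ≡ 1) ⊎ (∀ x → M v x ≢ N v x → N v x ≡ 1)

        -- Since `X` alone fits, failure means that the price is 1, so `p` and `q` are 1; the bounds
        -- then leave one value each for `r` and `s`.
        both1-small : ∀ {X p q r s} → p < r → r ≤ 2 → s < q → q ≤ 2 → X ≤ B → ¬ X + 2 * both1 p q ≤ B →
                      p ≡ 1 × r ≡ 2 × q ≡ 1 × s ≡ 0
        both1-small {p = 1} {1} {2} {0} _ _ _ _ X≤B ¬le = refl , refl , refl , refl
        both1-small {p = 1} {2} {2} {0} _ _ _ _ X≤B ¬le = contradiction (subst (_≤ B) (sym (ℕ.+-identityʳ _)) X≤B) ¬le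
        both1-small {p = 1} {2} {2} {1} _ _ _ _ X≤B ¬le = contradiction (subst (_≤ B) (sym (ℕ.+-identityʳ _)) X≤B) ¬le
        both1-small {p = 0} _ _ _ _ X≤B ¬le = contradiction (subst (_≤ B) (sym (ℕ.+-identityʳ _)) X≤B) ¬le
        both1-small {p = 1} {r = 1} (s≤s ()) _ _ _ _ _
        both1-small {p = suc (suc _)} {r = 1} (s≤s ()) _ _ _ _ _
        both1-small {p = suc (suc _)} {r = 2} (s≤s (s≤s ())) _ _ _ _ _
        both1-small {r = suc (suc (suc _))} _ (s≤s (s≤s ())) _ _ _ _
        both1-small {q = 1} {s = suc _} _ _ (s≤s ()) _ _ _
        both1-small {q = 2} {s = suc (suc _)} _ _ (s≤s (s≤s ())) _ _ _
        both1-small {q = suc (suc (suc _))} _ _ _ (s≤s (s≤s ())) _ _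

      -- When no switch towards the other graph is possible, the graph that is 1 where
      -- M and N differ lies strictly between them.
      module Stuck {M N : Graph} (AM : Adm M) (AN : Adm N) {v₀ x₀ : Fin n} (M≢N : M v₀ x₀ ≢ N v₀ x₀)
        (stuck : ∀ v a b → ¬ Allowed M N v a b) where

        blocked : ∀ v {a b} → M v a < N v a → N v b < M v b →
                  (¬ doubles M + 2 * both1 (M v a) (M v b) ≤ B × M v a ≡ 1 × N v a ≡ 2 × M v b ≡ 1 × N v b ≡ 0) ⊎
                  (¬ doubles N + 2 * both1 (N v b) (N v a) ≤ B × N v b ≡ 1 × M v b ≡ 2 × N v a ≡ 1 × M v a ≡ 0)
        blocked v {a} {b} va vb with doubles M + 2 * both1 (M v a) (M v b) ℕ.≤? B
                                   | doubles N + 2 * both1 (N v b) (N v a) ℕ.≤? B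
        ... | yes p | yes q = contradiction (va , vb , p , q) (stuck v a b)
        ... | no ¬p | _ = inj₁ (¬p , both1-small va (bounded AN v a) vb (bounded AM v b) (doubles≤ AM) ¬p)
        ... | yes _ | no ¬q = inj₂ (¬q , both1-small vb (bounded AM v b) va (bounded AN v a) (doubles≤ AN) ¬q)

        degrees-agree : ∀ v → sum (M v) ≡ sum (N v)
        degrees-agree v = trans (degree AM v) (sym (degree AN v))

        triple : ∀ {v x} → M v x ≢ N v x → ∃[ a ] ∃[ b ] M v a < N v a × N v b < M v b
        triple {v} {x} ne with M v x ℕ.<? N v x
        ... | yes lt with b , vb ← sum-≡⇒∃> (M v) (N v) (degrees-agree v) lt = x , b , lt , vb
        ... | no ¬lt with lt ← ℕ.≤∧≢⇒< (ℕ.≮⇒≥ ¬lt) (≢-sym ne)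
                     with a , va ← sum-≡⇒∃> (N v) (M v) (sym (degrees-agree v)) lt = a , x , va , lt

        -- One blocked pair `a`, `b` fixes the type of obstruction for the whole row: any further
        -- disagreement can be paired with `a` or with `b`, and the values 2 and 0 found there
        -- exclude the other type.
        mixed : ∀ v → Mixed M N v
        mixed v with Fin.any? (λ x → ¬? (M v x ℕ.≟ N v x))
        ... | no ¬p = inj₁ λ x ne → contradiction (x , ne) ¬p
        ... | yes (x , ne) with a , b , va , vb ← triple ne with blocked v va vb
        ...   | inj₁ (_ , Mva , Nva , Mvb , Nvb) = inj₁ go
          where
          go : ∀ y → M v y ≢ N v y → M v y ≡ 1
          go y ney with M v y ℕ.<? N v y
          ... | yes lt with blocked v lt vb
          ...   | inj₁ (_ , e , _) = e
          ...   | inj₂ (_ , e , _) = contradiction (trans (sym Nvb) e) λ ()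
          go y ney | no ¬lt with blocked v va (ℕ.≤∧≢⇒< (ℕ.≮⇒≥ ¬lt) (≢-sym ney))
          ...   | inj₁ (_ , _ , _ , e , _) = e
          ...   | inj₂ (_ , _ , _ , e , _) = contradiction (trans (sym Nva) e) λ ()
        ...   | inj₂ (_ , Nvb , Mvb , Nva , Mva) = inj₂ go
          where
          go : ∀ y → M v y ≢ N v y → N v y ≡ 1
          go y ney with M v y ℕ.<? N v y
          ... | yes lt with blocked v lt vb
          ...   | inj₁ (_ , _ , _ , e , _) = contradiction (trans (sym Mvb) e) λ ()
          ...   | inj₂ (_ , _ , _ , e , _) = e
          go y ney | no ¬lt with blocked v va (ℕ.≤∧≢⇒< (ℕ.≮⇒≥ ¬lt) (≢-sym ney))
          ...   | inj₁ (_ , e , _) = contradiction (trans (sym Mva) e) λ ()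
          ...   | inj₂ (_ , e , _) = e

        merge : ℕ → ℕ → ℕ
        merge p q with p ℕ.≟ q
        ... | yes _ = p
        ... | no _ = 1

        K : Graph
        K x y = merge (M x y) (N x y)

        mergeˡ : ∀ {p q} → (p ≢ q → p ≡ 1) → merge p q ≡ p
        mergeˡ {p} {q} h with p ℕ.≟ q
        ... | yes _ = refl
        ... | no ne = sym (h ne)

        mergeʳ : ∀ {p q} → (p ≢ q → q ≡ 1) → merge p q ≡ q
        mergeʳ {p} {q} h with p ℕ.≟ q
        ... | yes e = e
        ... | no ne = sym (h ne)

        merge≤2 : ∀ {p q} → p ≤ 2 → merge p q ≤ 2
        merge≤2 {p} {q} h with p ℕ.≟ q
        ... | yes _ = h
        ... | no _ = s≤s z≤n

        dbl-merge : ∀ p q → dbl (merge p q) ≤ dbl p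
        dbl-merge p q with p ℕ.≟ q
        ... | yes _ = ℕ.≤-refl
        ... | no _ = z≤n

        AK : Adm K
        AK = record
          { symmetric = λ x y → cong₂ merge (symmetric AM x y) (symmetric AN x y)
          ; loopless  = λ x → trans (cong₂ merge (loopless AM x) (loopless AN x)) refl
          ; bounded   = λ x y → merge≤2 (bounded AM x y)
          ; degree    = deg-K
          ; doubles≤  = ℕ.≤-trans (sum²-mono-≤ _ _ λ x y → dbl-merge (M x y) (N x y)) (doubles≤ AM)
          }
          where
          deg-K : ∀ x → sum (K x) ≡ deg x
          deg-K x with mixed x
          ... | inj₁ h = trans (sum-cong-≗ λ y → mergeˡ (h y)) (degree AM x)
          ... | inj₂ h = trans (sum-cong-≗ λ y → mergeʳ (h y)) (degree AN x)

        dist-split : dist M K + dist K N ≡ dist M N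
        dist-split = trans (sym (sum²-+ (λ x y → ∣ M x y - K x y ∣) (λ x y → ∣ K x y - N x y ∣))) (sum²-cong pointwise)
          where
          pointwise : ∀ x y → ∣ M x y - K x y ∣ + ∣ K x y - N x y ∣ ≡ ∣ M x y - N x y ∣
          pointwise x y with mixed x
          ... | inj₁ h rewrite mergeˡ (h y) | ℕ.∣n-n∣≡0 (M x y) = refl
          ... | inj₂ h rewrite mergeʳ (h y) | ℕ.∣n-n∣≡0 (N x y) = ℕ.+-identityʳ _

        merge-differ : ∀ {p q} → p ≢ q → merge p q ≡ 1
        merge-differ {p} {q} ne with p ℕ.≟ q
        ... | yes e = contradiction e ne
        ... | no _ = refl

        -- Where `P` is doubled it cannot differ from `Q`, so `Q` has all doubled pairs of `P` and
        -- `v x` in addition. Hence `P` has room for one more within any bound that `Q` meets.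
        slack : ∀ {P Q} → Adm P → Adm Q → ∀ {v x} → P v x ≡ 1 → Q v x ≡ 2 →
                (∀ x y → P x y ≢ Q x y → P x y ≡ 1) → doubles P + 2 ≤ doubles Q
        slack {P} {Q} AP AQ {v} {x} Pvx Qvx h = doubles-grow v≢x dbl≤ (symmetric AP) (symmetric AQ)
                                               (subst₂ (λ p q → dbl p < dbl q) (sym Pvx) (sym Qvx) (s≤s z≤n))
          where
          v≢x : v ≢ x
          v≢x refl = contradiction (trans (sym Qvx) (loopless AQ v)) λ ()
          dbl≤ : ∀ x y → dbl (P x y) ≤ dbl (Q x y)
          dbl≤ x y with P x y ℕ.≟ Q x y
          ... | yes e = ℕ.≤-reflexive (cong dbl e)
          ... | no ne rewrite h x y ne = z≤n

        -- Were `K` equal to `N`, then `N` would be 1 at every disagreement. This excludes the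
        -- obstruction in `M`, which needs a value 2 of `N`; and `slack` refutes the obstruction in
        -- `N` by providing the room that it denies.
        K≢N : dist K N ≢ 0
        K≢N d≡0 with a , b , va , vb ← triple M≢N with blocked v₀ va vb
        ... | inj₁ (_ , _ , Nva , _) =
          contradiction (trans (sym (merge-differ (ℕ.<⇒≢ va))) (trans (K≐N v₀ a) Nva)) λ ()
          where
          K≐N : K ≐ N
          K≐N x y = ℕ.∣m-n∣≡0⇒m≡n (sum²-zero⇒ _ d≡0 x y)
        ... | inj₂ (¬q , Nvb , Mvb , Nva , _) rewrite Nva | Nvb =
          ¬q (ℕ.≤-trans (slack AN AM Nvb Mvb λ x y ne′ → trans (sym (K≐N x y)) (merge-differ (≢-sym ne′))) (doubles≤ AM))
          where
          K≐N : K ≐ N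
          K≐N x y = ℕ.∣m-n∣≡0⇒m≡n (sum²-zero⇒ _ d≡0 x y)

        M≢K : dist M K ≢ 0
        M≢K d≡0 with a , b , va , vb ← triple M≢N with blocked v₀ va vb
        ... | inj₁ (¬p , Mva , Nva , Mvb , _) rewrite Mva | Mvb =
          ¬p (ℕ.≤-trans (slack AM AN Mva Nva λ x y ne′ → trans (M≐K x y) (merge-differ ne′)) (doubles≤ AN))
          where
          M≐K : M ≐ K
          M≐K x y = ℕ.∣m-n∣≡0⇒m≡n (sum²-zero⇒ _ d≡0 x y)
        ... | inj₂ (_ , _ , Mvb , _) =
          contradiction (trans (sym (merge-differ (≢-sym (ℕ.<⇒≢ vb)))) (trans (sym (M≐K v₀ b)) Mvb)) λ ()
          where
          M≐K : M ≐ K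
          M≐K x y = ℕ.∣m-n∣≡0⇒m≡n (sum²-zero⇒ _ d≡0 x y)

        M-K-closer : dist M K < dist M N
        M-K-closer = subst (dist M K <_) dist-split (ℕ.m<m+n _ (ℕ.n≢0⇒n>0 K≢N))

        K-N-closer : dist K N < dist M N
        K-N-closer = subst (dist K N <_) dist-split (ℕ.m<n+m _ (ℕ.n≢0⇒n>0 M≢K))

      private
        connect : ∀ k {M N} → Adm M → Adm N → dist M N < k → M ⇝ N
        connect (suc k) {M} {N} AM AN (s≤s d≤k)
          with Fin.any? (λ v → Fin.any? λ x → ¬? (M v x ℕ.≟ N v x))
             | Fin.any? (λ v → Fin.any? λ a → Fin.any? λ b → allowed? M N v a b)
        ... | no M≐N | _ = same λ x y → decidable-stable (M x y ℕ.≟ N x y) λ ne → M≐N (x , y , ne)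
        ... | yes _ | yes (v , a , b , ok) with allowed-step AM AN ok
        ...   | inj₁ (M′ , AM′ , s , closer) =
                switch AM AM′ s then connect k AM′ AN (ℕ.<-≤-trans closer d≤k)
        -- The step was found in `N`, so it is attached at the far end and run backwards.
        ...   | inj₂ (N′ , AN′ , s , closer) =
                connect k AM AN′ (ℕ.<-≤-trans closer d≤k) then switch AN′ AN (switch-inverse AN AN′ s)
        connect (suc k) {M} {N} AM AN (s≤s d≤k) | yes (_ , _ , M≢N) | no none =
          connect k AM AK (ℕ.<-≤-trans M-K-closer d≤k) then connect k AK AN (ℕ.<-≤-trans K-N-closer d≤k)
          where open Stuck AM AN M≢N (λ v a b ok → none (v , a , b , ok))

      connected : ∀ {M N} → Adm M → Adm N → M ⇝ N
      connected AM AN = connect _ AM AN (ℕ.n<1+n _)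

-- Two-coloured arcs with labelled stubs, and the moves between them.

module States {m p q n : ℕ} (colour : Fin p → Fin 2) (vertex : Fin q → Fin n) where

  open import Data.Fin.Base using (Fin; zero; suc; toℕ; fromℕ<)
  import Data.Fin.Properties as Fin
  open import Data.Nat.Base using (ℕ; zero; suc; _+_; _*_; _≤_; _<_; _⊓_; z≤n; s≤s; ∣_-_∣; s≤s⁻¹)
  import Data.Nat.Properties as ℕ
  open import Data.Nat.Tactic.RingSolver using (solve-∀)
  open import Data.Product.Base using (_×_; _,_; proj₁; proj₂; ∃-syntax)
  open import Data.Sum.Base using (_⊎_; inj₁; inj₂)
  open import Algebra.Properties.Semiring.Sum ℕ.+-*-semiring
    using (sum; sum-cong-≗; sum-replicate-zero; ∑-distrib-+; ∑-comm; *-distribˡ-sum;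
      *-distribʳ-sum)
  open import Relation.Binary.Construct.Closure.ReflexiveTransitive using (Star; ε; _◅_; _◅◅_)
  open import Relation.Binary.PropositionalEquality
    using (_≡_; _≢_; refl; sym; trans; cong; cong₂; subst; subst₂; ≢-sym; module ≡-Reasoning)
  open import Relation.Nullary.Decidable using (yes; no; ¬?; _×-dec_; decidable-stable)
  open import Relation.Nullary.Negation using (¬_; contradiction)
  open import Relation.Binary.Definitions using (tri<; tri≈; tri>)
  open FiniteSums
  open Edges
  open Multigraphs

  record Arc : Set where
    constructor arc
    field
      out     : Fin p
      in₁ in₂ : Fin q

  open Arc public

  heads : Arc → Fin q → ℕ
  heads α s = kron (in₁ α) s + kron (in₂ α) s

  weight : Arc → Fin 2 → Fin n → Fin n → ℕ
  weight α c x y = kron (colour (out α)) c * ind (vertex (in₁ α)) (vertex (in₂ α)) x y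

  graph : (Fin m → Arc) → Fin 2 → Fin n → Fin n → ℕ
  graph Y c x y = sum λ i → weight (Y i) c x y

  -- The condition simple also excludes loops, since ind x x x x = 2.
  record State : Set where
    field
      arcs    : Fin m → Arc
      tails=1 : ∀ s → sum (λ i → kron (out (arcs i)) s) ≡ 1
      heads=1 : ∀ s → sum (λ i → heads (arcs i) s) ≡ 1
      simple  : ∀ c x y → graph arcs c x y ≤ 1

  open State public

  layer : State → Fin 2 → Fin n → Fin n → ℕ
  layer Y = graph (arcs Y)

  multi : State → Fin n → Fin n → ℕ
  multi Y x y = layer Y zero x y + layer Y (suc zero) x y

  -- The multiset conditions of a shuffle at two positions. That its result is accepted is built in,
  -- because `Z` is a `State`.
  record Step (Y Z : State) : Set where
    field
      {i j}   : Fin m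
      i≢j     : i ≢ j
      off-ij  : ∀ k → k ≢ i → k ≢ j → arcs Z k ≡ arcs Y k
      tails≡  : ∀ s → kron (out (arcs Y i)) s + kron (out (arcs Y j)) s ≡ kron (out (arcs Z i)) s + kron (out (arcs Z j)) s
      heads≡  : ∀ s → heads (arcs Y i) s + heads (arcs Y j) s ≡ heads (arcs Z i) s + heads (arcs Z j) s

  Path : State → State → Set
  Path = Star Step

  opposite : Fin 2 → Fin 2
  opposite zero = suc zero
  opposite (suc zero) = zero

  opposite-≢ : ∀ c → c ≢ opposite c
  opposite-≢ zero ()
  opposite-≢ (suc zero) ()

  ≢⇒opposite : ∀ {c d} → d ≢ c → d ≡ opposite c
  ≢⇒opposite {zero} {zero} ne = contradiction refl ne
  ≢⇒opposite {zero} {suc zero} ne = refl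
  ≢⇒opposite {suc zero} {zero} ne = refl
  ≢⇒opposite {suc zero} {suc zero} ne = contradiction refl ne

  multi-split : ∀ Y c x y → multi Y x y ≡ layer Y c x y + layer Y (opposite c) x y
  multi-split Y zero x y = refl
  multi-split Y (suc zero) x y = ℕ.+-comm (layer Y zero x y) _

  sum-two-terms : ∀ {k} (f : Fin k → ℕ) {i j} → i ≢ j → f i + f j ≤ sum f
  sum-two-terms {k} f {i} {j} i≢j = begin
    f i + f j                                       ≡⟨ cong₂ _+_ (sum-kron-* i f) (sum-kron-* j f) ⟨
    sum (λ l → kron i l * f l) + sum (λ l → kron j l * f l)   ≡⟨ ∑-distrib-+ (λ l → kron i l * f l) _ ⟨
    sum (λ l → kron i l * f l + kron j l * f l)             ≤⟨ sum-mono-≤ _ f pointwise ⟩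
    sum f                                           ∎
    where
    open ℕ.≤-Reasoning
    pointwise : ∀ l → kron i l * f l + kron j l * f l ≤ f l
    pointwise l with i Fin.≟ l | j Fin.≟ l
    ... | yes refl | yes refl = contradiction refl i≢j
    ... | yes _ | no _ = ℕ.≤-reflexive (trans (ℕ.+-identityʳ _) (ℕ.*-identityˡ _))
    ... | no _ | yes _ = ℕ.≤-reflexive (ℕ.*-identityˡ _)
    ... | no _ | no _ = z≤n

  arc-edge : Arc → Fin n → Fin n → Set
  arc-edge α = Edge (vertex (in₁ α)) (vertex (in₂ α))

  loopless-arcs : ∀ Y i → vertex (in₁ (arcs Y i)) ≢ vertex (in₂ (arcs Y i))
  loopless-arcs Y i e = ℕ.1+n≰n (begin
    2                          ≡⟨ ind-loop x ⟨
    ind x x x x                ≡⟨ cong (λ y → ind x y x x) e ⟩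
    ind x y x x                ≡⟨ ℕ.*-identityˡ _ ⟨
    1 * ind x y x x            ≡⟨ cong (_* ind x y x x) (kron-refl c) ⟨
    weight (arcs Y i) c x x    ≤⟨ term≤sum (λ k → weight (arcs Y k) c x x) i ⟩
    layer Y c x x              ≤⟨ simple Y c x x ⟩
    1                          ∎)
    where
    open ℕ.≤-Reasoning
    c = colour (out (arcs Y i))
    x = vertex (in₁ (arcs Y i))
    y = vertex (in₂ (arcs Y i))

  weight-1 : ∀ Y i {c x y} → colour (out (arcs Y i)) ≡ c → arc-edge (arcs Y i) x y → weight (arcs Y i) c x y ≡ 1
  weight-1 Y i {c} refl e rewrite ind-edge (loopless-arcs Y i) e | kron-refl c = refl

  layer-arc : ∀ Y {c x y} → 1 ≤ layer Y c x y → ∃[ i ] colour (out (arcs Y i)) ≡ c × arc-edge (arcs Y i) x y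
  layer-arc Y {c} {x} {y} 1≤g
    with i , lt ← sum-<⇒∃ {m} (λ _ → 0) (λ i → weight (arcs Y i) c x y) (subst (_< layer Y c x y) (sym (sum-replicate-zero m)) 1≤g)
    = i , kron>0⇒≡ (ℕ.n≢0⇒n>0 λ e → ℕ.<⇒≢ lt (sym (cong (_* on i) e)))
        , ind>0⇒edge (ℕ.n≢0⇒n>0 λ e → ℕ.<⇒≢ lt (sym (trans (cong (of i *_) e) (ℕ.*-zeroʳ (of i)))))
    where
    of on : Fin m → ℕ
    of i = kron (colour (out (arcs Y i))) c
    on i = ind (vertex (in₁ (arcs Y i))) (vertex (in₂ (arcs Y i))) x y

  arcs-distinct : ∀ Y {i j x y} → i ≢ j → colour (out (arcs Y i)) ≡ colour (out (arcs Y j)) →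
                  arc-edge (arcs Y i) x y → ¬ arc-edge (arcs Y j) x y
  arcs-distinct Y {i} {j} {x} {y} i≢j c≡ ei ej = ℕ.1+n≰n (ℕ.≤-trans
    (subst (_≤ layer Y c x y) (cong₂ _+_ (weight-1 Y i c≡ ei) (weight-1 Y j refl ej)) (sum-two-terms (λ k → weight (arcs Y k) c x y) i≢j))
    (simple Y c x y))
    where c = colour (out (arcs Y j))

  -- `legal` says that removing the two old arcs and adding `α` and `β` keeps every layer at most 1,
  -- with the subtraction moved to the right-hand side.
  module _ (Y : State) {i j : Fin m} (i≢j : i ≢ j) (α β : Arc)
    (tails≡ : ∀ s → kron (out (arcs Y i)) s + kron (out (arcs Y j)) s ≡ kron (out α) s + kron (out β) s)
    (heads≡ : ∀ s → heads (arcs Y i) s + heads (arcs Y j) s ≡ heads α s + heads β s)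
    (legal  : ∀ c x y → layer Y c x y + (weight α c x y + weight β c x y) ≤
                        1 + (weight (arcs Y i) c x y + weight (arcs Y j) c x y)) where

    private
      arcs′ : Fin m → Arc
      arcs′ k with k Fin.≟ i | k Fin.≟ j
      ... | yes _ | _ = α
      ... | no _ | yes _ = β
      ... | no _ | no _ = arcs Y k

      at-i : arcs′ i ≡ α
      at-i with i Fin.≟ i | i Fin.≟ j
      ... | yes _ | _ = refl
      ... | no ¬p | _ = contradiction refl ¬p

      at-j : arcs′ j ≡ β
      at-j with j Fin.≟ i | j Fin.≟ j
      ... | yes p | _ = contradiction (sym p) i≢j
      ... | no _ | yes _ = refl
      ... | no _ | no ¬p = contradiction refl ¬p

      elsewhere : ∀ k → k ≢ i → k ≢ j → arcs′ k ≡ arcs Y k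
      elsewhere k k≢i k≢j with k Fin.≟ i | k Fin.≟ j
      ... | yes p | _ = contradiction p k≢i
      ... | no _ | yes p = contradiction p k≢j
      ... | no _ | no _ = refl

      sum′ : (f : Arc → ℕ) → sum (λ k → f (arcs′ k)) + (f (arcs Y i) + f (arcs Y j)) ≡ sum (λ k → f (arcs Y k)) + (f α + f β)
      sum′ f = subst₂ (λ γ ζ → sum (λ k → f (arcs′ k)) + (f (arcs Y i) + f (arcs Y j)) ≡ sum (λ k → f (arcs Y k)) + (f γ + f ζ))
        at-i at-j (sum-differ-at₂ (λ k → f (arcs′ k)) (λ k → f (arcs Y k)) i≢j λ k k≢i k≢j → cong f (elsewhere k k≢i k≢j))

      sum-preserved : (f : Arc → ℕ) → f (arcs Y i) + f (arcs Y j) ≡ f α + f β →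
                      sum (λ k → f (arcs′ k)) ≡ sum (λ k → f (arcs Y k))
      sum-preserved f e = ℕ.+-cancelʳ-≡ (f α + f β) _ _ (trans (cong (sum (λ k → f (arcs′ k)) +_) (sym e)) (sum′ f))

    record Replaced : Set where
      field
        result    : State
        step      : Step Y result
        result-i  : arcs result i ≡ α
        result-j  : arcs result j ≡ β
        unchanged : ∀ k → k ≢ i → k ≢ j → arcs result k ≡ arcs Y k
        layers    : ∀ c x y → layer result c x y + (weight (arcs Y i) c x y + weight (arcs Y j) c x y)
                            ≡ layer Y c x y + (weight α c x y + weight β c x y)

    abstract
      replace : Replaced
      replace = record
        { result = Z
        ; step = record
          { i≢j = i≢j ; off-ij = elsewhere
          ; tails≡ = λ s → trans (tails≡ s) (cong₂ (λ γ ζ → kron (out γ) s + kron (out ζ) s) (sym at-i) (sym at-j))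
          ; heads≡ = λ s → trans (heads≡ s) (cong₂ (λ γ ζ → heads γ s + heads ζ s) (sym at-i) (sym at-j)) }
        ; result-i = at-i ; result-j = at-j ; unchanged = elsewhere
        ; layers = λ c x y → sum′ (λ γ → weight γ c x y)
        }
        where
        Z : State
        Z = record
          { arcs = arcs′
          ; tails=1 = λ s → trans (sum-preserved (λ γ → kron (out γ) s) (tails≡ s)) (tails=1 Y s)
          ; heads=1 = λ s → trans (sum-preserved (λ γ → heads γ s) (heads≡ s)) (heads=1 Y s)
          ; simple = λ c x y → ℕ.+-cancelʳ-≤ _ _ _ (subst (_≤ 1 + (weight (arcs Y i) c x y + weight (arcs Y j) c x y)) (sym (sum′ (λ γ → weight γ c x y))) (legal c x y))
          }

  pair≡ : ∀ {k} {a b h l : Fin k} → Edge a b h l → ∀ s → kron a s + kron b s ≡ kron h s + kron l s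
  pair≡ (inj₁ (refl , refl)) s = refl
  pair≡ {a = a} {b} (inj₂ (refl , refl)) s = ℕ.+-comm (kron a s) (kron b s)

  orient : ∀ α {x y} → arc-edge α x y → ∃[ h ] ∃[ k ] vertex h ≡ x × vertex k ≡ y × Edge (in₁ α) (in₂ α) h k
  orient α (inj₁ (refl , refl)) = in₁ α , in₂ α , refl , refl , inj₁ (refl , refl)
  orient α (inj₂ (refl , refl)) = in₂ α , in₁ α , refl , refl , inj₂ (refl , refl)

  weight-of : ∀ α {c x y} → colour (out α) ≡ c → arc-edge α x y → ∀ d u w → weight α d u w ≡ kron c d * ind x y u w
  weight-of α {c} refl e d u w = cong (kron c d *_) (ind-resp e u w)

  layer-sym : ∀ Y d → Symmetric (layer Y d)
  layer-sym Y d x y = sum-cong-≗ λ k →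
    cong (kron (colour (out (arcs Y k))) d *_) (ind-sym (vertex (in₁ (arcs Y k))) (vertex (in₂ (arcs Y k))) x y)

  layer-loopless : ∀ Y {c x y} → 1 ≤ layer Y c x y → x ≢ y
  layer-loopless Y 1≤g refl with layer-arc Y 1≤g
  ... | i , _ , inj₁ (p , q) = loopless-arcs Y i (trans (sym p) q)
  ... | i , _ , inj₂ (p , q) = loopless-arcs Y i (trans (sym q) p)

  abstract
    -- Both arcs keep their tails and trade one head stub, the one at `b` for the one at `a`. The
    -- two vanishing layers ensure that no parallel arcs of equal colour arise.
    exchange : ∀ Y {v a b z} c c′ → Distinct v a b z →
               1 ≤ layer Y c v b → layer Y c v a ≡ 0 → 1 ≤ layer Y c′ a z → layer Y c′ b z ≡ 0 →
               ∃[ Z ] Step Y Z × (∀ d x y → layer Z d x y + (kron c d * ind v b x y + kron c′ d * ind a z x y)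
                                          ≡ layer Y d x y + (kron c d * ind v a x y + kron c′ d * ind b z x y))
    exchange Y {v} {a} {b} {z} c c′ D vb va az bz
      with i , ci , ei ← layer-arc Y vb | j , cj , ej ← layer-arc Y az
      with hv , hb , refl , refl , eᵢ ← orient (arcs Y i) ei | ha , hz , refl , refl , eⱼ ← orient (arcs Y j) ej =
      result , step , λ d x y →
        subst₂ (λ p q → layer result d x y + p ≡ layer Y d x y + q) (old d x y) (new d x y) (layers d x y)
      where
      open Distinct D
      i≢j : i ≢ j
      i≢j refl with edge-trans (edge-sym ei) ej
      ... | inj₁ (e , _) = v≢a (sym e)
      ... | inj₂ (_ , e) = v≢z (sym e)
      α β : Arc
      α = arc (out (arcs Y i)) hv ha
      β = arc (out (arcs Y j)) hb hz
      old : ∀ d x y → weight (arcs Y i) d x y + weight (arcs Y j) d x y ≡ kron c d * ind v b x y + kron c′ d * ind a z x y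
      old d x y = cong₂ _+_ (weight-of (arcs Y i) ci ei d x y) (weight-of (arcs Y j) cj ej d x y)
      new : ∀ d x y → weight α d x y + weight β d x y ≡ kron c d * ind v a x y + kron c′ d * ind b z x y
      new d x y = cong₂ _+_ (weight-of α ci (inj₁ (refl , refl)) d x y) (weight-of β cj (inj₁ (refl , refl)) d x y)
      swap-middle : ∀ p q r s → (p + q) + (r + s) ≡ (p + r) + (q + s)
      swap-middle = solve-∀
      single : ∀ {x y e f} c d → Edge x y e f → layer Y d e f ≡ layer Y d x y → layer Y c x y ≡ 0 →
               ∀ k → k ≡ kron c d → layer Y d e f + k ≤ 1
      single {e = e} {f} c d _ eq zero′ k refl with c Fin.≟ d
      ... | yes refl rewrite eq | zero′ = ℕ.≤-refl
      ... | no _ = subst (_≤ 1) (sym (ℕ.+-identityʳ _)) (simple Y d e f)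
      legal : ∀ d x y → layer Y d x y + (kron c d * ind v a x y + kron c′ d * ind b z x y) ≤ 1
      legal d x y with position D x y
      ... | on-va e (values p q r s) = single c d e (edge-resp (layer-sym Y d) e) va _
            (trans (cong₂ (λ k l → kron c d * k + kron c′ d * l) p s) (l (kron c d) (kron c′ d)))
        where
        l : ∀ k l → k * 1 + l * 0 ≡ k
        l = solve-∀
      ... | on-bz e (values p q r s) = single c′ d e (edge-resp (layer-sym Y d) e) bz _
            (trans (cong₂ (λ k l → kron c d * k + kron c′ d * l) p s) (l (kron c d) (kron c′ d)))
        where
        l : ∀ k l → k * 0 + l * 1 ≡ l
        l = solve-∀
      ... | on-vb _ (values p q r s) rewrite p | s | ℕ.*-zeroʳ (kron c d) | ℕ.*-zeroʳ (kron c′ d) = subst (_≤ 1) (sym (ℕ.+-identityʳ _)) (simple Y d x y)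
      ... | on-az _ (values p q r s) rewrite p | s | ℕ.*-zeroʳ (kron c d) | ℕ.*-zeroʳ (kron c′ d) = subst (_≤ 1) (sym (ℕ.+-identityʳ _)) (simple Y d x y)
      ... | off (values p q r s) rewrite p | s | ℕ.*-zeroʳ (kron c d) | ℕ.*-zeroʳ (kron c′ d) = subst (_≤ 1) (sym (ℕ.+-identityʳ _)) (simple Y d x y)
      open Replaced (replace Y i≢j α β (λ s → refl)
        (λ s → trans (cong₂ _+_ (pair≡ eᵢ s) (pair≡ eⱼ s)) (swap-middle (kron hv s) (kron hb s) (kron ha s) (kron hz s)))
        (λ d x y → ℕ.≤-trans (subst (λ k → layer Y d x y + k ≤ 1) (sym (new d x y)) (legal d x y)) (ℕ.m≤m+n 1 _)))

  sum-colours : ∀ (c : Fin 2) k → kron c zero * k + kron c (suc zero) * k ≡ k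
  sum-colours zero k = trans (ℕ.+-identityʳ _) (ℕ.*-identityˡ k)
  sum-colours (suc zero) k = ℕ.*-identityˡ k

  multi-equation : ∀ Y Z c c′ x y {e f e′ f′} →
    (∀ d → layer Z d x y + (kron c d * e + kron c′ d * f) ≡ layer Y d x y + (kron c d * e′ + kron c′ d * f′)) →
    multi Z x y + (e + f) ≡ multi Y x y + (e′ + f′)
  multi-equation Y Z c c′ x y {e} {f} {e′} {f′} h = begin
    multi Z x y + (e + f)      ≡⟨ split Z e f ⟩
    (layer Z zero x y + (kron c zero * e + kron c′ zero * f)) + (layer Z (suc zero) x y + (kron c (suc zero) * e + kron c′ (suc zero) * f))
                               ≡⟨ cong₂ _+_ (h zero) (h (suc zero)) ⟩
    (layer Y zero x y + (kron c zero * e′ + kron c′ zero * f′)) + (layer Y (suc zero) x y + (kron c (suc zero) * e′ + kron c′ (suc zero) * f′))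
                               ≡⟨ split Y e′ f′ ⟨
    multi Y x y + (e′ + f′)    ∎
    where
    open ≡-Reasoning
    l : ∀ a b p q r s → (a + b) + ((p + q) + (r + s)) ≡ (a + (p + r)) + (b + (q + s))
    l = solve-∀
    split : ∀ W e f → multi W x y + (e + f) ≡ (layer W zero x y + (kron c zero * e + kron c′ zero * f)) + (layer W (suc zero) x y + (kron c (suc zero) * e + kron c′ (suc zero) * f))
    split W e f = trans (cong₂ (λ p q → multi W x y + (p + q)) (sym (sum-colours c e)) (sym (sum-colours c′ f)))
                        (l (layer W zero x y) (layer W (suc zero) x y) (kron c zero * e) (kron c (suc zero) * e) (kron c′ zero * f) (kron c′ (suc zero) * f))

  record Recoloured (Y : State) (c c′ : Fin 2) (x₁ y₁ x₂ y₂ : Fin n) : Set where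
    field
      result    : State
      step      : Step Y result
      multi≐    : multi result ≐ multi Y
      gain₁     : 1 ≤ layer result c′ x₁ y₁
      gain₂     : 1 ≤ layer result c x₂ y₂
      loss₁     : layer result c x₁ y₁ ≡ 0
      loss₂     : layer result c′ x₂ y₂ ≡ 0
      elsewhere : ∀ d x y → ¬ Edge x₁ y₁ x y → ¬ Edge x₂ y₂ x y → layer result d x y ≡ layer Y d x y

  abstract
    -- The two arcs trade their whole heads, which amounts to trading colours between the two edges;
    -- it is legal because each edge lacks the colour that it receives.
    recolour : ∀ Y {c c′ x₁ y₁ x₂ y₂} → c ≢ c′ →
               1 ≤ layer Y c x₁ y₁ → layer Y c′ x₁ y₁ ≡ 0 → 1 ≤ layer Y c′ x₂ y₂ → layer Y c x₂ y₂ ≡ 0 →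
               Recoloured Y c c′ x₁ y₁ x₂ y₂
    recolour Y {c} {c′} {x₁} {y₁} {x₂} {y₂} c≢c′ g₁ z₁ g₂ z₂
      with i , ci , ei ← layer-arc Y g₁ | j , cj , ej ← layer-arc Y g₂ = record
      { result = result ; step = step
      ; multi≐ = λ x y → ℕ.+-cancelʳ-≡ (ind x₁ y₁ x y + ind x₂ y₂ x y) _ _
          (trans (multi-equation Y result c c′ x y (λ d → equation d x y)) (cong (multi Y x y +_) (ℕ.+-comm (ind x₂ y₂ x y) _)))
      ; gain₁ = ℕ.≤-reflexive (sym (trans at₁ (cong₂ _+_ z₁ (kron-refl c′))))
      ; gain₂ = ℕ.≤-reflexive (sym (trans at₂ (cong₂ _+_ z₂ (kron-refl c))))
      ; loss₁ = ℕ.+-cancelʳ-≡ 1 _ _ (subst₂ (λ k l → layer result c x₁ y₁ + k ≡ l) (kron-refl c)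
                  (cong₂ _+_ (ℕ.≤-antisym (simple Y c x₁ y₁) g₁) (kron-≢ (≢-sym c≢c′))) (before₁ c))
      ; loss₂ = ℕ.+-cancelʳ-≡ 1 _ _ (subst₂ (λ k l → layer result c′ x₂ y₂ + k ≡ l) (kron-refl c′)
                  (cong₂ _+_ (ℕ.≤-antisym (simple Y c′ x₂ y₂) g₂) (kron-≢ c≢c′)) (before₂ c′))
      ; elsewhere = λ d x y ¬e₁ ¬e₂ → ℕ.+-cancelʳ-≡ (kron c d * 0 + kron c′ d * 0) _ _
          (subst₂ (λ k l → layer result d x y + (kron c d * k + kron c′ d * l) ≡ layer Y d x y + (kron c d * l + kron c′ d * k))
            (ind-¬edge ¬e₁) (ind-¬edge ¬e₂) (equation d x y))
      }
      where
      i≢j : i ≢ j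
      i≢j refl = c≢c′ (trans (sym ci) cj)
      x₁≢y₁ : x₁ ≢ y₁
      x₁≢y₁ = layer-loopless Y g₁
      x₂≢y₂ : x₂ ≢ y₂
      x₂≢y₂ = layer-loopless Y g₂
      e₁≢e₂ : ¬ Edge x₁ y₁ x₂ y₂
      e₁≢e₂ e = ℕ.n≮0 (subst (1 ≤_) (trans (sym (edge-resp (layer-sym Y c) e)) z₂) g₁)
      ind₁₂ : ind x₁ y₁ x₂ y₂ ≡ 0
      ind₁₂ = ind-¬edge e₁≢e₂
      ind₂₁ : ind x₂ y₂ x₁ y₁ ≡ 0
      ind₂₁ = ind-¬edge λ e → e₁≢e₂ (edge-sym e)
      α β : Arc
      α = arc (out (arcs Y i)) (in₁ (arcs Y j)) (in₂ (arcs Y j))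
      β = arc (out (arcs Y j)) (in₁ (arcs Y i)) (in₂ (arcs Y i))
      old : ∀ d x y → weight (arcs Y i) d x y + weight (arcs Y j) d x y ≡ kron c d * ind x₁ y₁ x y + kron c′ d * ind x₂ y₂ x y
      old d x y = cong₂ _+_ (weight-of (arcs Y i) ci ei d x y) (weight-of (arcs Y j) cj ej d x y)
      new : ∀ d x y → weight α d x y + weight β d x y ≡ kron c d * ind x₂ y₂ x y + kron c′ d * ind x₁ y₁ x y
      new d x y = cong₂ _+_ (weight-of α ci ej d x y) (weight-of β cj ei d x y)
      single : ∀ {x y u w} c d → Edge x y u w → layer Y c x y ≡ 0 →
               ∀ k → k ≡ kron c d → layer Y d u w + k ≤ 1
      single {u = u} {w} c d e zero′ k refl with c Fin.≟ d
      ... | yes refl rewrite edge-resp (layer-sym Y d) e | zero′ = ℕ.≤-refl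
      ... | no _ = subst (_≤ 1) (sym (ℕ.+-identityʳ _)) (simple Y d u w)
      legal : ∀ d x y → layer Y d x y + (kron c d * ind x₂ y₂ x y + kron c′ d * ind x₁ y₁ x y) ≤ 1
      legal d x y with edge? x₁ y₁ x y | edge? x₂ y₂ x y
      ... | yes e | yes e′ = contradiction (edge-trans e (edge-sym e′)) e₁≢e₂
      ... | yes e | no ¬e′ = single c′ d e z₁ _
        (trans (cong₂ (λ k l → kron c d * k + kron c′ d * l) (ind-¬edge ¬e′) (ind-edge x₁≢y₁ e)) (l (kron c d) (kron c′ d)))
        where
        l : ∀ k l → k * 0 + l * 1 ≡ l
        l = solve-∀
      ... | no ¬e | yes e′ = single c d e′ z₂ _
        (trans (cong₂ (λ k l → kron c d * k + kron c′ d * l) (ind-edge x₂≢y₂ e′) (ind-¬edge ¬e)) (l (kron c d) (kron c′ d)))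
        where
        l : ∀ k l → k * 1 + l * 0 ≡ k
        l = solve-∀
      ... | no ¬e | no ¬e′ rewrite ind-¬edge ¬e | ind-¬edge ¬e′ | ℕ.*-zeroʳ (kron c d) | ℕ.*-zeroʳ (kron c′ d) =
        subst (_≤ 1) (sym (ℕ.+-identityʳ _)) (simple Y d x y)
      open Replaced (replace Y i≢j α β (λ s → refl)
        (λ s → ℕ.+-comm (heads (arcs Y i) s) _)
        (λ d x y → ℕ.≤-trans (subst (λ k → layer Y d x y + k ≤ 1) (sym (new d x y)) (legal d x y)) (ℕ.m≤m+n 1 _)))
      equation : ∀ d x y → layer result d x y + (kron c d * ind x₁ y₁ x y + kron c′ d * ind x₂ y₂ x y)
                         ≡ layer Y d x y + (kron c d * ind x₂ y₂ x y + kron c′ d * ind x₁ y₁ x y)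
      equation d x y = subst₂ (λ p q → layer result d x y + p ≡ layer Y d x y + q) (old d x y) (new d x y) (layers d x y)
      l₁ : ∀ k l → k * 1 + l * 0 ≡ k
      l₁ = solve-∀
      l₂ : ∀ k l → k * 0 + l * 1 ≡ l
      l₂ = solve-∀
      before₁ : ∀ d → layer result d x₁ y₁ + kron c d ≡ layer Y d x₁ y₁ + kron c′ d
      before₁ d = subst₂ (λ k l → layer result d x₁ y₁ + k ≡ layer Y d x₁ y₁ + l)
        (trans (cong₂ (λ k l → kron c d * k + kron c′ d * l) (ind-self x₁≢y₁) ind₂₁) (l₁ (kron c d) (kron c′ d)))
        (trans (cong₂ (λ k l → kron c d * k + kron c′ d * l) ind₂₁ (ind-self x₁≢y₁)) (l₂ (kron c d) (kron c′ d)))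
        (equation d x₁ y₁)
      before₂ : ∀ d → layer result d x₂ y₂ + kron c′ d ≡ layer Y d x₂ y₂ + kron c d
      before₂ d = subst₂ (λ k l → layer result d x₂ y₂ + k ≡ layer Y d x₂ y₂ + l)
        (trans (cong₂ (λ k l → kron c d * k + kron c′ d * l) ind₁₂ (ind-self x₂≢y₂)) (l₂ (kron c d) (kron c′ d)))
        (trans (cong₂ (λ k l → kron c d * k + kron c′ d * l) (ind-self x₂≢y₂) ind₁₂) (l₁ (kron c d) (kron c′ d)))
        (equation d x₂ y₂)
      at₁ : layer result c′ x₁ y₁ ≡ layer Y c′ x₁ y₁ + kron c′ c′
      at₁ = trans (sym (ℕ.+-identityʳ _)) (trans (cong (layer result c′ x₁ y₁ +_) (sym (kron-≢ c≢c′))) (before₁ c′))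
      at₂ : layer result c x₂ y₂ ≡ layer Y c x₂ y₂ + kron c c
      at₂ = trans (sym (ℕ.+-identityʳ _)) (trans (cong (layer result c x₂ y₂ +_) (sym (kron-≢ (≢-sym c≢c′)))) (before₂ c))

  -- Counting arcs by colour and by vertex.

  sum-double-count : ∀ {k l} (H : Fin k → Fin l → ℕ) (F : Fin l → ℕ) → (∀ s → sum (λ i → H i s) ≡ 1) →
                     sum (λ i → sum λ s → H i s * F s) ≡ sum F
  sum-double-count H F one = begin
    sum (λ i → sum λ s → H i s * F s)    ≡⟨ ∑-comm (λ i s → H i s * F s) ⟩
    sum (λ s → sum λ i → H i s * F s)    ≡⟨ sum-cong-≗ (λ s → *-distribʳ-sum (F s) (λ i → H i s)) ⟨
    sum (λ s → sum (λ i → H i s) * F s)  ≡⟨ sum-cong-≗ (λ s → trans (cong (_* F s) (one s)) (ℕ.*-identityˡ (F s))) ⟩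
    sum F                                ∎
    where open ≡-Reasoning

  -- Every out-stub is the tail of exactly one arc, so a sum over arcs becomes a sum over stubs;
  -- such totals are therefore the same for all states.
  sum-tails : ∀ Y (F : Fin p → ℕ) → sum (λ i → F (out (arcs Y i))) ≡ sum F
  sum-tails Y F = trans (sum-cong-≗ λ i → sym (sum-kron-* (out (arcs Y i)) F))
                        (sum-double-count (λ i s → kron (out (arcs Y i)) s) F (tails=1 Y))

  sum-heads : ∀ Y (F : Fin q → ℕ) → sum (λ i → F (in₁ (arcs Y i)) + F (in₂ (arcs Y i))) ≡ sum F
  sum-heads Y F = trans (sum-cong-≗ split) (sum-double-count (λ i s → heads (arcs Y i) s) F (heads=1 Y))
    where
    split : ∀ i → F (in₁ (arcs Y i)) + F (in₂ (arcs Y i)) ≡ sum (λ s → heads (arcs Y i) s * F s)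
    split i = begin
      F a + F b                                                ≡⟨ cong₂ _+_ (sum-kron-* a F) (sum-kron-* b F) ⟨
      sum (λ s → kron a s * F s) + sum (λ s → kron b s * F s)        ≡⟨ ∑-distrib-+ (λ s → kron a s * F s) _ ⟨
      sum (λ s → kron a s * F s + kron b s * F s)                    ≡⟨ sum-cong-≗ (λ s → ℕ.*-distribʳ-+ (F s) (kron a s) (kron b s)) ⟨
      sum (λ s → heads (arcs Y i) s * F s)                     ∎
      where
      open ≡-Reasoning
      a = in₁ (arcs Y i)
      b = in₂ (arcs Y i)

  -- Twice the number of arcs of colour c, as every arc gives two ordered pairs.
  total : Fin 2 → ℕ
  total c = sum λ s → kron (colour s) c * 2

  sum²-layer : ∀ Y c → sum² (layer Y c) ≡ total c
  sum²-layer Y c = begin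
    sum (λ x → sum λ y → sum λ i → weight (arcs Y i) c x y)  ≡⟨ sum-cong-≗ (λ x → ∑-comm (λ y i → weight (arcs Y i) c x y)) ⟩
    sum (λ x → sum λ i → sum λ y → weight (arcs Y i) c x y)  ≡⟨ ∑-comm (λ x i → sum λ y → weight (arcs Y i) c x y) ⟩
    sum (λ i → sum² (weight (arcs Y i) c))                   ≡⟨ sum-cong-≗ (λ i → sum²-weight (arcs Y i)) ⟩
    sum (λ i → kron (colour (out (arcs Y i))) c * 2)            ≡⟨ sum-tails Y (λ s → kron (colour s) c * 2) ⟩
    total c                                                  ∎
    where
    open ≡-Reasoning
    sum²-weight : ∀ α → sum² (weight α c) ≡ kron (colour (out α)) c * 2
    sum²-weight α = begin
      sum² (weight α c)                                  ≡⟨ sum²-cong (λ x y → ℕ.*-comm k (I x y)) ⟩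
      sum² (λ x y → I x y * k)                           ≡⟨ sum²-ind-* (vertex (in₁ α)) (vertex (in₂ α)) k ⟩
      2 * k                                              ≡⟨ ℕ.*-comm 2 k ⟩
      k * 2                                              ∎
      where
      k = kron (colour (out α)) c
      I = ind (vertex (in₁ α)) (vertex (in₂ α))

  degreeᵢₙ : Fin n → ℕ
  degreeᵢₙ x = sum λ s → kron (vertex s) x

  -- A doubled edge carries one arc of each colour, so the rarer colour bounds the doubled edges.
  -- Ordered pairs are counted, as in `doubles`.
  B : ℕ
  B = total zero ⊓ total (suc zero)

  B≤total : ∀ c → B ≤ total c
  B≤total zero = ℕ.m⊓n≤m _ _
  B≤total (suc zero) = ℕ.m⊓n≤n _ _

  sum-layer : ∀ Y c x → sum (layer Y c x) ≡ sum λ i → kron (colour (out (arcs Y i))) c * (kron (vertex (in₁ (arcs Y i))) x + kron (vertex (in₂ (arcs Y i))) x)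
  sum-layer Y c x = trans (∑-comm (λ y i → weight (arcs Y i) c x y)) (sum-cong-≗ λ i →
    trans (sym (*-distribˡ-sum (kron (colour (out (arcs Y i))) c) (ind (vertex (in₁ (arcs Y i))) (vertex (in₂ (arcs Y i))) x)))
          (cong (kron (colour (out (arcs Y i))) c *_) (sum-ind (vertex (in₁ (arcs Y i))) (vertex (in₂ (arcs Y i))) x)))

  sum-multi : ∀ Y x → sum (multi Y x) ≡ degreeᵢₙ x
  sum-multi Y x = begin
    sum (multi Y x)                                    ≡⟨ ∑-distrib-+ (layer Y zero x) (layer Y (suc zero) x) ⟩
    sum (layer Y zero x) + sum (layer Y (suc zero) x)  ≡⟨ cong₂ _+_ (sum-layer Y zero x) (sum-layer Y (suc zero) x) ⟩
    sum (λ i → k zero i * d i) + sum (λ i → k (suc zero) i * d i)  ≡⟨ ∑-distrib-+ (λ i → k zero i * d i) _ ⟨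
    sum (λ i → k zero i * d i + k (suc zero) i * d i)  ≡⟨ sum-cong-≗ (λ i → sum-colours (colour (out (arcs Y i))) (d i)) ⟩
    sum d                                              ≡⟨ sum-heads Y (λ s → kron (vertex s) x) ⟩
    degreeᵢₙ x                                         ∎
    where
    open ≡-Reasoning
    k : Fin 2 → Fin m → ℕ
    k c i = kron (colour (out (arcs Y i))) c
    d : Fin m → ℕ
    d i = kron (vertex (in₁ (arcs Y i))) x + kron (vertex (in₂ (arcs Y i))) x

  layer-diagonal : ∀ Y c x → layer Y c x x ≡ 0
  layer-diagonal Y c x = ℕ.n<1⇒n≡0 (ℕ.≰⇒> λ 1≤g → layer-loopless Y 1≤g refl)

  dbl≤layer : ∀ Y c x y → dbl (multi Y x y) ≤ layer Y c x y
  dbl≤layer Y c x y rewrite multi-split Y c x y = lemma (layer Y c x y) _ (simple Y c x y) (simple Y (opposite c) x y)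
    where
    lemma : ∀ k l → k ≤ 1 → l ≤ 1 → dbl (k + l) ≤ k
    lemma 0 0 _ _ = z≤n
    lemma 0 1 _ _ = z≤n
    lemma 1 0 _ _ = z≤n
    lemma 1 1 _ _ = ℕ.≤-refl
    lemma (suc (suc _)) _ (s≤s ()) _
    lemma _ (suc (suc _)) _ (s≤s ())

  admissible : ∀ Y → Admissible degreeᵢₙ B (multi Y)
  admissible Y = record
    { symmetric = λ x y → cong₂ _+_ (layer-sym Y zero x y) (layer-sym Y (suc zero) x y)
    ; loopless  = λ x → cong₂ _+_ (layer-diagonal Y zero x) (layer-diagonal Y (suc zero) x)
    ; bounded   = λ x y → ℕ.+-mono-≤ (simple Y zero x y) (simple Y (suc zero) x y)
    ; degree    = sum-multi Y
    ; doubles≤  = ℕ.⊓-glb (below zero) (below (suc zero))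
    }
    where
    below : ∀ c → doubles (multi Y) ≤ total c
    below c = subst (doubles (multi Y) ≤_) (sum²-layer Y c) (sum²-mono-≤ _ _ (dbl≤layer Y c))

  -- The pairs joined by arcs of colour c only outnumber A, so one of them avoids A.
  find-single : ∀ Y c (A : Fin n → Fin n → ℕ) → doubles (multi Y) + sum² A < total c →
                ∃[ x ] ∃[ y ] 1 ≤ layer Y c x y × layer Y (opposite c) x y ≡ 0 × A x y ≡ 0
  find-single Y c A lt
    with x , y , xy ← sum²-<⇒∃ (λ x y → dbl (multi Y x y) + A x y) (layer Y c)
           (subst₂ _<_ (sym (sum²-+ (λ x y → dbl (multi Y x y)) A)) (sym (sum²-layer Y c)) lt) =
    x , y , ℕ.≤-trans (s≤s z≤n) xy , other , ℕ.m+n≡0⇒n≡0 (dbl (multi Y x y)) small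
    where
    small : dbl (multi Y x y) + A x y ≡ 0
    small = ℕ.n<1⇒n≡0 (ℕ.<-≤-trans xy (simple Y c x y))
    other : layer Y (opposite c) x y ≡ 0
    other = lemma (layer Y c x y) _ (ℕ.≤-antisym (simple Y c x y) (ℕ.≤-trans (s≤s z≤n) xy)) (simple Y (opposite c) x y)
      (trans (cong dbl (sym (multi-split Y c x y))) (ℕ.m+n≡0⇒m≡0 _ small))
      where
      lemma : ∀ k l → k ≡ 1 → l ≤ 1 → dbl (k + l) ≡ 0 → l ≡ 0
      lemma _ 0 _ _ _ = refl
      lemma .1 1 refl _ ()
      lemma _ (suc (suc _)) _ (s≤s ()) _

  -- An arc v-b can be turned into v-a without changing its colour.
  Movable : State → (v a b : Fin n) → Set
  Movable Y v a b = ∃[ c ] 1 ≤ layer Y c v b × layer Y c v a ≡ 0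

  -- Both edges carry the colour `c` and no other, so moving the arc from `v b` to `v a` would
  -- create a parallel arc of its own colour.
  Jammed : State → Fin 2 → (v a b : Fin n) → Set
  Jammed Y c v a b = 1 ≤ layer Y c v a × 1 ≤ layer Y c v b × layer Y (opposite c) v a ≡ 0 × layer Y (opposite c) v b ≡ 0

  -- If no colour of `v b` is missing at `v a`, the colours of `v b` are among the at most one of
  -- `v a`, so both edges have the same single colour.
  movable-or-jammed : ∀ Y {v a b} → multi Y v a ≤ 1 → 1 ≤ multi Y v b →
    Movable Y v a b ⊎ ∃[ c ] Jammed Y c v a b × multi Y v a ≡ 1 × multi Y v b ≡ 1
  movable-or-jammed Y {v} {a} {b} va vb
    with layer Y zero v a in p₀ | layer Y zero v b in q₀ | layer Y (suc zero) v a in p₁ | layer Y (suc zero) v b in q₁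
  ... | 0 | suc _ | _ | _ = inj₁ (zero , ℕ.≤-trans (s≤s z≤n) (ℕ.≤-reflexive (sym q₀)) , p₀)
  ... | _ | _ | 0 | suc _ = inj₁ (suc zero , ℕ.≤-trans (s≤s z≤n) (ℕ.≤-reflexive (sym q₁)) , p₁)
  ... | 1 | 1 | 0 | 0 = inj₂ (zero , (ℕ.≤-reflexive (sym p₀) , ℕ.≤-reflexive (sym q₀) , p₁ , q₁) , refl , refl)
  ... | 0 | 0 | 1 | 1 = inj₂ (suc zero , (ℕ.≤-reflexive (sym p₁) , ℕ.≤-reflexive (sym q₁) , p₀ , q₀) , refl , refl)
  ... | _ | suc (suc _) | _ | _ = contradiction (subst (_≤ 1) q₀ (simple Y zero v b)) λ { (s≤s ()) }
  ... | _ | _ | _ | suc (suc _) = contradiction (subst (_≤ 1) q₁ (simple Y (suc zero) v b)) λ { (s≤s ()) }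
  ... | suc _ | _ | suc _ | _ = contradiction va λ { (s≤s le) → ℕ.n≮0 (ℕ.≤-trans (ℕ.m≤n+m _ _) le) }
  ... | suc (suc _) | _ | 0 | _ = contradiction va λ { (s≤s ()) }
  ... | 0 | 0 | _ | 0 = contradiction vb λ ()
  ... | _ | 0 | 0 | 0 = contradiction vb λ ()
  ... | 0 | 0 | suc (suc _) | _ = contradiction va λ { (s≤s ()) }

  ≐-sum² : {F G : Fin n → Fin n → ℕ} (φ : ℕ → ℕ) → F ≐ G → sum² (λ x y → φ (F x y)) ≡ sum² (λ x y → φ (G x y))
  ≐-sum² φ F≐G = sum²-cong λ x y → cong φ (F≐G x y)

  module _ (Y : State) (c : Fin 2) {v a b x y : Fin n} (v≢a : v ≢ a) (a≢b : a ≢ b) (jam : Jammed Y c v a b)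
           (xy : 1 ≤ layer Y (opposite c) x y) (xyc : layer Y c x y ≡ 0) where

    private
      R : Recoloured Y c (opposite c) v b x y
      R = recolour Y {c} {opposite c} {v} {b} {x} {y} (opposite-≢ c) (proj₁ (proj₂ jam)) (proj₂ (proj₂ (proj₂ jam))) xy xyc
      open Recoloured R
      vbva : ¬ Edge v b v a
      vbva (inj₁ (_ , a≡b)) = a≢b a≡b
      vbva (inj₂ (_ , a≡v)) = v≢a (sym a≡v)
      xyva : ¬ Edge x y v a
      xyva e = ℕ.n≮0 (subst (1 ≤_) (trans (edge-resp {F = layer Y c} (layer-sym Y c) e) xyc) (proj₁ jam))

    -- Giving `v b` the colour opposite to `c` sets it apart from `v a`, which keeps `c`: the
    -- partner `x y` lacks `c` and so is not `v a`.
    unjam-by : ∃[ Z ] Step Y Z × multi Z ≐ multi Y × Movable Z v a b ×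
               (∀ d u w → ¬ Edge v b u w → ¬ Edge x y u w → layer Z d u w ≡ layer Y d u w)
    unjam-by = result , step , multi≐ , (opposite c , gain₁ , trans (elsewhere (opposite c) v a vbva xyva) (proj₁ (proj₂ (proj₂ jam))))
             , elsewhere

  opposite-involutive : ∀ c → opposite (opposite c) ≡ c
  opposite-involutive zero = refl
  opposite-involutive (suc zero) = refl

  -- `A` marks pairs that must keep their colours, and the partner edge is found off `A`. Pairs
  -- without the colour opposite to `c` are safe in any case, since the partner has that colour.
  unjam : ∀ Y c {v a b} (A : Fin n → Fin n → ℕ) → Symmetric A → v ≢ a → a ≢ b → Jammed Y c v a b →
          doubles (multi Y) + sum² A < total (opposite c) →
          ∃[ Z ] Step Y Z × multi Z ≐ multi Y × Movable Z v a b ×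
                 (∀ d u w → A u w ≢ 0 ⊎ layer Y (opposite c) u w ≡ 0 → ¬ Edge v b u w → layer Z d u w ≡ layer Y d u w)
  unjam Y c A symA v≢a a≢b jam lt =
    let x , y , xy , xy′ , Axy = find-single Y (opposite c) A lt
        Z , step , Z≐Y , ok , keep = unjam-by Y c v≢a a≢b jam xy (subst (λ d → layer Y d x y ≡ 0) (opposite-involutive c) xy′)
    in Z , step , Z≐Y , ok , λ d u w h ¬vb → keep d u w ¬vb (avoid x y xy Axy h)
    where
    avoid : ∀ x y → 1 ≤ layer Y (opposite c) x y → A x y ≡ 0 →
            ∀ {u w} → A u w ≢ 0 ⊎ layer Y (opposite c) u w ≡ 0 → ¬ Edge x y u w
    avoid x y xy Axy (inj₁ Auw) e = Auw (trans (edge-resp {F = A} symA e) Axy)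
    avoid x y xy Axy (inj₂ guw) e =
      ℕ.n≮0 (subst (1 ≤_) (trans (sym (edge-resp {F = layer Y (opposite c)} (layer-sym Y (opposite c)) e)) guw) xy)

  movable-resp : ∀ {Y Z v a b} → (∀ d → layer Z d v a ≡ layer Y d v a) → (∀ d → layer Z d v b ≡ layer Y d v b) →
                 Movable Y v a b → Movable Z v a b
  movable-resp va vb (c , p , q) = c , subst (1 ≤_) (sym (vb c)) p , trans (va c) q

  -- Unjamming both sides of a square within the cost of its switch.

  module _ {v a b z : Fin n} (D : Distinct v a b z) where
    open Distinct D

    module Unjamming (Y : State) (va≤1 : multi Y v a ≤ 1) (1≤vb : 1 ≤ multi Y v b)
      (bz≤1 : multi Y b z ≤ 1) (1≤az : 1 ≤ multi Y a z) (cost≤ : cost (multi Y) v a b z ≤ B) where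

      Goal : Set
      Goal = ∃[ Z ] Path Y Z × multi Z ≐ multi Y × Movable Z v a b × Movable Z z b a

      private
        -- A side whose edges are both single reserves 2 in the cost, so `doubles` is strictly below
        -- the total of either colour; this is what `find-single` needs.
        weaken : ∀ k l c t → k ≡ 1 ⊎ l ≡ 1 → t ≡ 0 → doubles (multi Y) + 2 * (k + l) ≤ B → doubles (multi Y) + t < total c
        weaken k l c t h refl le = ℕ.<-≤-trans (ℕ.<-≤-trans (ℕ.+-monoʳ-< (doubles (multi Y)) (positive k l h)) le) (B≤total c)
          where
          positive : ∀ k l → k ≡ 1 ⊎ l ≡ 1 → 0 < 2 * (k + l)
          positive k l (inj₁ refl) = s≤s z≤n
          positive k l (inj₂ refl) rewrite ℕ.+-comm k 1 = s≤s z≤n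

        sum²-0 : sum² {n} {n} (λ _ _ → 0) ≡ 0
        sum²-0 = trans (sum-cong-≗ {n} λ _ → sum-replicate-zero n) (sum-replicate-zero n)

      first : ∃[ Z ] Path Y Z × multi Z ≐ multi Y × Movable Z v a b
      first with movable-or-jammed Y va≤1 1≤vb
      ... | inj₁ ok = Y , ε , (λ _ _ → refl) , ok
      ... | inj₂ (c , jam , va≡1 , vb≡1) =
        let Z , s , Z≐Y , ok , _ = unjam Y c (λ _ _ → 0) (λ _ _ → refl) v≢a a≢b jam
               (weaken (both1 (multi Y v a) (multi Y v b)) (both1 (multi Y b z) (multi Y a z)) (opposite c) (sum² {n} {n} (λ _ _ → 0))
                 (inj₁ (cong₂ both1 va≡1 vb≡1)) sum²-0 cost≤)
        in Z , s ◅ ε , Z≐Y , ok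

      private
        symY = Admissible.symmetric (admissible Y)

        zb≢za : ∀ {x y} → Edge v a x y ⊎ Edge v b x y → ¬ Edge z a x y
        zb≢za (inj₁ e) e′ with edge-trans e (edge-sym e′)
        ... | inj₁ (z≡v , _) = v≢z (sym z≡v)
        ... | inj₂ (z≡a , _) = a≢z (sym z≡a)
        zb≢za (inj₂ e) e′ with edge-trans e (edge-sym e′)
        ... | inj₁ (z≡v , _) = v≢z (sym z≡v)
        ... | inj₂ (z≡b , _) = b≢z (sym z≡b)

        layer-unique : ∀ Z c {x y} → multi Z x y ≡ 1 → 1 ≤ layer Z c x y → layer Z (opposite c) x y ≡ 0
        layer-unique Z c {x} {y} m≡1 1≤g = ℕ.n≤0⇒n≡0 (ℕ.+-cancelˡ-≤ 1 _ 0 (begin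
          1 + layer Z (opposite c) x y              ≤⟨ ℕ.+-monoˡ-≤ _ 1≤g ⟩
          layer Z c x y + layer Z (opposite c) x y  ≡⟨ multi-split Z c x y ⟨
          multi Z x y                               ≡⟨ m≡1 ⟩
          1                                         ∎))
          where open ℕ.≤-Reasoning

        module _ (Z : State) (Z≐Y : multi Z ≐ multi Y) (ok : Movable Z v a b)
                 (c : Fin 2) (jam : Jammed Z c z b a) (zb≡1 : multi Z z b ≡ 1) (za≡1 : multi Z z a ≡ 1) where

          both1-side₂ : both1 (multi Y b z) (multi Y a z) ≡ 1
          both1-side₂ = cong₂ both1 (trans (symY b z) (trans (sym (Z≐Y z b)) zb≡1))
                                    (trans (symY a z) (trans (sym (Z≐Y z a)) za≡1))

          -- With all four edges single the cost reserves 4, so that one edge, of total 2, can be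
          -- protected while the second side is unjammed.
          unjam₂-preserving : (A : Fin n → Fin n → ℕ) → Symmetric A → sum² A ≡ 2 →
            multi Z v a ≡ 1 → multi Z v b ≡ 1 →
            A v a ≢ 0 ⊎ layer Z (opposite c) v a ≡ 0 → A v b ≢ 0 ⊎ layer Z (opposite c) v b ≡ 0 →
            ∃[ W ] Step Z W × multi W ≐ multi Z × Movable W v a b × Movable W z b a
          unjam₂-preserving A symA A≡2 va≡1 vb≡1 Ava Avb =
            let W , s , W≐Z , ok₂ , keep = unjam Z c A symA (≢-sym b≢z) (≢-sym a≢b) jam enough
            in W , s , W≐Z , movable-resp {Z} {W} (λ d → keep d v a Ava (zb≢za (inj₁ (inj₁ (refl , refl)))))
                                                  (λ d → keep d v b Avb (zb≢za (inj₂ (inj₁ (refl , refl))))) ok , ok₂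
            where
            open ℕ.≤-Reasoning
            both1-side₁ : both1 (multi Y v a) (multi Y v b) ≡ 1
            both1-side₁ = cong₂ both1 (trans (sym (Z≐Y v a)) va≡1) (trans (sym (Z≐Y v b)) vb≡1)
            enough : doubles (multi Z) + sum² A < total (opposite c)
            enough = begin-strict
              doubles (multi Z) + sum² A     ≡⟨ cong₂ _+_ (≐-sum² dbl Z≐Y) A≡2 ⟩
              doubles (multi Y) + 2          <⟨ ℕ.+-monoʳ-< (doubles (multi Y)) {2} {2 * (1 + 1)} (s≤s (s≤s (s≤s z≤n))) ⟩
              doubles (multi Y) + 2 * (1 + 1)
                ≡⟨ cong₂ (λ k l → doubles (multi Y) + 2 * (k + l)) both1-side₁ both1-side₂ ⟨
              cost (multi Y) v a b z         ≤⟨ cost≤ ⟩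
              B                              ≤⟨ B≤total (opposite c) ⟩
              total (opposite c)             ∎

          -- One protected edge is enough. The first side is movable and its two edges are single,
          -- so they have different colours; the one lacking the colour opposite to `c` is safe
          -- anyway, and the other is protected.
          unjam₂-tight : multi Z v a ≡ 1 → multi Z v b ≡ 1 →
            ∃[ W ] Step Z W × multi W ≐ multi Z × Movable W v a b × Movable W z b a
          unjam₂-tight va≡1 vb≡1 with opposite c Fin.≟ proj₁ ok
          ... | yes e = unjam₂-preserving (ind v b) (ind-sym v b) (sum²-ind v b) va≡1 vb≡1
                  (inj₂ (subst (λ d → layer Z d v a ≡ 0) (sym e) (proj₂ (proj₂ ok))))
                  (inj₁ λ z → contradiction (trans (sym z) (ind-self v≢b)) λ ())
          ... | no ne = unjam₂-preserving (ind v a) (ind-sym v a) (sum²-ind v a) va≡1 vb≡1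
                  (inj₁ λ z → contradiction (trans (sym z) (ind-self v≢a)) λ ())
                  (inj₂ (subst (λ d → layer Z d v b ≡ 0) (sym (≢⇒opposite ne)) (layer-unique Z (proj₁ ok) vb≡1 (proj₁ (proj₂ ok)))))

          -- Unless `v a` and `v b` are both single, no colouring jams the first side, so nothing
          -- has to be protected.
          unjam₂-loose : ¬ (multi Z v a ≡ 1 × multi Z v b ≡ 1) →
            ∃[ W ] Step Z W × multi W ≐ multi Z × Movable W v a b × Movable W z b a
          unjam₂-loose ¬11 =
            let W , s , W≐Z , ok₂ , _ = unjam Z c (λ _ _ → 0) (λ _ _ → refl) (≢-sym b≢z) (≢-sym a≢b) jam enough
            in W , s , W≐Z , side₁ W W≐Z , ok₂
            where
            enough : doubles (multi Z) + sum² {n} {n} (λ _ _ → 0) < total (opposite c)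
            enough = subst (λ k → k + sum² {n} {n} (λ _ _ → 0) < total (opposite c)) (sym (≐-sum² dbl Z≐Y))
              (weaken (both1 (multi Y v a) (multi Y v b)) (both1 (multi Y b z) (multi Y a z)) (opposite c) (sum² {n} {n} (λ _ _ → 0))
                 (inj₂ both1-side₂) sum²-0 cost≤)
            side₁ : ∀ W → multi W ≐ multi Z → Movable W v a b
            side₁ W W≐Z with movable-or-jammed W (subst (_≤ 1) (sym (trans (W≐Z v a) (Z≐Y v a))) va≤1)
                                                (subst (1 ≤_) (sym (trans (W≐Z v b) (Z≐Y v b))) 1≤vb)
            ... | inj₁ ok′ = ok′
            ... | inj₂ (_ , _ , p , q) = contradiction (trans (sym (W≐Z v a)) p , trans (sym (W≐Z v b)) q) ¬11

          unjam₂ : ∃[ W ] Step Z W × multi W ≐ multi Z × Movable W v a b × Movable W z b a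
          unjam₂ with multi Z v a ℕ.≟ 1 ×-dec multi Z v b ℕ.≟ 1
          ... | yes (p , q) = unjam₂-tight p q
          ... | no ¬p = unjam₂-loose ¬p

      unjammed : Goal
      unjammed = finish first
        where
        finish : ∃[ Z ] Path Y Z × multi Z ≐ multi Y × Movable Z v a b → Goal
        finish (Z , path , Z≐Y , ok)
          with movable-or-jammed Z {z} {b} {a} (subst (_≤ 1) (sym (trans (Z≐Y z b) (symY z b))) bz≤1)
                                               (subst (1 ≤_) (sym (trans (Z≐Y z a) (symY z a))) 1≤az)
        ... | inj₁ ok₂ = Z , path , Z≐Y , ok , ok₂
        ... | inj₂ (c , jam , zb≡1 , za≡1) =
          let W , s , W≐Z , ok₁ , ok₂ = unjam₂ Z Z≐Y ok c jam zb≡1 za≡1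
          in W , path ◅◅ s ◅ ε , (λ x y → trans (W≐Z x y) (Z≐Y x y)) , ok₁ , ok₂

  -- Lifting connections of multigraphs to states.

  cost-resp : ∀ {M N : Graph {n}} → M ≐ N → ∀ v a b z → cost M v a b z ≡ cost N v a b z
  cost-resp {M} {N} M≐N v a b z = cong₂ (λ d k → d + 2 * k) (≐-sum² dbl M≐N)
    (cong₂ _+_ (cong₂ both1 (M≐N v a) (M≐N v b)) (cong₂ both1 (M≐N b z) (M≐N a z)))

  lift-switch : ∀ Y {M M′} → multi Y ≐ M → Admissible degreeᵢₙ B M′ → Switch B M M′ →
                ∃[ Z ] Path Y Z × multi Z ≐ M′
  lift-switch Y {M} {M′} Y≐M AM′ (switch {v} {a} {b} {z} D eq c) =
    let W , path , W≐Y , (c₁ , p₁ , q₁) , (c₂ , p₂ , q₂) = U.unjammed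
        Z , s , eqZ = exchange W c₁ c₂ D p₁ q₁
                        -- The second side was treated as seen from `z`, with `a` and `b` in
                        -- exchanged roles; symmetry of the layers translates it back.
                        (subst (1 ≤_) (layer-sym W c₂ z a) p₂) (trans (layer-sym W c₂ b z) q₂)
    in Z , path ◅◅ s ◅ ε , λ x y → ℕ.+-cancelʳ-≡ (ind v b x y + ind a z x y) _ _ (begin
         multi Z x y + (ind v b x y + ind a z x y)  ≡⟨ multi-equation W Z c₁ c₂ x y (λ d → eqZ d x y) ⟩
         multi W x y + (ind v a x y + ind b z x y)  ≡⟨ cong (_+ (ind v a x y + ind b z x y)) (trans (W≐Y x y) (Y≐M x y)) ⟩
         M x y + (ind v a x y + ind b z x y)        ≡⟨ eq x y ⟨
         M′ x y + (ind v b x y + ind a z x y)       ∎)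
    where
    open ≡-Reasoning
    open Switched {M = M} {M′} D eq
    below : ∀ {x y} → M′ x y ≡ suc (M x y) → multi Y x y ≤ 1
    below {x} {y} e = subst (_≤ 1) (sym (Y≐M x y)) (s≤s⁻¹ (subst (_≤ 2) e (Admissible.bounded AM′ x y)))
    above : ∀ {x y} → M x y ≡ suc (M′ x y) → 1 ≤ multi Y x y
    above {x} {y} e = subst (1 ≤_) (sym (trans (Y≐M x y) e)) (s≤s z≤n)
    module U = Unjamming D Y (below va) (above vb) (below bz) (above az) (subst (_≤ B) (sym (cost-resp Y≐M v a b z)) c)

  lift : ∀ Y {M N} → multi Y ≐ M → M ⇝ N → ∃[ Z ] Path Y Z × multi Z ≐ N
  lift Y Y≐M (same M≐N) = Y , ε , λ x y → trans (Y≐M x y) (M≐N x y)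
  lift Y Y≐M (switch AM AN s) = lift-switch Y Y≐M AN s
  lift Y Y≐M (r then r′) =
    let Z , path , Z≐K = lift Y Y≐M r
        W , path′ , W≐N = lift Z Z≐K r′
    in W , path ◅◅ path′ , W≐N

  same-multi : ∀ Y Y₀ → ∃[ Z ] Path Y Z × multi Z ≐ multi Y₀
  same-multi Y Y₀ = lift Y (λ _ _ → refl) (connected (admissible Y) (admissible Y₀))

  -- Matching the colours of two states with the same multigraph.

  SameLayers : State → State → Set
  SameLayers Y Z = ∀ c x y → layer Y c x y ≡ layer Z c x y

  private
    0<1-split : ∀ {k l} → k < l → l ≤ 1 → k ≡ 0 × l ≡ 1
    0<1-split {zero} {suc zero} _ _ = refl , refl
    0<1-split {_} {suc (suc _)} _ (s≤s ())
    0<1-split {suc _} {suc zero} (s≤s ()) _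

  -- Layer `zero` suffices: with equal multigraphs it determines the other layer.
  colour-distance : State → State → ℕ
  colour-distance Y Y₀ = sum² λ x y → ∣ layer Y zero x y - layer Y₀ zero x y ∣

  module _ (Y Y₀ : State) (Y≐Y₀ : multi Y ≐ multi Y₀) {x₁ y₁ x₂ y₂ : Fin n}
    (lt₁ : layer Y₀ zero x₁ y₁ < layer Y zero x₁ y₁) (lt₂ : layer Y zero x₂ y₂ < layer Y₀ zero x₂ y₂) where

    private
      g₁ : layer Y zero x₁ y₁ ≡ 1
      g₁ = proj₂ (0<1-split lt₁ (simple Y zero x₁ y₁))
      h₁ : layer Y₀ zero x₁ y₁ ≡ 0
      h₁ = proj₁ (0<1-split lt₁ (simple Y zero x₁ y₁))
      g₂ : layer Y zero x₂ y₂ ≡ 0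
      g₂ = proj₁ (0<1-split lt₂ (simple Y₀ zero x₂ y₂))
      h₂ : layer Y₀ zero x₂ y₂ ≡ 1
      h₂ = proj₂ (0<1-split lt₂ (simple Y₀ zero x₂ y₂))
      k₁ : layer Y (suc zero) x₁ y₁ ≡ 0
      k₁ = ℕ.n≤0⇒n≡0 (s≤s⁻¹ (begin
        1 + layer Y (suc zero) x₁ y₁                  ≡⟨ cong (_+ layer Y (suc zero) x₁ y₁) g₁ ⟨
        multi Y x₁ y₁                                 ≡⟨ Y≐Y₀ x₁ y₁ ⟩
        multi Y₀ x₁ y₁                                ≡⟨ cong (_+ layer Y₀ (suc zero) x₁ y₁) h₁ ⟩
        layer Y₀ (suc zero) x₁ y₁                     ≤⟨ simple Y₀ (suc zero) x₁ y₁ ⟩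
        1                                             ∎))
        where open ℕ.≤-Reasoning
      k₂ : 1 ≤ layer Y (suc zero) x₂ y₂
      k₂ = begin
        1                                             ≤⟨ s≤s z≤n ⟩
        1 + layer Y₀ (suc zero) x₂ y₂                 ≡⟨ cong (_+ layer Y₀ (suc zero) x₂ y₂) h₂ ⟨
        multi Y₀ x₂ y₂                                ≡⟨ Y≐Y₀ x₂ y₂ ⟨
        multi Y x₂ y₂                                 ≡⟨ cong (_+ layer Y (suc zero) x₂ y₂) g₂ ⟩
        layer Y (suc zero) x₂ y₂                      ∎
        where open ℕ.≤-Reasoning
      open Recoloured (recolour Y {zero} {suc zero} (λ ()) (ℕ.≤-reflexive (sym g₁)) k₁ k₂ g₂)

      distance-at : Fin n → Fin n → State → ℕ
      distance-at x y W = ∣ layer W zero x y - layer Y₀ zero x y ∣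

      at₁ : ∀ {x y} → Edge x₁ y₁ x y → distance-at x y result ≡ 0
      at₁ e = trans (cong₂ ∣_-_∣ (edge-resp (layer-sym result zero) e) (edge-resp (layer-sym Y₀ zero) e))
                    (cong₂ ∣_-_∣ loss₁ h₁)
      at₂ : ∀ {x y} → Edge x₂ y₂ x y → distance-at x y result ≡ 0
      at₂ e = trans (cong₂ ∣_-_∣ (edge-resp (layer-sym result zero) e) (edge-resp (layer-sym Y₀ zero) e))
                    (cong₂ ∣_-_∣ (ℕ.≤-antisym (simple result zero x₂ y₂) gain₂) h₂)

      closer-at : ∀ x y → distance-at x y result ≤ distance-at x y Y
      closer-at x y with edge? x₁ y₁ x y | edge? x₂ y₂ x y
      ... | yes e | _ = subst (_≤ distance-at x y Y) (sym (at₁ e)) z≤n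
      ... | no _ | yes e = subst (_≤ distance-at x y Y) (sym (at₂ e)) z≤n
      ... | no ¬e₁ | no ¬e₂ = ℕ.≤-reflexive (cong (∣_- layer Y₀ zero x y ∣) (elsewhere zero x y ¬e₁ ¬e₂))

    -- Equality of the multigraphs forces the first edge to have only colour `zero` in `Y` and the
    -- second only the other colour, so trading them is legal and corrects both.
    recolour-closer : ∃[ Z ] Step Y Z × multi Z ≐ multi Y × colour-distance Z Y₀ < colour-distance Y Y₀
    recolour-closer = result , step , multi≐ ,
      sum²-mono-< _ _ closer-at {x₁} {y₁}
        (subst₂ _<_ (sym (at₁ (inj₁ (refl , refl)))) (sym (cong₂ ∣_-_∣ g₁ h₁)) (s≤s z≤n))

  module _ (Y₀ : State) where

    private
      colours-from : ∀ k Y → multi Y ≐ multi Y₀ → colour-distance Y Y₀ < k → ∃[ Z ] Path Y Z × SameLayers Z Y₀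
      colours-from (suc k) Y Y≐Y₀ (s≤s d≤k)
        with Fin.any? (λ x → Fin.any? λ y → ¬? (layer Y zero x y ℕ.≟ layer Y₀ zero x y))
      ... | no none = Y , ε , λ where
          zero x y → zero≡ x y
          (suc zero) x y → ℕ.+-cancelˡ-≡ (layer Y zero x y) _ _ (trans (Y≐Y₀ x y) (cong (_+ layer Y₀ (suc zero) x y) (sym (zero≡ x y))))
        where
        zero≡ : ∀ x y → layer Y zero x y ≡ layer Y₀ zero x y
        zero≡ x y = decidable-stable (layer Y zero x y ℕ.≟ layer Y₀ zero x y) λ ne → none (x , y , ne)
      ... | yes (x , y , ne) = continue (disagreements (ℕ.<-cmp (layer Y zero x y) (layer Y₀ zero x y)))
        where
        -- All states have equally many arcs of colour `zero`, so a surplus at one edge comes with a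
        -- deficit at another.
        sums : sum² (layer Y zero) ≡ sum² (layer Y₀ zero)
        sums = trans (sum²-layer Y zero) (sym (sum²-layer Y₀ zero))
        Disagreements : Set
        Disagreements = (∃[ x ] ∃[ y ] layer Y₀ zero x y < layer Y zero x y)
                      × (∃[ x ] ∃[ y ] layer Y zero x y < layer Y₀ zero x y)
        disagreements : _ → Disagreements
        disagreements (tri< lt _ _) = sum²-≡⇒∃> (layer Y zero) (layer Y₀ zero) sums lt , (x , y , lt)
        disagreements (tri≈ _ e _) = contradiction e ne
        disagreements (tri> _ _ gt) = (x , y , gt) , sum²-≡⇒∃> (layer Y₀ zero) (layer Y zero) (sym sums) gt
        continue : Disagreements → ∃[ Z ] Path Y Z × SameLayers Z Y₀
        continue ((_ , _ , lt₁) , (_ , _ , lt₂)) =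
          let Z , s , Z≐Y , closer = recolour-closer Y Y₀ Y≐Y₀ lt₁ lt₂
              W , path , W≡ = colours-from k Z (λ x y → trans (Z≐Y x y) (Y≐Y₀ x y)) (ℕ.<-≤-trans closer d≤k)
          in W , s ◅ path , W≡

    same-layers : ∀ Y → ∃[ Z ] Path Y Z × SameLayers Z Y₀
    same-layers Y =
      let Z , path , Z≐Y₀ = same-multi Y Y₀
          W , path′ , W≡ = colours-from _ Z Z≐Y₀ (ℕ.n<1+n _)
      in W , path ◅◅ path′ , W≡

  -- Matching positions and stubs once the layers agree.

  edge-map : ∀ {k l} (f : Fin k → Fin l) {a b x y} → Edge a b x y → Edge (f a) (f b) (f x) (f y)
  edge-map f (inj₁ (refl , refl)) = inj₁ (refl , refl)
  edge-map f (inj₂ (refl , refl)) = inj₂ (refl , refl)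

  -- A head is a set of two stubs, so `in₁` and `in₂` may be interchanged.
  record Agrees (α β : Arc) : Set where
    constructor agrees
    field
      same-out : out α ≡ out β
      same-in  : Edge (in₁ α) (in₂ α) (in₁ β) (in₂ β)

  has-head : Arc → Fin q → Fin q → Set
  has-head α s r = Edge (in₁ α) (in₂ α) s r

  tail-position : ∀ Y s → ∃[ i ] out (arcs Y i) ≡ s
  tail-position Y s =
    let i , lt = sum-<⇒∃ {m} (λ _ → 0) (λ i → kron (out (arcs Y i)) s)
                   (subst₂ _<_ (sym (sum-replicate-zero m)) (sym (tails=1 Y s)) (s≤s z≤n))
    in i , kron>0⇒≡ lt

  head-position : ∀ Y s → ∃[ i ] ∃[ r ] has-head (arcs Y i) s r
  head-position Y s =
    let i , lt = sum-<⇒∃ {m} (λ _ → 0) (λ i → heads (arcs Y i) s)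
                   (subst₂ _<_ (sym (sum-replicate-zero m)) (sym (heads=1 Y s)) (s≤s z≤n))
    in i , one-of (in₁ (arcs Y i)) (in₂ (arcs Y i)) lt
    where
    one-of : ∀ a b → 0 < kron a s + kron b s → ∃[ r ] Edge a b s r
    one-of a b lt with a Fin.≟ s | b Fin.≟ s
    ... | yes refl | _ = b , inj₁ (refl , refl)
    ... | no _ | yes refl = a , inj₂ (refl , refl)
    ... | no _ | no _ = contradiction lt λ ()

  tails-distinct : ∀ Y {i j} → i ≢ j → out (arcs Y i) ≢ out (arcs Y j)
  tails-distinct Y {i} {j} i≢j e = ℕ.1+n≰n (begin
    2                                       ≡⟨ cong₂ _+_ (trans (cong (λ t → kron t s) e) (kron-refl s)) (kron-refl s) ⟨
    kron (out (arcs Y i)) s + kron s s            ≤⟨ sum-two-terms (λ k → kron (out (arcs Y k)) s) i≢j ⟩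
    sum (λ k → kron (out (arcs Y k)) s)        ≡⟨ tails=1 Y s ⟩
    1                                       ∎)
    where
    open ℕ.≤-Reasoning
    s = out (arcs Y j)

  head-count : ∀ α {s r} → has-head α s r → 1 ≤ heads α s
  head-count α {s} (inj₁ (refl , _)) = ℕ.m≤n⇒m≤n+o _ (ℕ.≤-reflexive (sym (kron-refl s)))
  head-count α {s} (inj₂ (refl , _)) = ℕ.m≤n⇒m≤o+n (kron (in₁ α) s) (ℕ.≤-reflexive (sym (kron-refl s)))

  heads-distinct : ∀ Y {i j s r r′} → i ≢ j → has-head (arcs Y i) s r → ¬ has-head (arcs Y j) s r′
  heads-distinct Y {i} {j} {s} i≢j e e′ = ℕ.1+n≰n (begin
    2                                       ≤⟨ ℕ.+-mono-≤ (head-count (arcs Y i) e) (head-count (arcs Y j) e′) ⟩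
    heads (arcs Y i) s + heads (arcs Y j) s ≤⟨ sum-two-terms (λ k → heads (arcs Y k) s) i≢j ⟩
    sum (λ k → heads (arcs Y k) s)          ≡⟨ heads=1 Y s ⟩
    1                                       ∎)
    where open ℕ.≤-Reasoning

  in-distinct : ∀ Y i → in₁ (arcs Y i) ≢ in₂ (arcs Y i)
  in-distinct Y i e = loopless-arcs Y i (cong vertex e)

  module _ (Y₀ : State) (κ : Fin m) where

    -- The invariant for treating positions in increasing order: those below `κ` are final, and the
    -- layers already match, so every arc still needed has a counterpart.
    record Good (Z : State) : Set where
      field
        settled : ∀ i → toℕ i < toℕ κ → Agrees (arcs Z i) (arcs Y₀ i)
        layers≡ : SameLayers Z Y₀

    open Good

    module _ (Z : State) (G : Good Z) {j : Fin m} (κ≢j : κ ≢ j) (j≮κ : ¬ toℕ j < toℕ κ) (α β : Arc)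
      (tails≡ : ∀ s → kron (out (arcs Z κ)) s + kron (out (arcs Z j)) s ≡ kron (out α) s + kron (out β) s)
      (heads≡ : ∀ s → heads (arcs Z κ) s + heads (arcs Z j) s ≡ heads α s + heads β s)
      (weights≡ : ∀ c x y → weight α c x y + weight β c x y ≡ weight (arcs Z κ) c x y + weight (arcs Z j) c x y) where

      -- Only `κ` and a position not below it are touched, and equal weights keep all layers, so the
      -- move is legal without further conditions.
      relabel : ∃[ W ] Path Z W × Good W × arcs W κ ≡ α
      relabel = result , step ◅ ε , record { settled = settled′ ; layers≡ = layers′ } , result-i
        where
        open Replaced (replace Z κ≢j α β tails≡ heads≡
          (λ c x y → subst (λ k → layer Z c x y + k ≤ 1 + (weight (arcs Z κ) c x y + weight (arcs Z j) c x y))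
                           (sym (weights≡ c x y)) (ℕ.+-monoˡ-≤ _ (simple Z c x y))))
        settled′ : ∀ i → toℕ i < toℕ κ → Agrees (arcs result i) (arcs Y₀ i)
        settled′ i i<κ = subst (λ γ → Agrees γ (arcs Y₀ i))
          (sym (unchanged i (λ { refl → ℕ.<-irrefl refl i<κ }) (λ { refl → j≮κ i<κ }))) (settled G i i<κ)
        layers′ : SameLayers result Y₀
        layers′ c x y = trans (ℕ.+-cancelʳ-≡ (weight (arcs Z κ) c x y + weight (arcs Z j) c x y) _ _
          (trans (layers c x y) (cong (layer Z c x y +_) (weights≡ c x y)))) (layers≡ G c x y)

    private
      α₀ = arcs Y₀ κ

      SameEdge : Arc → Set
      SameEdge α = arc-edge α (vertex (in₁ α₀)) (vertex (in₂ α₀))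

      -- Equal layers provide an arc of the right colour on the right edge, and trading its position
      -- with `κ` is itself a shuffle. It is not at a settled position, since `Y₀` would then have
      -- parallel arcs of one colour.
      fix-edge : ∀ Z → Good Z → ∃[ W ] Path Z W × Good W × colour (out (arcs W κ)) ≡ colour (out α₀) × SameEdge (arcs W κ)
      fix-edge Z G = go (layer-arc Z {c} {x} {y} (subst (1 ≤_) (sym (layers≡ G c x y)) present))
        where
        c = colour (out α₀)
        x = vertex (in₁ α₀)
        y = vertex (in₂ α₀)
        present : 1 ≤ layer Y₀ c x y
        present = subst (_≤ layer Y₀ c x y) (weight-1 Y₀ κ refl (inj₁ (refl , refl))) (term≤sum (λ k → weight (arcs Y₀ k) c x y) κ)
        go : ∃[ i ] colour (out (arcs Z i)) ≡ c × arc-edge (arcs Z i) x y → _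
        go (j , cj , ej) with κ Fin.≟ j
        ... | yes refl = Z , ε , G , cj , ej
        ... | no κ≢j =
          let W , path , G′ , e = relabel Z G κ≢j j≮κ (arcs Z j) (arcs Z κ)
                (λ s → ℕ.+-comm (kron (out (arcs Z κ)) s) _) (λ s → ℕ.+-comm (heads (arcs Z κ) s) _)
                (λ c x y → ℕ.+-comm (weight (arcs Z j) c x y) _)
          in W , path , G′ , trans (cong (λ γ → colour (out γ)) e) cj , subst SameEdge (sym e) ej
          where
          j≮κ : ¬ toℕ j < toℕ κ
          j≮κ j<κ = arcs-distinct Y₀ κ≢j (sym (trans (cong colour (sym (same-out A))) cj)) (inj₁ (refl , refl))
                      (edge-trans (edge-sym (edge-map vertex (same-in A))) ej)
            where
            A = settled G j j<κ
            open Agrees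

      -- The two tails have the same colour, so trading them leaves the layers alone. A settled
      -- position cannot hold the wanted out-stub, which occurs only once in `Y₀`.
      fix-tail : ∀ Z → Good Z → colour (out (arcs Z κ)) ≡ colour (out α₀) → SameEdge (arcs Z κ) →
                 ∃[ W ] Path Z W × Good W × out (arcs W κ) ≡ out α₀ × SameEdge (arcs W κ)
      fix-tail Z G cκ eκ = go (tail-position Z (out α₀))
        where
        go : ∃[ i ] out (arcs Z i) ≡ out α₀ → _
        go (j , tj) with κ Fin.≟ j
        ... | yes refl = Z , ε , G , tj , eκ
        ... | no κ≢j =
          let W , path , G′ , e = relabel Z G κ≢j j≮κ α β (λ s → ℕ.+-comm (kron (out (arcs Z κ)) s) _) (λ s → refl)
                (λ c x y → cong₂ (λ k l → kron k c * ind (vertex (in₁ (arcs Z κ))) (vertex (in₂ (arcs Z κ))) x y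
                                        + kron l c * ind (vertex (in₁ (arcs Z j))) (vertex (in₂ (arcs Z j))) x y)
                                 (trans (cong colour tj) (sym cκ)) (trans cκ (sym (cong colour tj))))
          in W , path , G′ , trans (cong out e) tj , subst SameEdge (sym e) eκ
          where
          α β : Arc
          α = arc (out (arcs Z j)) (in₁ (arcs Z κ)) (in₂ (arcs Z κ))
          β = arc (out (arcs Z κ)) (in₁ (arcs Z j)) (in₂ (arcs Z j))
          j≮κ : ¬ toℕ j < toℕ κ
          j≮κ j<κ = tails-distinct Y₀ κ≢j (sym (trans (sym (Agrees.same-out (settled G j j<κ))) tj))

      -- Trades `h` for the wanted stub `s` of the same vertex while `k` stays. If `s` is already in
      -- the head at `κ`, then `s ≢ k` shows that it is `h` itself.
      fix-head : ∀ Z → Good Z → ∀ {h k s r₀} → has-head (arcs Z κ) h k → has-head α₀ s r₀ → vertex h ≡ vertex s → s ≢ k →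
                 ∃[ W ] Path Z W × Good W × out (arcs W κ) ≡ out (arcs Z κ) × has-head (arcs W κ) s k
      fix-head Z G {h} {k} {s} {r₀} hκ h₀ vh≡vs s≢k = go (head-position Z s)
        where
        go : ∃[ i ] ∃[ r ] has-head (arcs Z i) s r → _
        go (j , r , hj) with κ Fin.≟ j
        ... | yes refl = Z , ε , G , refl , here (edge-trans (edge-sym hκ) hj)
          where
          here : Edge h k s r → has-head (arcs Z κ) s k
          here (inj₁ (refl , _)) = hκ
          here (inj₂ (s≡k , _)) = contradiction s≡k s≢k
        ... | no κ≢j =
          let W , path , G′ , e = relabel Z G κ≢j j≮κ α β (λ s → refl)
                (λ u → trans (cong₂ _+_ (pair≡ hκ u) (pair≡ hj u)) (rotate (kron h u) (kron k u) (kron s u) (kron r u)))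
                (λ c x y → cong₂ _+_ (cong (kron (colour (out (arcs Z κ))) c *_) (ind-resp (edge-sym (vertices-κ)) x y))
                                     (cong (kron (colour (out (arcs Z j))) c *_) (ind-resp (edge-sym (vertices-j)) x y)))
          in W , path , G′ , cong out e , subst (λ γ → has-head γ s k) (sym e) (inj₁ (refl , refl))
          where
          α β : Arc
          α = arc (out (arcs Z κ)) s k
          β = arc (out (arcs Z j)) h r
          rotate : ∀ a b c d → (a + b) + (c + d) ≡ (c + b) + (a + d)
          rotate = solve-∀
          vertices-κ : arc-edge (arcs Z κ) (vertex s) (vertex k)
          vertices-κ = subst (λ x → arc-edge (arcs Z κ) x (vertex k)) vh≡vs (edge-map vertex hκ)
          vertices-j : arc-edge (arcs Z j) (vertex h) (vertex r)
          vertices-j = subst (λ x → arc-edge (arcs Z j) x (vertex r)) (sym vh≡vs) (edge-map vertex hj)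
          j≮κ : ¬ toℕ j < toℕ κ
          j≮κ j<κ = heads-distinct Y₀ κ≢j h₀ (edge-trans (edge-sym (Agrees.same-in (settled G j j<κ))) hj)

    settle-next : ∀ Z → Good Z → ∃[ W ] Path Z W × Good W × Agrees (arcs W κ) α₀
    settle-next Z G =
      let Z₁ , p₁ , G₁ , c₁ , e₁ = fix-edge Z G
          Z₂ , p₂ , G₂ , t₂ , e₂ = fix-tail Z₁ G₁ c₁ e₁
          h , k , vh , vk , hk = orient (arcs Z₂ κ) e₂
          Z₃ , p₃ , G₃ , t₃ , h₃ = fix-head Z₂ G₂ {r₀ = in₂ α₀} hk (inj₁ (refl , refl)) vh
                                    (λ e → loopless-arcs Y₀ κ (trans (cong vertex e) vk))
          Z₄ , p₄ , G₄ , t₄ , h₄ = fix-head Z₃ G₃ {r₀ = in₁ α₀} (edge-trans h₃ (inj₂ (refl , refl))) (inj₂ (refl , refl)) vk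
                                    (≢-sym (in-distinct Y₀ κ))
      in Z₄ , p₁ ◅◅ p₂ ◅◅ p₃ ◅◅ p₄ , G₄ , agrees (trans t₄ (trans t₃ t₂)) (edge-trans h₄ (inj₂ (refl , refl)))

  private
    settle-upto : ∀ Y₀ Z → SameLayers Z Y₀ → ∀ k → k ≤ m →
      ∃[ W ] Path Z W × SameLayers W Y₀ × (∀ i → toℕ i < k → Agrees (arcs W i) (arcs Y₀ i))
    settle-upto Y₀ Z Z≡ zero _ = Z , ε , Z≡ , λ _ ()
    settle-upto Y₀ Z Z≡ (suc k) k<m =
      let Z₁ , p₁ , Z₁≡ , S₁ = settle-upto Y₀ Z Z≡ k (ℕ.<⇒≤ k<m)
          W , p₂ , G , A = settle-next Y₀ κ Z₁ (record { settled = λ i i<κ → S₁ i (subst (toℕ i <_) κ≡k i<κ) ; layers≡ = Z₁≡ })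
      in W , p₁ ◅◅ p₂ , Good.layers≡ G , λ i i<1+k → next W G A i (ℕ.m≤n⇒m<n∨m≡n (s≤s⁻¹ i<1+k))
      where
      κ : Fin m
      κ = fromℕ< k<m
      κ≡k : toℕ κ ≡ k
      κ≡k = Fin.toℕ-fromℕ< k<m
      next : ∀ W → Good Y₀ κ W → Agrees (arcs W κ) (arcs Y₀ κ) → ∀ i → toℕ i < k ⊎ toℕ i ≡ k → Agrees (arcs W i) (arcs Y₀ i)
      next W G A i (inj₁ i<k) = Good.settled G i (subst (toℕ i <_) (sym κ≡k) i<k)
      next W G A i (inj₂ i≡k) = subst (λ i → Agrees (arcs W i) (arcs Y₀ i)) (Fin.toℕ-injective (trans κ≡k (sym i≡k))) A

  state-connected : ∀ Y Y₀ → ∃[ W ] Path Y W × (∀ i → Agrees (arcs W i) (arcs Y₀ i))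
  state-connected Y Y₀ =
    let Z , p₁ , Z≡ = same-layers Y₀ Y
        W , p₂ , _ , S = settle-upto Y₀ Z Z≡ m ℕ.≤-refl
    in W , p₁ ◅◅ p₂ , λ i → S i (Fin.toℕ<n i)

-- Stub sets of one and two elements, and their characteristic functions.

module Subsets where

  open import Defs
  open import Data.Bool.Base using (Bool; true; false; if_then_else_; _∨_; _∧_)
  open import Data.Fin.Base using (Fin; zero; suc; splitAt)
  import Data.Fin.Base as Fin
  import Data.Fin.Properties as Fin
  open import Data.Fin.Subset using (Subset; inside; outside; _∩_; ∣_∣)
  open import Data.Fin.Subset.Properties using (_∈?_)
  open import Data.Nat.Base using (ℕ; zero; suc; _+_; _*_; _≤_; _<_; z≤n; s≤s)
  import Data.Nat.Properties as ℕ
  open import Data.Product.Base using (_×_; _,_; ∃-syntax)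
  open import Data.Sum.Base using (_⊎_; inj₁; inj₂)
  import Data.List.Relation.Unary.All as ListAll
  open import Data.List.Relation.Unary.AllPairs using ([]; _∷_)
  open import Data.List.Relation.Unary.Unique.Propositional using (Unique)
  open import Data.Vec.Base as Vec using (Vec; []; _∷_; lookup; tabulate; toList; count)
  import Data.Vec.Properties as Vec
  open import Data.Vec.Relation.Unary.All using (All; []; _∷_)
  open import Algebra.Properties.Semiring.Sum ℕ.+-*-semiring
    using (sum; sum-cong-≗; sum-replicate-zero; ∑-distrib-+)
  open import Relation.Binary.PropositionalEquality
    using (_≡_; _≢_; refl; sym; trans; cong; cong₂; module ≡-Reasoning)
  open import Relation.Nullary.Decidable using (yes; no; does)
  open import Relation.Nullary.Negation using (¬_; contradiction)
  open import Relation.Unary using (Decidable)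
  open FiniteSums
  open Edges

  private variable
    k l : ℕ
    A : Set

  χ : Subset k → Fin k → ℕ
  χ S s = if lookup S s then 1 else 0

  lookup-ext : (u v : Vec A k) → (∀ i → lookup u i ≡ lookup v i) → u ≡ v
  lookup-ext u v e = trans (sym (Vec.tabulate∘lookup u)) (trans (Vec.tabulate-cong e) (Vec.tabulate∘lookup v))

  ∣∣-sum : (S : Subset k) → ∣ S ∣ ≡ sum (χ S)
  ∣∣-sum [] = refl
  ∣∣-sum (inside ∷ S) = cong suc (∣∣-sum S)
  ∣∣-sum (outside ∷ S) = ∣∣-sum S

  count-sum : {P : A → Set} (P? : Decidable P) (v : Vec A k) →
              count P? v ≡ sum λ i → if does (P? (lookup v i)) then 1 else 0
  count-sum P? [] = refl
  count-sum P? (x ∷ v) with does (P? x)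
  ... | true = cong suc (count-sum P? v)
  ... | false = count-sum P? v

  does-∈? : (s : Fin k) (S : Subset k) → does (s ∈? S) ≡ lookup S s
  does-∈? zero (inside ∷ S) = refl
  does-∈? zero (outside ∷ S) = refl
  does-∈? (suc s) (_ ∷ S) = does-∈? s S

  singleton : Fin k → Subset k
  singleton t = tabulate λ s → does (t Fin.≟ s)

  doubleton : Fin k → Fin k → Subset k
  doubleton a b = tabulate λ s → does (a Fin.≟ s) ∨ does (b Fin.≟ s)

  χ-singleton : (t s : Fin k) → χ (singleton t) s ≡ kron t s
  χ-singleton t s = cong (if_then 1 else 0) (Vec.lookup∘tabulate _ s)

  χ-doubleton : {a b : Fin k} → a ≢ b → ∀ s → χ (doubleton a b) s ≡ kron a s + kron b s
  χ-doubleton {a = a} {b} a≢b s rewrite Vec.lookup∘tabulate (λ s → does (a Fin.≟ s) ∨ does (b Fin.≟ s)) s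
    with a Fin.≟ s | b Fin.≟ s
  ... | yes refl | yes refl = contradiction refl a≢b
  ... | yes _ | no _ = refl
  ... | no _ | yes _ = refl
  ... | no _ | no _ = refl

  doubleton-edge : {a b x y : Fin k} → Edge a b x y → doubleton a b ≡ doubleton x y
  doubleton-edge (inj₁ (refl , refl)) = refl
  doubleton-edge {a = a} {b} (inj₂ (refl , refl)) = Vec.tabulate-cong λ s → ∨-comm (does (a Fin.≟ s)) (does (b Fin.≟ s))
    where open import Data.Bool.Properties using (∨-comm)

  ∣∣≡0 : (S : Subset k) → ∣ S ∣ ≡ 0 → ∀ s → lookup S s ≡ outside
  ∣∣≡0 (outside ∷ S) e zero = refl
  ∣∣≡0 (outside ∷ S) e (suc s) = ∣∣≡0 S e s

  ∣∣≡1 : (S : Subset k) → ∣ S ∣ ≡ 1 → ∃[ t ] S ≡ singleton t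
  ∣∣≡1 S e = let t , h = go S e in t , lookup-ext _ _ λ s → trans (h s) (sym (Vec.lookup∘tabulate _ s))
    where
    go : ∀ {k} (S : Subset k) → ∣ S ∣ ≡ 1 → ∃[ t ] (∀ s → lookup S s ≡ does (t Fin.≟ s))
    go (inside ∷ S) e = zero , λ { zero → refl ; (suc s) → ∣∣≡0 S (ℕ.suc-injective e) s }
    go (outside ∷ S) e = let t , h = go S e in suc t , λ { zero → refl ; (suc s) → h s }

  ∣∣≡2 : (S : Subset k) → ∣ S ∣ ≡ 2 → ∃[ a ] ∃[ b ] a ≢ b × S ≡ doubleton a b
  ∣∣≡2 S e = let a , b , a≢b , h = go S e in a , b , a≢b , lookup-ext _ _ λ s → trans (h s) (sym (Vec.lookup∘tabulate _ s))
    where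
    go : ∀ {k} (S : Subset k) → ∣ S ∣ ≡ 2 → ∃[ a ] ∃[ b ] a ≢ b × (∀ s → lookup S s ≡ does (a Fin.≟ s) ∨ does (b Fin.≟ s))
    go (inside ∷ S) e =
      let b , S≡ = ∣∣≡1 S (ℕ.suc-injective e)
      in zero , suc b , (λ ()) , λ { zero → refl ; (suc s) → trans (cong (λ S → lookup S s) S≡) (Vec.lookup∘tabulate _ s) }
    go (outside ∷ S) e =
      let a , b , a≢b , h = go S e
      in suc a , suc b , (λ e → a≢b (Fin.suc-injective e)) , λ { zero → refl ; (suc s) → h s }

  ∣singleton∣ : (t : Fin k) → ∣ singleton t ∣ ≡ 1
  ∣singleton∣ t = trans (∣∣-sum (singleton t)) (trans (sum-cong-≗ (χ-singleton t)) (sum-kron t))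

  ∣doubleton∣ : {a b : Fin k} → a ≢ b → ∣ doubleton a b ∣ ≡ 2
  ∣doubleton∣ {a = a} {b} a≢b = trans (∣∣-sum (doubleton a b)) (trans (sum-cong-≗ (χ-doubleton a≢b))
    (trans (∑-distrib-+ (kron a) (kron b)) (cong₂ _+_ (sum-kron a) (sum-kron b))))

  lookup-fromSubset : (S : Subset k) (s : Fin k) → lookup (fromSubset S) s ≡ χ S s
  lookup-fromSubset S s = Vec.lookup-map s _ S

  fromSubset-⊎ : {S T S′ T′ : Subset k} → (∀ s → χ S s + χ T s ≡ χ S′ s + χ T′ s) →
                 fromSubset S ⊎ᵐ fromSubset T ≡ fromSubset S′ ⊎ᵐ fromSubset T′
  fromSubset-⊎ {S = S} {T} {S′} {T′} e = lookup-ext _ _ λ s → trans (at S T s) (trans (e s) (sym (at S′ T′ s)))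
    where
    at : ∀ S T s → lookup (fromSubset S ⊎ᵐ fromSubset T) s ≡ χ S s + χ T s
    at S T s = trans (Vec.lookup-zipWith _+_ s (fromSubset S) (fromSubset T))
                     (cong₂ _+_ (lookup-fromSubset S s) (lookup-fromSubset T s))

  χ-∩ : (S T : Subset k) (s : Fin k) → χ (S ∩ T) s ≡ χ S s * χ T s
  χ-∩ S T s rewrite Vec.lookup-zipWith _∧_ s S T with lookup S s | lookup T s
  ... | true | true = refl
  ... | true | false = refl
  ... | false | _ = refl

  lookup-owners : (d : Vec ℕ k) (S : Subset (Vec.sum d)) (v : Fin k) →
                  lookup (owners d S) v ≡ sum λ s → χ S s * kron (owner d s) v
  lookup-owners d S v = begin
    lookup (owners d S) v                     ≡⟨ Vec.lookup∘tabulate _ v ⟩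
    ∣ S ∩ stubsOf d v ∣                       ≡⟨ ∣∣-sum (S ∩ stubsOf d v) ⟩
    sum (χ (S ∩ stubsOf d v))                 ≡⟨ sum-cong-≗ (λ s → trans (χ-∩ S (stubsOf d v) s)
                                                  (cong (χ S s *_) (cong (if_then 1 else 0) (Vec.lookup∘tabulate _ s)))) ⟩
    sum (λ s → χ S s * kron (owner d s) v)       ∎
    where open ≡-Reasoning

  lookup-owners-singleton : (d : Vec ℕ k) (t : Fin (Vec.sum d)) (v : Fin k) →
                            lookup (owners d (singleton t)) v ≡ kron (owner d t) v
  lookup-owners-singleton d t v = trans (lookup-owners d (singleton t) v)
    (trans (sum-cong-≗ λ s → cong (_* kron (owner d s) v) (χ-singleton t s)) (sum-kron-* t (λ s → kron (owner d s) v)))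

  lookup-owners-doubleton : (d : Vec ℕ k) {a b : Fin (Vec.sum d)} → a ≢ b → (v : Fin k) →
                            lookup (owners d (doubleton a b)) v ≡ kron (owner d a) v + kron (owner d b) v
  lookup-owners-doubleton d {a} {b} a≢b v = begin
    lookup (owners d (doubleton a b)) v              ≡⟨ lookup-owners d (doubleton a b) v ⟩
    sum (λ s → χ (doubleton a b) s * o s)            ≡⟨ sum-cong-≗ (λ s → trans (cong (_* o s) (χ-doubleton a≢b s)) (ℕ.*-distribʳ-+ (o s) (kron a s) (kron b s))) ⟩
    sum (λ s → kron a s * o s + kron b s * o s)            ≡⟨ ∑-distrib-+ (λ s → kron a s * o s) _ ⟩
    sum (λ s → kron a s * o s) + sum (λ s → kron b s * o s)  ≡⟨ cong₂ _+_ (sum-kron-* a o) (sum-kron-* b o) ⟩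
    o a + o b                                        ∎
    where
    open ≡-Reasoning
    o : Fin (Vec.sum d) → ℕ
    o s = kron (owner d s) v

  pair-injective : {a b x y : Fin k} → (∀ v → kron a v + kron b v ≡ kron x v + kron y v) → Edge a b x y
  pair-injective {a = a} {b} {x} {y} e with a Fin.≟ x | b Fin.≟ x
  ... | yes refl | _ = inj₁ (refl , kron>0⇒≡ (ℕ.≤-reflexive (trans (sym (kron-refl b)) (ℕ.+-cancelˡ-≡ (kron a b) _ _ (e b)))))
  ... | no a≢x | yes refl = inj₂ (refl , kron>0⇒≡ (ℕ.≤-reflexive (trans (sym (kron-refl a))
        (ℕ.+-cancelʳ-≡ (kron b a) _ _ (trans (e a) (ℕ.+-comm (kron b a) (kron y a)))))))
  ... | no a≢x | no b≢x = contradiction (e x) λ eq → ℕ.1+n≢0 (trans (sym (trans eq (cong (_+ kron y x) (kron-refl x)))) (cong₂ _+_ (kron-≢ a≢x) (kron-≢ b≢x)))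

  all-lookup : {P : A → Set} (v : Vec A k) → ListAll.All P (toList v) → ∀ i → P (lookup v i)
  all-lookup (x ∷ v) (p ListAll.∷ ps) zero = p
  all-lookup (x ∷ v) (p ListAll.∷ ps) (suc i) = all-lookup v ps i

  lookup-all : {P : A → Set} (v : Vec A k) → (∀ i → P (lookup v i)) → ListAll.All P (toList v)
  lookup-all [] h = ListAll.[]
  lookup-all (x ∷ v) h = h zero ListAll.∷ lookup-all v (λ i → h (suc i))

  unique⇒injective : (v : Vec A k) → Unique (toList v) → ∀ i j → lookup v i ≡ lookup v j → i ≡ j
  unique⇒injective (x ∷ v) (p ∷ u) zero zero e = refl
  unique⇒injective (x ∷ v) (p ∷ u) zero (suc j) e = contradiction e (all-lookup v p j)
  unique⇒injective (x ∷ v) (p ∷ u) (suc i) zero e = contradiction (sym e) (all-lookup v p i)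
  unique⇒injective (x ∷ v) (p ∷ u) (suc i) (suc j) e = cong suc (unique⇒injective v u i j e)

  injective⇒unique : (v : Vec A k) → (∀ i j → lookup v i ≡ lookup v j → i ≡ j) → Unique (toList v)
  injective⇒unique [] h = []
  injective⇒unique (x ∷ v) h = lookup-all v (λ i e → contradiction (h zero (suc i) e) λ ())
                             ∷ injective⇒unique v (λ i j e → Fin.suc-injective (h (suc i) (suc j) e))

  sum≤1 : (f : Fin k → ℕ) → (∀ i → f i ≤ 1) → (∀ i j → 1 ≤ f i → 1 ≤ f j → i ≡ j) → sum f ≤ 1
  sum≤1 {zero} f f≤1 unique = z≤n
  sum≤1 {suc k} f f≤1 unique with f zero in e | f≤1 zero
  ... | zero | _ = sum≤1 (λ i → f (suc i)) (λ i → f≤1 (suc i)) λ i j p q → Fin.suc-injective (unique (suc i) (suc j) p q)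
  ... | suc zero | _ = s≤s (ℕ.≤-reflexive (trans (sum-cong-≗ rest) (sum-replicate-zero k)))
    where
    rest : ∀ i → f (suc i) ≡ 0
    rest i = ℕ.n<1⇒n≡0 (ℕ.≰⇒> λ p → contradiction (unique zero (suc i) (ℕ.≤-reflexive (sym e)) p) λ ())
  ... | suc (suc _) | s≤s ()

  owner-positive : (d : Vec ℕ k) (s : Fin (Vec.sum d)) → 0 < lookup d (owner d s)
  owner-positive (x ∷ d) s with splitAt x s
  owner-positive (suc x ∷ d) s | inj₁ _ = s≤s z≤n
  owner-positive (x ∷ d) s | inj₂ s′ = owner-positive d s′

  count-positive≡0 : (d : Vec ℕ k) → count (0 ℕ.<?_) d ≡ 0 → ∀ v → ¬ 0 < lookup d v
  count-positive≡0 (zero ∷ d) e zero ()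
  count-positive≡0 (zero ∷ d) e (suc v) = count-positive≡0 d e v

  count-positive≡1 : (d : Vec ℕ k) → count (0 ℕ.<?_) d ≡ 1 → ∃[ u ] ∀ v → 0 < lookup d v → v ≡ u
  count-positive≡1 (zero ∷ d) e =
    let u , h = count-positive≡1 d e in suc u , λ { zero () ; (suc v) p → cong suc (h v p) }
  count-positive≡1 (suc x ∷ d) e =
    zero , λ { zero p → refl ; (suc v) p → contradiction p (count-positive≡0 d (ℕ.suc-injective e) v) }

  count-positive≡2 : (d : Vec ℕ k) → count (0 ℕ.<?_) d ≡ 2 → ∃[ u ] ∃[ w ] ∀ v → 0 < lookup d v → v ≡ u ⊎ v ≡ w
  count-positive≡2 (zero ∷ d) e =
    let u , w , h = count-positive≡2 d e
    in suc u , suc w , λ { zero () ; (suc v) p → shift (h v p) }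
    where
    shift : ∀ {u v w : Fin k} → v ≡ u ⊎ v ≡ w → suc v ≡ suc u ⊎ suc v ≡ suc w
    shift (inj₁ refl) = inj₁ refl
    shift (inj₂ refl) = inj₂ refl
  count-positive≡2 (suc x ∷ d) e =
    let w , h = count-positive≡1 d (ℕ.suc-injective e)
    in zero , suc w , λ { zero p → inj₁ refl ; (suc v) p → inj₂ (cong suc (h v p)) }

  -- Two vertices with out-stubs give at least two out-stubs, and from these come the two hyperarcs
  -- that the method needs.
  count-positive≤sum : (d : Vec ℕ k) → count (0 ℕ.<?_) d ≤ Vec.sum d
  count-positive≤sum [] = z≤n
  count-positive≤sum (zero ∷ d) = count-positive≤sum d
  count-positive≤sum (suc x ∷ d) = s≤s (ℕ.m≤n⇒m≤o+n x (count-positive≤sum d))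

-- Translating the space into states; connectivity of the space.

module Connectivity where

  open import Defs
  open import Data.Bool.Base using (if_then_else_)
  open import Data.Fin.Base using (Fin; zero; suc; toℕ)
  import Data.Fin.Base as Fin
  import Data.Fin.Properties as Fin
  open import Data.Fin.Subset.Properties using (_∈?_)
  open import Data.Nat.Base using (ℕ; zero; suc; _+_; _≤_; _<_; z≤n; s≤s)
  import Data.Nat.Properties as ℕ
  open import Data.Product.Base using (_×_; _,_; proj₁; proj₂; ∃-syntax)
  open import Data.Sum.Base using (_⊎_; inj₁; inj₂)
  open import Data.List.Relation.Unary.AllPairs using (_∷_)
  open import Data.List.Relation.Binary.Permutation.Propositional using (↭-sym; ↭-reflexive)
  open import Data.List.Relation.Binary.Permutation.Propositional.Properties using (All-resp-↭)
  open import Data.Vec.Base as Vec using (Vec; _∷_; lookup; tabulate; toList; count; _[_]≔_)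
  import Data.Vec.Properties as Vec
  open import Data.Vec.Relation.Unary.All as All using (All; _∷_)
  open import Data.Vec.Relation.Unary.Any using (Any; here; there)
  import Data.Vec.Relation.Unary.All.Properties as All
  open import Algebra.Properties.Semiring.Sum ℕ.+-*-semiring using (sum; sum-cong-≗)
  open import Relation.Binary.Construct.Closure.ReflexiveTransitive using (Star; ε; _◅_)
  open import Relation.Binary.Definitions using (tri<; tri≈; tri>)
  open import Relation.Binary.PropositionalEquality
    using (_≡_; _≢_; refl; sym; trans; cong; cong₂; subst; ≢-sym)
  open import Relation.Nullary.Decidable using (yes; no; does; decidable-stable)
  open import Relation.Nullary.Negation using (contradiction)
  open import Relation.Unary using (Decidable)
  open FiniteSums
  open Edges
  open Subsets

  any-lookup : {A : Set} {P : A → Set} {k : ℕ} (v : Vec A k) → Any P v → ∃[ i ] P (lookup v i)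
  any-lookup (x ∷ v) (here p) = zero , p
  any-lookup (x ∷ v) (there p) = let i , h = any-lookup v p in suc i , h

  lookup-any : {A : Set} {P : A → Set} {k : ℕ} (v : Vec A k) (i : Fin k) → P (lookup v i) → Any P v
  lookup-any (x ∷ v) zero p = here p
  lookup-any (x ∷ v) (suc i) p = there (lookup-any v i p)

  module _ (d : DegreeSequence) where
    open DegreeSequence d

    -- The positions are ordered as in `pairs`, the list from which the method draws. Acceptance is
    -- added separately in `InSpaceMove`.
    record Move (H G : Hypergraph d) : Set where
      field
        {i j}   : Fin arcs
        i<j     : i Fin.< j
        {â b̂}   : StubHyperarc d
        shuffle : IsShuffle d (lookup H i) (lookup H j) (â , b̂)
        result  : G ≡ H [ i ]≔ â [ j ]≔ b̂

    InSpaceMove : Hypergraph d → Hypergraph d → Set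
    InSpaceMove H G = Move H G × InSpace d G

    module Encoding (sizes : All (λ δₐ → proj₁ δₐ ≡ 1 × proj₂ δₐ ≡ 2) δ) (u w : Fin vertices)
      (tails : ∀ v → 0 < lookup dᵒᵘᵗ v → v ≡ u ⊎ v ≡ w) where

      private
        p = Vec.sum dᵒᵘᵗ
        q = Vec.sum dⁱⁿ

      colour : Fin p → Fin 2
      colour s = if does (owner dᵒᵘᵗ s Fin.≟ u) then zero else suc zero

      -- Owning a stub makes the out-degree positive, so an out-stub not owned by `u` is owned by
      -- `w`. This is where two tail vertices reduce to two colours.
      owner≡ : ∀ {s t} → colour s ≡ colour t → owner dᵒᵘᵗ s ≡ owner dᵒᵘᵗ t
      owner≡ {s} {t} e with owner dᵒᵘᵗ s Fin.≟ u | owner dᵒᵘᵗ t Fin.≟ u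
      ... | yes p | yes q = trans p (sym q)
      ... | no p | no q = trans (other s p) (sym (other t q))
        where
        other : ∀ s → owner dᵒᵘᵗ s ≢ u → owner dᵒᵘᵗ s ≡ w
        other s ne with tails (owner dᵒᵘᵗ s) (owner-positive dᵒᵘᵗ s)
        ... | inj₁ e = contradiction e ne
        ... | inj₂ e = e

      colour≡ : ∀ {s t} → owner dᵒᵘᵗ s ≡ owner dᵒᵘᵗ t → colour s ≡ colour t
      colour≡ = cong λ v → if does (v Fin.≟ u) then zero else suc zero

      open States {arcs} colour (owner dⁱⁿ)
        using (Arc; arc; out; in₁; in₂; heads; weight; State; tails=1; heads=1; simple; Step; module Step; Path;
               loopless-arcs; arcs-distinct; pair≡; state-connected; Agrees; module Agrees; in-distinct; tail-position)
        renaming (arcs to arcsOf)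

      encodeArc : Arc → StubHyperarc d
      encodeArc α = singleton (out α) , doubleton (in₁ α) (in₂ α)

      encode : State → Hypergraph d
      encode Y = tabulate λ i → encodeArc (arcsOf Y i)

      lookup-encode : ∀ Y i → lookup (encode Y) i ≡ encodeArc (arcsOf Y i)
      lookup-encode Y = Vec.lookup∘tabulate _

      underlying-out : ∀ α v → lookup (proj₁ (underlying d (encodeArc α))) v ≡ kron (owner dᵒᵘᵗ (out α)) v
      underlying-out α v = lookup-owners-singleton dᵒᵘᵗ (out α) v

      underlying-in : ∀ α → in₁ α ≢ in₂ α → ∀ v → lookup (proj₂ (underlying d (encodeArc α))) v ≡
                      kron (owner dⁱⁿ (in₁ α)) v + kron (owner dⁱⁿ (in₂ α)) v
      underlying-in α ne v = lookup-owners-doubleton dⁱⁿ ne v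

      underlying-injective : ∀ α β → in₁ α ≢ in₂ α → in₁ β ≢ in₂ β → underlying d (encodeArc α) ≡ underlying d (encodeArc β) →
        colour (out α) ≡ colour (out β) × Edge (owner dⁱⁿ (in₁ α)) (owner dⁱⁿ (in₂ α)) (owner dⁱⁿ (in₁ β)) (owner dⁱⁿ (in₂ β))
      underlying-injective α β α≢ β≢ e =
          colour≡ (kron>0⇒≡ positive)
        , pair-injective in≡
        where
        out≡ : ∀ v → kron (owner dᵒᵘᵗ (out α)) v ≡ kron (owner dᵒᵘᵗ (out β)) v
        out≡ v = trans (sym (underlying-out α v)) (trans (cong (λ a → lookup (proj₁ a) v) e) (underlying-out β v))
        positive : 0 < kron (owner dᵒᵘᵗ (out α)) (owner dᵒᵘᵗ (out β))
        positive = ℕ.≤-reflexive (sym (trans (out≡ _) (kron-refl (owner dᵒᵘᵗ (out β)))))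
        in≡ : ∀ v → _
        in≡ v = trans (sym (underlying-in α α≢ v)) (trans (cong (λ a → lookup (proj₂ a) v) e) (underlying-in β β≢ v))

      underlying-cong : ∀ α β → in₁ α ≢ in₂ α → in₁ β ≢ in₂ β → colour (out α) ≡ colour (out β) →
        Edge (owner dⁱⁿ (in₁ α)) (owner dⁱⁿ (in₂ α)) (owner dⁱⁿ (in₁ β)) (owner dⁱⁿ (in₂ β)) →
        underlying d (encodeArc α) ≡ underlying d (encodeArc β)
      underlying-cong α β α≢ β≢ c e = cong₂ _,_
        (lookup-ext _ _ λ v → trans (underlying-out α v) (trans (cong (λ o → kron o v) (owner≡ c)) (sym (underlying-out β v))))
        (lookup-ext _ _ λ v → trans (underlying-in α α≢ v) (trans (pair≡ e v) (sym (underlying-in β β≢ v))))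

      -- `simple` yields two conditions at once: without loops no head is degenerate, and without
      -- parallel arcs of one colour there are no multi-hyperarcs.
      encode-inSpace : ∀ Y → InSpace d (encode Y)
      encode-inSpace Y = (tail-count , head-count) , degrees-ok , nondegenerate , no-multi
        where
        lookup-count : ∀ {P : StubHyperarc d → Set} (P? : Decidable P) (f : Arc → ℕ) →
          (∀ i → (if does (P? (encodeArc (arcsOf Y i))) then 1 else 0) ≡ f (arcsOf Y i)) → sum (λ i → f (arcsOf Y i)) ≡ 1 →
          count P? (encode Y) ≡ 1
        lookup-count P? f e one = trans (count-sum P? (encode Y)) (trans (sum-cong-≗ λ i →
          trans (cong (λ a → if does (P? a) then 1 else 0) (lookup-encode Y i)) (e i)) one)
        tail-count : ∀ s → count (λ a → s ∈? tail d a) (encode Y) ≡ 1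
        tail-count s = lookup-count (λ a → s ∈? tail d a) (λ α → kron (out α) s)
          (λ i → trans (cong (if_then 1 else 0) (does-∈? s (singleton (out (arcsOf Y i))))) (χ-singleton (out (arcsOf Y i)) s)) (tails=1 Y s)
        head-count : ∀ s → count (λ a → s ∈? head d a) (encode Y) ≡ 1
        head-count s = lookup-count (λ a → s ∈? head d a) (λ α → heads α s)
          (λ i → trans (cong (if_then 1 else 0) (does-∈? s (doubleton (in₁ (arcsOf Y i)) (in₂ (arcsOf Y i))))) (χ-doubleton (in-distinct Y i) s)) (heads=1 Y s)
        degrees-ok : HasArcDegrees d (encode Y)
        degrees-ok = ↭-reflexive (cong toList (lookup-ext (Vec.map (degrees d) (encode Y)) δ λ i →
          trans (Vec.lookup-map i (degrees d) (encode Y)) (trans (cong (degrees d) (lookup-encode Y i))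
            (trans (cong₂ _,_ (∣singleton∣ (out (arcsOf Y i))) (∣doubleton∣ (in-distinct Y i)))
              (sym (cong₂ _,_ (proj₁ (All.lookup⁺ sizes i)) (proj₂ (All.lookup⁺ sizes i))))))))
        nondegenerate : NoDegenerate d (encode Y)
        nondegenerate = All.tabulate⁺ λ i → λ where
            (inj₁ x) → let v , le = any-lookup _ x in contradiction (ℕ.≤-trans le (ℕ.≤-reflexive (underlying-out (arcsOf Y i) v))) (ℕ.<⇒≱ (s≤s (kron≤1 (owner dᵒᵘᵗ (out (arcsOf Y i))) v)))
            (inj₂ x) → let v , le = any-lookup _ x in loopless-arcs Y i (both (owner dⁱⁿ (in₁ (arcsOf Y i))) (owner dⁱⁿ (in₂ (arcsOf Y i))) v
                         (ℕ.≤-trans le (ℕ.≤-reflexive (underlying-in (arcsOf Y i) (in-distinct Y i) v))))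
          where
          kron≤1 : ∀ {k} (i j : Fin k) → kron i j ≤ 1
          kron≤1 i j with i Fin.≟ j
          ... | yes _ = ℕ.≤-refl
          ... | no _ = z≤n
          both : ∀ {k} (a b v : Fin k) → 2 ≤ kron a v + kron b v → a ≡ b
          both a b v le with a Fin.≟ v | b Fin.≟ v
          ... | yes p | yes q = trans p (sym q)
          both a b v (s≤s ()) | yes _ | no _
          both a b v (s≤s ()) | no _ | yes _
          both a b v () | no _ | no _
        no-multi : NoMulti d (encode Y)
        no-multi = injective⇒unique _ λ i j e → decidable-stable (i Fin.≟ j) λ i≢j →
          let c , e′ = underlying-injective (arcsOf Y i) (arcsOf Y j) (in-distinct Y i) (in-distinct Y j) (trans (sym (at i)) (trans e (at j)))
          in arcs-distinct Y i≢j c e′ (inj₁ (refl , refl))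
          where
          at : ∀ i → lookup (Vec.map (underlying d) (encode Y)) i ≡ underlying d (encodeArc (arcsOf Y i))
          at i = trans (Vec.lookup-map i (underlying d) (encode Y)) (cong (underlying d) (lookup-encode Y i))

      -- The sizes 1 and 2 turn stub sets into an out-stub and two in-stubs. For `simple`,
      -- nondegeneracy bounds each single weight by 1, and the absence of multi-hyperarcs leaves at
      -- most one positive weight.
      decode : ∀ {H} → InSpace d H → ∃[ Y ] encode Y ≡ H
      decode {H} ((tail-count , head-count) , degrees-ok , nondegenerate , no-multi) = Y , encode≡
        where
        size : ∀ i → proj₁ (degrees d (lookup H i)) ≡ 1 × proj₂ (degrees d (lookup H i)) ≡ 2
        size i = subst (λ a → proj₁ a ≡ 1 × proj₂ a ≡ 2) (Vec.lookup-map i (degrees d) H)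
          (all-lookup {P = λ a → proj₁ a ≡ 1 × proj₂ a ≡ 2} _ (All-resp-↭ (↭-sym degrees-ok) (lookup-all δ (All.lookup⁺ sizes))) i)
        t : Fin arcs → Fin p
        t i = proj₁ (∣∣≡1 (tail d (lookup H i)) (proj₁ (size i)))
        heads′ : ∀ i → ∃[ a ] ∃[ b ] a ≢ b × head d (lookup H i) ≡ doubleton a b
        heads′ i = ∣∣≡2 (head d (lookup H i)) (proj₂ (size i))
        as : Fin arcs → Arc
        as i = arc (t i) (proj₁ (heads′ i)) (proj₁ (proj₂ (heads′ i)))
        in≢ : ∀ i → in₁ (as i) ≢ in₂ (as i)
        in≢ i = proj₁ (proj₂ (proj₂ (heads′ i)))
        at : ∀ i → lookup H i ≡ encodeArc (as i)
        at i = cong₂ _,_ (proj₂ (∣∣≡1 (tail d (lookup H i)) (proj₁ (size i)))) (proj₂ (proj₂ (proj₂ (heads′ i))))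
        counted : ∀ {P : StubHyperarc d → Set} (P? : Decidable P) (f : Arc → ℕ) →
          (∀ i → (if does (P? (encodeArc (as i))) then 1 else 0) ≡ f (as i)) → count P? H ≡ 1 → sum (λ i → f (as i)) ≡ 1
        counted P? f e one = trans (sum-cong-≗ λ i → trans (sym (e i)) (cong (λ a → if does (P? a) then 1 else 0) (sym (at i))))
                                   (trans (sym (count-sum P? H)) one)
        vertices-distinct : ∀ i → owner dⁱⁿ (in₁ (as i)) ≢ owner dⁱⁿ (in₂ (as i))
        vertices-distinct i e = All.lookup⁺ nondegenerate i (inj₂ (lookup-any _ v
          (ℕ.≤-reflexive (sym (trans (cong (λ a → lookup (proj₂ (underlying d a)) v) (at i)) (trans (underlying-in (as i) (in≢ i) v)
            (cong₂ _+_ (trans (cong (λ o → kron o v) e) (kron-refl v)) (kron-refl v))))))))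
          where v = owner dⁱⁿ (in₂ (as i))
        Y : State
        Y = record
          { arcs = as
          ; tails=1 = λ s → counted (λ a → s ∈? tail d a) (λ α → kron (out α) s)
              (λ i → trans (cong (if_then 1 else 0) (does-∈? s (singleton (out (as i))))) (χ-singleton (out (as i)) s)) (tail-count s)
          ; heads=1 = λ s → counted (λ a → s ∈? head d a) (λ α → heads α s)
              (λ i → trans (cong (if_then 1 else 0) (does-∈? s (doubleton (in₁ (as i)) (in₂ (as i))))) (χ-doubleton (in≢ i) s)) (head-count s)
          ; simple = λ c x y → sum≤1 (λ i → weight (as i) c x y) (λ i → weight≤1 i c x y) (weight-unique c x y)
          }
          where
          weight≤1 : ∀ i c x y → weight (as i) c x y ≤ 1
          weight≤1 i c x y with colour (t i) Fin.≟ c | edge? (owner dⁱⁿ (in₁ (as i))) (owner dⁱⁿ (in₂ (as i))) x y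
          ... | no _ | _ = z≤n
          ... | yes _ | yes e = ℕ.≤-reflexive (trans (ℕ.*-identityˡ _) (ind-edge (vertices-distinct i) e))
          ... | yes _ | no ¬e = ℕ.≤-trans (ℕ.≤-reflexive (trans (ℕ.*-identityˡ _) (ind-¬edge ¬e))) z≤n
          weight-parts : ∀ i c x y → 1 ≤ weight (as i) c x y → colour (t i) ≡ c × Edge (owner dⁱⁿ (in₁ (as i))) (owner dⁱⁿ (in₂ (as i))) x y
          weight-parts i c x y le with colour (t i) Fin.≟ c
          ... | yes e = e , ind>0⇒edge (subst (1 ≤_) (ℕ.*-identityˡ _) le)
          weight-parts i c x y () | no _
          weight-unique : ∀ c x y i j → 1 ≤ weight (as i) c x y → 1 ≤ weight (as j) c x y → i ≡ j
          weight-unique c x y i j wi wj with weight-parts i c x y wi | weight-parts j c x y wj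
          ... | ci , ei | cj , ej = unique⇒injective (Vec.map (underlying d) H) no-multi i j
            (trans (under i) (trans (underlying-cong (as i) (as j) (in≢ i) (in≢ j) (trans ci (sym cj)) (edge-trans ei (edge-sym ej))) (sym (under j))))
            where
            under : ∀ i → lookup (Vec.map (underlying d) H) i ≡ underlying d (encodeArc (as i))
            under i = trans (Vec.lookup-map i (underlying d) H) (cong (underlying d) (at i))
        encode≡ : encode Y ≡ H
        encode≡ = lookup-ext _ _ λ i → trans (lookup-encode Y i) (sym (at i))

      encode-agrees : ∀ Y Z → (∀ i → Agrees (arcsOf Y i) (arcsOf Z i)) → encode Y ≡ encode Z
      encode-agrees Y Z h = Vec.tabulate-cong λ i → cong₂ _,_ (cong singleton (Agrees.same-out (h i))) (doubleton-edge (Agrees.same-in (h i)))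

      private
        two-updates : ∀ Y Z {i j : Fin arcs} → i ≢ j → (∀ k → k ≢ i → k ≢ j → arcsOf Z k ≡ arcsOf Y k) →
          encode Z ≡ encode Y [ i ]≔ encodeArc (arcsOf Z i) [ j ]≔ encodeArc (arcsOf Z j)
        two-updates Y Z {i} {j} i≢j others = lookup-ext _ _ at
          where
          at : ∀ k → lookup (encode Z) k ≡ lookup (encode Y [ i ]≔ encodeArc (arcsOf Z i) [ j ]≔ encodeArc (arcsOf Z j)) k
          at k with k Fin.≟ j
          ... | yes refl = trans (lookup-encode Z k) (sym (Vec.lookup∘updateAt k (encode Y [ i ]≔ encodeArc (arcsOf Z i))))
          ... | no k≢j with k Fin.≟ i
          ...   | yes refl = trans (lookup-encode Z k) (sym (trans (Vec.lookup∘updateAt′ k j k≢j (encode Y [ i ]≔ encodeArc (arcsOf Z i))) (Vec.lookup∘updateAt k (encode Y))))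
          ...   | no k≢i = trans (lookup-encode Z k) (trans (cong encodeArc (others k k≢i k≢j)) (sym (trans (Vec.lookup∘updateAt′ k j k≢j (encode Y [ i ]≔ encodeArc (arcsOf Z i)))
                             (trans (Vec.lookup∘updateAt′ k i k≢i (encode Y)) (lookup-encode Y k)))))

        encode-shuffle : ∀ Y Z i j → (∀ s → kron (out (arcsOf Y i)) s + kron (out (arcsOf Y j)) s ≡ kron (out (arcsOf Z i)) s + kron (out (arcsOf Z j)) s) →
          (∀ s → heads (arcsOf Y i) s + heads (arcsOf Y j) s ≡ heads (arcsOf Z i) s + heads (arcsOf Z j) s) →
          IsShuffle d (lookup (encode Y) i) (lookup (encode Y) j) (encodeArc (arcsOf Z i) , encodeArc (arcsOf Z j))
        encode-shuffle Y Z i j t h rewrite lookup-encode Y i | lookup-encode Y j =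
            fromSubset-⊎ {S = singleton (out (arcsOf Y i))} (λ s → trans (tails-χ Y s) (trans (t s) (sym (tails-χ Z s))))
          , fromSubset-⊎ {S = doubleton (in₁ (arcsOf Y i)) (in₂ (arcsOf Y i))} (λ s → trans (heads-χ Y s) (trans (h s) (sym (heads-χ Z s))))
          , size i , size j
          where
          tails-χ : ∀ Y s → χ (singleton (out (arcsOf Y i))) s + χ (singleton (out (arcsOf Y j))) s ≡ kron (out (arcsOf Y i)) s + kron (out (arcsOf Y j)) s
          tails-χ Y s = cong₂ _+_ (χ-singleton (out (arcsOf Y i)) s) (χ-singleton (out (arcsOf Y j)) s)
          heads-χ : ∀ Y s → χ (doubleton (in₁ (arcsOf Y i)) (in₂ (arcsOf Y i))) s + χ (doubleton (in₁ (arcsOf Y j)) (in₂ (arcsOf Y j))) s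
                          ≡ heads (arcsOf Y i) s + heads (arcsOf Y j) s
          heads-χ Y s = cong₂ _+_ (χ-doubleton (in-distinct Y i) s) (χ-doubleton (in-distinct Y j) s)
          size : ∀ i → degrees d (encodeArc (arcsOf Y i)) ≡ degrees d (encodeArc (arcsOf Z i))
          size i = cong₂ _,_ (trans (∣singleton∣ (out (arcsOf Y i))) (sym (∣singleton∣ (out (arcsOf Z i)))))
                             (trans (∣doubleton∣ (in-distinct Y i)) (sym (∣doubleton∣ (in-distinct Z i))))

      encode-step : ∀ {Y Z} → Step Y Z → Move (encode Y) (encode Z)
      encode-step {Y} {Z} s = ordered (Fin.<-cmp i j)
        where
        open Step s
        ordered : _ → Move (encode Y) (encode Z)
        ordered (tri< i<j _ _) = record { i<j = i<j ; shuffle = encode-shuffle Y Z i j tails≡ heads≡ ; result = two-updates Y Z i≢j off-ij }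
        ordered (tri≈ _ i≡j _) = contradiction i≡j i≢j
        ordered (tri> _ _ j<i) = record
          { i<j = j<i
          ; shuffle = encode-shuffle Y Z j i
              (λ s → trans (ℕ.+-comm (kron (out (arcsOf Y j)) s) _) (trans (tails≡ s) (ℕ.+-comm (kron (out (arcsOf Z i)) s) _)))
              (λ s → trans (ℕ.+-comm (heads (arcsOf Y j) s) _) (trans (heads≡ s) (ℕ.+-comm (heads (arcsOf Z i) s) _)))
          ; result = two-updates Y Z (≢-sym i≢j) λ k k≢j k≢i → off-ij k k≢i k≢j
          }

      encode-path : ∀ {Y Z} → Path Y Z → Star InSpaceMove (encode Y) (encode Z)
      encode-path ε = ε
      encode-path (_◅_ {j = Z} s path) = (encode-step s , encode-inSpace Z) ◅ encode-path path

      space-connected : ∀ {H G} → InSpace d H → InSpace d G → Star InSpaceMove H G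
      space-connected H∈ G∈ with decode H∈ | decode G∈
      ... | Y , refl | Z , refl =
        let W , path , A = state-connected Y Z
        in subst (Star InSpaceMove (encode Y)) (encode-agrees W Z A) (encode-path path)

      -- A tail consists of a single stub, so two different out-stubs lie at two different
      -- positions.
      two-positions : ∀ {H} → 2 ≤ p → InSpace d H → ∃[ i ] ∃[ j ] i Fin.< j
      two-positions 2≤p H∈ =
        let Y , _ = decode H∈
            i , ei = tail-position Y (Fin.fromℕ< (ℕ.<-≤-trans (s≤s z≤n) 2≤p))
            j , ej = tail-position Y (Fin.fromℕ< 2≤p)
        in ordered i j λ e → ℕ.0≢1+n (trans (sym (Fin.toℕ-fromℕ< _)) (trans (cong toℕ (trans (sym ei) (trans (cong (λ k → out (arcsOf Y k)) e) ej))) (Fin.toℕ-fromℕ< 2≤p)))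
        where
        ordered : ∀ (i j : Fin arcs) → i ≢ j → ∃[ i ] ∃[ j ] i Fin.< j
        ordered i j i≢j with Fin.<-cmp i j
        ... | tri< lt _ _ = i , j , lt
        ... | tri≈ _ e _ = contradiction e i≢j
        ... | tri> _ _ gt = j , i , gt

-- Expectations over finitely supported distributions.

module Expectation where

  open import Defs
  open import Data.Bool.Base using (true; false; if_then_else_)
  open import Data.Integer.Base as ℤ using (+_)
  import Data.Integer.Properties as ℤ
  open import Data.Integer.Tactic.RingSolver using () renaming (solve-∀ to solveℤ-∀)
  open import Data.List.Base using (List; []; _∷_; _++_; filter; map; cartesianProductWith; length)
  open import Data.List.Membership.Propositional using (_∈_)
  open import Data.List.Relation.Binary.Permutation.Propositional
    using (_↭_; refl; prep; swap; trans)
  open import Data.List.Relation.Unary.Any using (here; there)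
  open import Data.Nat.Base as ℕ using (ℕ; suc)
  open import Data.Product.Base using (_,_)
  open import Data.Rational.Base as ℚ using (ℚ; 0ℚ; 1ℚ; _+_; _*_; _-_; -_; _≤_; _<_; toℚᵘ)
  import Data.Rational.Properties as ℚ
  import Data.Rational.Unnormalised.Base as ℚᵘ
  import Data.Rational.Unnormalised.Properties as ℚᵘ
  open import Function.Base using (_∘_)
  open import Relation.Binary.PropositionalEquality as ≡
    using (_≡_; refl; sym; cong; cong₂; subst; subst₂; module ≡-Reasoning)
  open import Relation.Nullary.Decidable using (does; dec⇒maybe)
  open import Relation.Unary using (Decidable)
  open import Tactic.RingSolver using (solve-∀)
  open import Tactic.RingSolver.Core.AlmostCommutativeRing
    using (AlmostCommutativeRing; fromCommutativeRing)

  ringℚ : AlmostCommutativeRing _ _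
  ringℚ = fromCommutativeRing ℚ.+-*-commutativeRing λ x → dec⇒maybe (0ℚ ℚ.≟ x)

  private variable
    A C : Set

  0≤* : ∀ {p q} → 0ℚ ≤ p → 0ℚ ≤ q → 0ℚ ≤ p * q
  0≤* {p} {q} 0≤p 0≤q = ℚ.nonNegative⁻¹ (p * q)
    {{ℚ.nonNeg*nonNeg⇒nonNeg p {{ℚ.nonNegative 0≤p}} q {{ℚ.nonNegative 0≤q}}}}

  0<* : ∀ {p q} → 0ℚ < p → 0ℚ < q → 0ℚ < p * q
  0<* {p} {q} 0<p 0<q = ℚ.positive⁻¹ (p * q) {{ℚ.pos*pos⇒pos p {{ℚ.positive 0<p}} q {{ℚ.positive 0<q}}}}

  *-monoˡ : ∀ {p q r} → 0ℚ ≤ r → p ≤ q → r * p ≤ r * q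
  *-monoˡ {r = r} 0≤r = ℚ.*-monoˡ-≤-nonNeg r {{ℚ.nonNegative 0≤r}}

  *-monoʳ : ∀ {p q r} → 0ℚ ≤ r → p ≤ q → p * r ≤ q * r
  *-monoʳ {r = r} 0≤r = ℚ.*-monoʳ-≤-nonNeg r {{ℚ.nonNegative 0≤r}}

  ≤⇒0≤- : ∀ {p q} → p ≤ q → 0ℚ ≤ q - p
  ≤⇒0≤- {p} {q} p≤q = subst (_≤ q - p) (ℚ.+-inverseʳ p) (ℚ.+-monoˡ-≤ (- p) p≤q)

  fromℕ : ℕ → ℚ
  fromℕ n = + n ℚ./ 1

  private
    toℚᵘ-/ : ∀ n k → toℚᵘ (+ n ℚ./ suc k) ℚᵘ.≃ ℚᵘ.mkℚᵘ (+ n) k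
    toℚᵘ-/ n k = ℚ.toℚᵘ-fromℚᵘ (ℚᵘ.mkℚᵘ (+ n) k)

  fromℕ-suc : ∀ n → fromℕ (suc n) ≡ 1ℚ + fromℕ n
  fromℕ-suc n = ℚ.toℚᵘ-injective (begin-equality
    toℚᵘ (fromℕ (suc n))                   ≃⟨ toℚᵘ-/ (suc n) 0 ⟩
    ℚᵘ.mkℚᵘ (+ suc n) 0                    ≃⟨ ℚᵘ.*≡* (lemma (+ n)) ⟩
    toℚᵘ 1ℚ ℚᵘ.+ ℚᵘ.mkℚᵘ (+ n) 0            ≃⟨ ℚᵘ.+-cong (ℚᵘ.≃-refl {toℚᵘ 1ℚ}) (ℚᵘ.≃-sym (toℚᵘ-/ n 0)) ⟩
    toℚᵘ 1ℚ ℚᵘ.+ toℚᵘ (fromℕ n)            ≃⟨ ℚᵘ.≃-sym (ℚ.toℚᵘ-homo-+ 1ℚ (fromℕ n)) ⟩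
    toℚᵘ (1ℚ + fromℕ n)                    ∎)
    where
    open ℚᵘ.≤-Reasoning
    lemma : ∀ z → (+ 1 ℤ.+ z) ℤ.* + 1 ≡ (+ 1 ℤ.* + 1 ℤ.+ z ℤ.* + 1) ℤ.* + 1
    lemma = solveℤ-∀

  1/suc*suc : ∀ n → (+ 1 ℚ./ suc n) * fromℕ (suc n) ≡ 1ℚ
  1/suc*suc n = ℚ.toℚᵘ-injective (begin-equality
    toℚᵘ ((+ 1 ℚ./ suc n) * fromℕ (suc n))           ≃⟨ ℚ.toℚᵘ-homo-* (+ 1 ℚ./ suc n) (fromℕ (suc n)) ⟩
    toℚᵘ (+ 1 ℚ./ suc n) ℚᵘ.* toℚᵘ (fromℕ (suc n))   ≃⟨ ℚᵘ.*-cong (toℚᵘ-/ 1 n) (toℚᵘ-/ (suc n) 0) ⟩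
    ℚᵘ.mkℚᵘ (+ 1) n ℚᵘ.* ℚᵘ.mkℚᵘ (+ suc n) 0         ≃⟨ ℚᵘ.*≡* lemma ⟩
    toℚᵘ 1ℚ                                          ∎)
    where
    open ℚᵘ.≤-Reasoning
    lemma′ : ∀ z → (+ 1 ℤ.* z) ℤ.* + 1 ≡ + 1 ℤ.* (z ℤ.* + 1)
    lemma′ = solveℤ-∀
    lemma : (+ 1 ℤ.* + suc n) ℤ.* + 1 ≡ + 1 ℤ.* + suc (n ℕ.* 1)
    lemma = ≡.trans (lemma′ (+ suc n)) (cong (λ k → + 1 ℤ.* k) (≡.sym (ℤ.pos-* (suc n) 1)))

  sumBy : List A → (A → ℚ) → ℚ
  sumBy [] f = 0ℚ
  sumBy (x ∷ xs) f = f x + sumBy xs f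

  sumBy-cong : {f g : A → ℚ} (xs : List A) → (∀ {x} → x ∈ xs → f x ≡ g x) → sumBy xs f ≡ sumBy xs g
  sumBy-cong [] h = refl
  sumBy-cong (x ∷ xs) h = cong₂ _+_ (h (here refl)) (sumBy-cong xs (h ∘ there))

  sumBy-mono : {f g : A → ℚ} (xs : List A) → (∀ {x} → x ∈ xs → f x ≤ g x) → sumBy xs f ≤ sumBy xs g
  sumBy-mono [] h = ℚ.≤-refl
  sumBy-mono (x ∷ xs) h = ℚ.+-mono-≤ (h (here refl)) (sumBy-mono xs (h ∘ there))

  sumBy-0 : (xs : List A) → sumBy xs (λ _ → 0ℚ) ≡ 0ℚ
  sumBy-0 [] = refl
  sumBy-0 (x ∷ xs) = ≡.trans (ℚ.+-identityˡ _) (sumBy-0 xs)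

  sumBy-nonneg : {f : A → ℚ} (xs : List A) → (∀ {x} → x ∈ xs → 0ℚ ≤ f x) → 0ℚ ≤ sumBy xs f
  sumBy-nonneg {f = f} xs h = subst (_≤ sumBy xs f) (sumBy-0 xs) (sumBy-mono xs h)

  term≤sumBy : {f : A → ℚ} (xs : List A) → (∀ {x} → x ∈ xs → 0ℚ ≤ f x) → ∀ {x} → x ∈ xs → f x ≤ sumBy xs f
  term≤sumBy {f = f} (x ∷ xs) h (here refl) =
    subst (_≤ f x + sumBy xs f) (ℚ.+-identityʳ (f x)) (ℚ.+-monoʳ-≤ (f x) (sumBy-nonneg xs (h ∘ there)))
  term≤sumBy {f = f} (y ∷ xs) h {x} (there x∈xs) =
    subst (_≤ f y + sumBy xs f) (ℚ.+-identityˡ (f x)) (ℚ.+-mono-≤ (h (here refl)) (term≤sumBy xs (h ∘ there) x∈xs))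

  sumBy-+ : (f g : A → ℚ) (xs : List A) → sumBy xs (λ x → f x + g x) ≡ sumBy xs f + sumBy xs g
  sumBy-+ f g [] = refl
  sumBy-+ f g (x ∷ xs) = ≡.trans (cong (_+_ (f x + g x)) (sumBy-+ f g xs)) (lemma (f x) (g x) (sumBy xs f) (sumBy xs g))
    where
    lemma : ∀ a b c d → (a + b) + (c + d) ≡ (a + c) + (b + d)
    lemma = solve-∀ ringℚ

  sumBy-*ˡ : (p : ℚ) (f : A → ℚ) (xs : List A) → sumBy xs (λ x → p * f x) ≡ p * sumBy xs f
  sumBy-*ˡ p f [] = sym (ℚ.*-zeroʳ p)
  sumBy-*ˡ p f (x ∷ xs) = ≡.trans (cong (_+_ (p * f x)) (sumBy-*ˡ p f xs)) (sym (ℚ.*-distribˡ-+ p (f x) _))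

  sumBy-*ʳ : (p : ℚ) (f : A → ℚ) (xs : List A) → sumBy xs (λ x → f x * p) ≡ sumBy xs f * p
  sumBy-*ʳ p f xs = ≡.trans (sumBy-cong xs (λ {x} _ → ℚ.*-comm (f x) p)) (≡.trans (sumBy-*ˡ p f xs) (ℚ.*-comm p _))

  sumBy-++ : (f : A → ℚ) (xs ys : List A) → sumBy (xs ++ ys) f ≡ sumBy xs f + sumBy ys f
  sumBy-++ f [] ys = sym (ℚ.+-identityˡ _)
  sumBy-++ f (x ∷ xs) ys = ≡.trans (cong (_+_ (f x)) (sumBy-++ f xs ys)) (sym (ℚ.+-assoc (f x) _ _))

  sumBy-map : (g : C → A) (f : A → ℚ) (xs : List C) → sumBy (map g xs) f ≡ sumBy xs (f ∘ g)
  sumBy-map g f [] = refl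
  sumBy-map g f (x ∷ xs) = cong (_+_ (f (g x))) (sumBy-map g f xs)

  sumBy-comm : (F : A → C → ℚ) (xs : List A) (ys : List C) →
               sumBy xs (λ x → sumBy ys (F x)) ≡ sumBy ys (λ y → sumBy xs (λ x → F x y))
  sumBy-comm F [] ys = sym (sumBy-0 ys)
  sumBy-comm F (x ∷ xs) ys = ≡.trans (cong (_+_ (sumBy ys (F x))) (sumBy-comm F xs ys))
                                     (sym (sumBy-+ (F x) (λ y → sumBy xs (λ x → F x y)) ys))

  sumBy-filter : {P : A → Set} (P? : Decidable P) (f : A → ℚ) (xs : List A) →
                 sumBy (filter P? xs) f ≡ sumBy xs (λ x → if does (P? x) then f x else 0ℚ)
  sumBy-filter P? f [] = refl
  sumBy-filter P? f (x ∷ xs) with does (P? x)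
  ... | true = cong (_+_ (f x)) (sumBy-filter P? f xs)
  ... | false = ≡.trans (sumBy-filter P? f xs) (sym (ℚ.+-identityˡ _))

  sumBy-cartesianWith : ∀ {B : Set} (g : A → C → B) (f : B → ℚ) (xs : List A) (ys : List C) →
                        sumBy (cartesianProductWith g xs ys) f ≡ sumBy xs (λ x → sumBy ys (λ y → f (g x y)))
  sumBy-cartesianWith g f [] ys = refl
  sumBy-cartesianWith g f (x ∷ xs) ys = ≡.trans (sumBy-++ f (map (g x) ys) _)
    (cong₂ _+_ (sumBy-map (g x) f ys) (sumBy-cartesianWith g f xs ys))

  sumBy-↭ : (f : A → ℚ) {xs ys : List A} → xs ↭ ys → sumBy xs f ≡ sumBy ys f
  sumBy-↭ f refl = refl
  sumBy-↭ f (prep x p) = cong (_+_ (f x)) (sumBy-↭ f p)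
  sumBy-↭ f (swap {xs} {ys} x y p) = ≡.trans (cong (λ s → f x + (f y + s)) (sumBy-↭ f p)) (lemma (f x) (f y) (sumBy ys f))
    where
    lemma : ∀ a b c → a + (b + c) ≡ b + (a + c)
    lemma = solve-∀ ringℚ
  sumBy-↭ f (trans p q) = ≡.trans (sumBy-↭ f p) (sumBy-↭ f q)

  sumBy-1 : (xs : List A) → sumBy xs (λ _ → 1ℚ) ≡ fromℕ (length xs)
  sumBy-1 [] = refl
  sumBy-1 (x ∷ xs) = ≡.trans (cong (_+_ 1ℚ) (sumBy-1 xs)) (sym (fromℕ-suc (length xs)))

  -- The common probability used by `uniform`; the value 0 for the empty list keeps `E-uniform` free
  -- of side conditions.
  weightOf : List A → ℚ
  weightOf [] = 0ℚ
  weightOf (x ∷ xs) = + 1 ℚ./ suc (length xs)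

  weight>0 : {xs : List A} {x : A} → x ∈ xs → 0ℚ < weightOf xs
  weight>0 {xs = x ∷ xs} _ = ℚ.positive⁻¹ (+ 1 ℚ./ suc (length xs)) {{ℚ.normalize-pos 1 (suc (length xs))}}

  weight≥0 : (xs : List A) → 0ℚ ≤ weightOf xs
  weight≥0 [] = ℚ.≤-refl
  weight≥0 (x ∷ xs) = ℚ.<⇒≤ (weight>0 {xs = x ∷ xs} (here refl))

  weight-total : {xs : List A} {x : A} → x ∈ xs → weightOf xs * sumBy xs (λ _ → 1ℚ) ≡ 1ℚ
  weight-total {xs = x ∷ xs} _ = ≡.trans (cong (weightOf (x ∷ xs) *_) (sumBy-1 (x ∷ xs))) (1/suc*suc (length xs))

  E : Dist A → (A → ℚ) → ℚ
  E [] f = 0ℚ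
  E ((p , x) ∷ D) f = p * f x + E D f

  E-++ : (D D′ : Dist A) (f : A → ℚ) → E (D ++ D′) f ≡ E D f + E D′ f
  E-++ [] D′ f = sym (ℚ.+-identityˡ _)
  E-++ ((p , x) ∷ D) D′ f = ≡.trans (cong (_+_ (p * f x)) (E-++ D D′ f)) (sym (ℚ.+-assoc (p * f x) _ _))

  E-scale : (p : ℚ) (D : Dist A) (f : A → ℚ) → E (map (λ (q , y) → p * q , y) D) f ≡ p * E D f
  E-scale p [] f = sym (ℚ.*-zeroʳ p)
  E-scale p ((q , y) ∷ D) f = ≡.trans (cong (_+_ (p * q * f y)) (E-scale p D f)) (lemma p q (f y) (E D f))
    where
    lemma : ∀ p q a b → p * q * a + p * b ≡ p * (q * a + b)
    lemma = solve-∀ ringℚ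

  E->>= : (D : Dist A) (g : A → Dist C) (f : C → ℚ) → E (D >>= g) f ≡ E D (λ x → E (g x) f)
  E->>= [] g f = refl
  E->>= ((p , x) ∷ D) g f = ≡.trans (E-++ (map (λ (q , y) → p * q , y) (g x)) (D >>= g) f)
                                    (cong₂ _+_ (E-scale p (g x) f) (E->>= D g f))

  E-point : (x : A) (f : A → ℚ) → E (point x) f ≡ f x
  E-point x f = ≡.trans (ℚ.+-identityʳ _) (ℚ.*-identityˡ (f x))

  E-cong : {f g : A → ℚ} (D : Dist A) → (∀ x → f x ≡ g x) → E D f ≡ E D g
  E-cong [] h = refl
  E-cong ((p , x) ∷ D) h = cong₂ _+_ (cong (p *_) (h x)) (E-cong D h)

  E-uniform : (xs : List A) (f : A → ℚ) → E (uniform xs) f ≡ weightOf xs * sumBy xs f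
  E-uniform [] f = refl
  E-uniform (x ∷ xs) f = go (x ∷ xs) (+ 1 ℚ./ suc (length xs))
    where
    go : ∀ ys p → E (map (p ,_) ys) f ≡ p * sumBy ys f
    go [] p = sym (ℚ.*-zeroʳ p)
    go (y ∷ ys) p = ≡.trans (cong (_+_ (p * f y)) (go ys p)) (sym (ℚ.*-distribˡ-+ p (f y) _))

  indicator : {P : A → Set} → Decidable P → A → ℚ
  indicator P? x = if does (P? x) then 1ℚ else 0ℚ

  Pr-E : {P : A → Set} (P? : Decidable P) (D : Dist A) → Pr P? D ≡ E D (indicator P?)
  Pr-E P? [] = refl
  Pr-E P? ((p , x) ∷ D) with does (P? x)
  ... | true = cong₂ _+_ (sym (ℚ.*-identityʳ p)) (Pr-E P? D)
  ... | false = ≡.trans (Pr-E P? D) (≡.trans (sym (ℚ.+-identityˡ _)) (cong (_+ E D (indicator P?)) (sym (ℚ.*-zeroʳ p))))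

  E-+ : (f g : A → ℚ) (D : Dist A) → E D (λ x → f x + g x) ≡ E D f + E D g
  E-+ f g [] = refl
  E-+ f g ((p , x) ∷ D) = ≡.trans (cong (_+_ (p * (f x + g x))) (E-+ f g D)) (lemma p (f x) (g x) (E D f) (E D g))
    where
    lemma : ∀ p a b c d → p * (a + b) + (c + d) ≡ (p * a + c) + (p * b + d)
    lemma = solve-∀ ringℚ

  E-* : (q : ℚ) (f : A → ℚ) (D : Dist A) → E D (λ x → q * f x) ≡ q * E D f
  E-* q f [] = sym (ℚ.*-zeroʳ q)
  E-* q f ((p , x) ∷ D) = ≡.trans (cong (_+_ (p * (q * f x))) (E-* q f D)) (lemma p q (f x) (E D f))
    where
    lemma : ∀ p q a b → p * (q * a) + q * b ≡ q * (p * a + b)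
    lemma = solve-∀ ringℚ

  E-uniform-mono : {f g : A → ℚ} (xs : List A) → (∀ {x} → x ∈ xs → f x ≤ g x) → E (uniform xs) f ≤ E (uniform xs) g
  E-uniform-mono {f = f} {g} xs h = subst₂ _≤_ (sym (E-uniform xs f)) (sym (E-uniform xs g)) (*-monoˡ (weight≥0 xs) (sumBy-mono xs h))

  E-uniform-const : (p : ℚ) {xs : List A} {x : A} → x ∈ xs → E (uniform xs) (λ _ → p) ≡ p
  E-uniform-const p {xs} x∈ = begin
    E (uniform xs) (λ _ → p)                      ≡⟨ E-cong (uniform xs) (λ _ → sym (ℚ.*-identityʳ p)) ⟩
    E (uniform xs) (λ _ → p * 1ℚ)                 ≡⟨ E-* p (λ _ → 1ℚ) (uniform xs) ⟩
    p * E (uniform xs) (λ _ → 1ℚ)                 ≡⟨ cong (p *_) (≡.trans (E-uniform xs (λ _ → 1ℚ)) (weight-total x∈)) ⟩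
    p * 1ℚ                                        ≡⟨ ℚ.*-identityʳ p ⟩
    p                                             ∎
    where open ≡-Reasoning

  E-uniform-term : {f : A → ℚ} (xs : List A) → (∀ {x} → x ∈ xs → 0ℚ ≤ f x) → ∀ {x} → x ∈ xs → weightOf xs * f x ≤ E (uniform xs) f
  E-uniform-term {f = f} xs h {x} x∈ = subst (weightOf xs * f x ≤_) (sym (E-uniform xs f)) (*-monoˡ (weight≥0 xs) (term≤sumBy xs h x∈))

-- Contraction under the averaging operator of a Markov chain.

module Averages where

  open import Data.Integer.Base as ℤ using (+_)
  import Data.Integer.Properties as ℤ
  open import Data.List.Base using (List; []; _∷_)
  open import Data.List.Membership.Propositional using (_∈_)
  open import Data.List.Relation.Unary.Any using (here; there)
  open import Data.Nat.Base as ℕ using (ℕ; zero; suc)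
  import Data.Nat.Properties as ℕ
  open import Data.Product.Base using (_×_; _,_; proj₁; proj₂; ∃-syntax)
  open import Data.Rational.Base as ℚ using (ℚ; 0ℚ; 1ℚ; _+_; _*_; _-_; -_; _≤_; _<_; toℚᵘ)
  import Data.Rational.Properties as ℚ
  import Data.Rational.Unnormalised.Base as ℚᵘ
  import Data.Rational.Unnormalised.Properties as ℚᵘ
  open import Data.Sum.Base using (inj₁; inj₂)
  open import Function.Base using (_∘_)
  open import Relation.Binary.PropositionalEquality as ≡
    using (_≡_; refl; sym; cong; cong₂; subst; subst₂; module ≡-Reasoning)
  open import Tactic.RingSolver using (solve-∀)
  open Expectation

  infixr 8 _^_
  _^_ : ℚ → ℕ → ℚ
  q ^ zero = 1ℚ
  q ^ suc k = q * q ^ k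

  archimedean : ∀ p → 0ℚ < p → ∃[ k ] 1ℚ < fromℕ k * p
  -- The denominator is `suc d` and the numerator at least 1, so the multiple by `suc (suc d)`
  -- already exceeds 1.
  archimedean (ℚ.mkℚ (+ suc n) d _) _ = suc (suc d) , ℚ.toℚᵘ-cancel-< (ℚᵘ.<-respʳ-≃ (ℚᵘ.≃-sym homo) (ℚᵘ.*<* lt))
    where
    homo : toℚᵘ (fromℕ (suc (suc d)) * ℚ.mkℚ (+ suc n) d _) ℚᵘ.≃ ℚᵘ.mkℚᵘ (+ suc (suc d)) 0 ℚᵘ.* ℚᵘ.mkℚᵘ (+ suc n) d
    homo = ℚᵘ.≃-trans (ℚ.toℚᵘ-homo-* (fromℕ (suc (suc d))) _)
                      (ℚᵘ.*-congʳ {ℚᵘ.mkℚᵘ (+ suc n) d} (ℚ.toℚᵘ-fromℚᵘ (ℚᵘ.mkℚᵘ (+ suc (suc d)) 0)))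
    nat : suc (d ℕ.+ 0) ℕ.< suc (suc d) ℕ.* suc n
    nat = ℕ.≤-trans (ℕ.s≤s (ℕ.s≤s (ℕ.≤-reflexive (ℕ.+-identityʳ d)))) (ℕ.m≤m*n (suc (suc d)) (suc n))
    lt : + 1 ℤ.* + suc (d ℕ.+ 0) ℤ.< (+ suc (suc d) ℤ.* + suc n) ℤ.* + 1
    lt = subst₂ ℤ._<_ (sym (ℤ.*-identityˡ _)) (sym (≡.trans (ℤ.*-identityʳ _) (sym (ℤ.pos-* (suc (suc d)) (suc n))))) (ℤ.+<+ nat)
  archimedean (ℚ.mkℚ (+ 0) d _) (ℚ.*<* (ℤ.+<+ ()))
  archimedean (ℚ.mkℚ (ℤ.-[1+ n ]) d _) (ℚ.*<* ())

  0≤fromℕ : ∀ k → 0ℚ ≤ fromℕ k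
  0≤fromℕ k = ℚ.nonNegative⁻¹ (fromℕ k) {{ℚ.normalize-nonNeg k 1}}

  -- Bernoulli's inequality for 1 + k c, multiplied through by (1 - c)ᵏ.
  bernoulli : ∀ {c} → 0ℚ ≤ c → c ≤ 1ℚ → ∀ k → (1ℚ - c) ^ k * (1ℚ + fromℕ k * c) ≤ 1ℚ
  bernoulli {c} 0≤c c≤1 zero = ℚ.≤-reflexive (lemma c)
    where
    lemma : ∀ c → 1ℚ * (1ℚ + 0ℚ * c) ≡ 1ℚ
    lemma = solve-∀ ringℚ
  bernoulli {c} 0≤c c≤1 (suc k) = begin
    (q * q ^ k) * (1ℚ + fromℕ (suc k) * c)               ≡⟨ cong (λ m → (q * q ^ k) * (1ℚ + m * c)) (fromℕ-suc k) ⟩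
    (q * q ^ k) * (1ℚ + (1ℚ + fromℕ k) * c)              ≡⟨ rearrange (q ^ k) c (fromℕ k) ⟩
    q ^ k * (1ℚ + fromℕ k * c) - q ^ k * ((1ℚ + fromℕ k) * (c * c))  ≤⟨ ℚ.+-monoʳ-≤ (q ^ k * (1ℚ + fromℕ k * c)) (ℚ.neg-antimono-≤ nonneg) ⟩
    q ^ k * (1ℚ + fromℕ k * c) + 0ℚ                      ≡⟨ ℚ.+-identityʳ _ ⟩
    q ^ k * (1ℚ + fromℕ k * c)                           ≤⟨ bernoulli 0≤c c≤1 k ⟩
    1ℚ                                                   ∎
    where
    open ℚ.≤-Reasoning
    q = 1ℚ - c
    0≤q^ : ∀ k → 0ℚ ≤ q ^ k
    0≤q^ zero = ℚ.nonNegative⁻¹ 1ℚ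
    0≤q^ (suc k) = 0≤* (≤⇒0≤- c≤1) (0≤q^ k)
    nonneg : 0ℚ ≤ q ^ k * ((1ℚ + fromℕ k) * (c * c))
    nonneg = 0≤* (0≤q^ k) (0≤* (subst (0ℚ ≤_) (fromℕ-suc k) (0≤fromℕ (suc k))) (0≤* 0≤c 0≤c))
    rearrange : ∀ r c n → ((1ℚ - c) * r) * (1ℚ + (1ℚ + n) * c) ≡ r * (1ℚ + n * c) - r * ((1ℚ + n) * (c * c))
    rearrange = solve-∀ ringℚ

  -- For `k` with `1 < k c η`, Bernoulli's inequality bounds the power times `1 + k c` by 1, hence
  -- strictly by `η (1 + k c)`; the common factor cancels.
  powers-vanish : ∀ {c} → 0ℚ < c → c ≤ 1ℚ → ∀ {η} → 0ℚ < η → ∃[ k ] (1ℚ - c) ^ k < η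
  powers-vanish {c} 0<c c≤1 {η} 0<η with k , 1<kcη ← archimedean (c * η) (0<* 0<c 0<η) =
    k , ℚ.*-cancelʳ-<-nonNeg (1ℚ + fromℕ k * c) {{ℚ.nonNegative 0≤1+kc}} (begin-strict
      (1ℚ - c) ^ k * (1ℚ + fromℕ k * c)   ≤⟨ bernoulli (ℚ.<⇒≤ 0<c) c≤1 k ⟩
      1ℚ                                  <⟨ 1<kcη ⟩
      fromℕ k * (c * η)                   ≡⟨ ℚ.+-identityˡ _ ⟨
      0ℚ + fromℕ k * (c * η)              ≤⟨ ℚ.+-monoˡ-≤ _ (ℚ.<⇒≤ 0<η) ⟩
      η + fromℕ k * (c * η)               ≡⟨ rearrange η (fromℕ k) c ⟩
      η * (1ℚ + fromℕ k * c)              ∎)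
    where
    open ℚ.≤-Reasoning
    0≤1+kc : 0ℚ ≤ 1ℚ + fromℕ k * c
    0≤1+kc = ℚ.+-mono-≤ (ℚ.nonNegative⁻¹ 1ℚ) (0≤* (0≤fromℕ k) (ℚ.<⇒≤ 0<c))
    rearrange : ∀ η n c → η + n * (c * η) ≡ η * (1ℚ + n * c)
    rearrange = solve-∀ ringℚ

  -- T is the averaging operator of a Markov chain on the points satisfying In.
  module Averaging {X : Set} (In : X → Set) (T : (X → ℚ) → X → ℚ)
    (T-+ : ∀ f g x → T (λ y → f y + g y) x ≡ T f x + T g x)
    (T-* : ∀ p f x → T (λ y → p * f y) x ≡ p * T f x)
    (T-1 : ∀ {x} → In x → T (λ _ → 1ℚ) x ≡ 1ℚ)
    (T-mono : ∀ {f g} → (∀ {y} → In y → f y ≤ g y) → ∀ {x} → In x → T f x ≤ T g x)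
    where

    private variable
      f : X → ℚ
      lo hi : ℚ

    T-const : ∀ p {x} → In x → T (λ _ → p) x ≡ p
    T-const p {x} x∈ = begin
      T (λ _ → p) x          ≡⟨ ℚ.≤-antisym (T-mono (λ _ → ℚ.≤-reflexive (sym (ℚ.*-identityʳ p))) x∈)
                                            (T-mono (λ _ → ℚ.≤-reflexive (ℚ.*-identityʳ p)) x∈) ⟩
      T (λ _ → p * 1ℚ) x     ≡⟨ T-* p (λ _ → 1ℚ) x ⟩
      p * T (λ _ → 1ℚ) x     ≡⟨ cong (p *_) (T-1 x∈) ⟩
      p * 1ℚ                 ≡⟨ ℚ.*-identityʳ p ⟩
      p                      ∎
      where open ≡-Reasoning

    -- The new `T` is applied first, because `method` appends its last step on the right and `E->>=`
    -- then averages the test function over that step.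
    iter : ℕ → (X → ℚ) → X → ℚ
    iter zero f = f
    iter (suc k) f = iter k (T f)

    iter-+ : ∀ a b f → iter (a ℕ.+ b) f ≡ iter b (iter a f)
    iter-+ zero b f = refl
    iter-+ (suc a) b f = iter-+ a b (T f)

    iter-T : ∀ k f x → iter k (T f) x ≡ T (iter k f) x
    iter-T zero f x = refl
    iter-T (suc k) f x = iter-T k (T f) x

    iter-mono : ∀ k {f g} → (∀ {y} → In y → f y ≤ g y) → ∀ {x} → In x → iter k f x ≤ iter k g x
    iter-mono zero h = h
    iter-mono (suc k) h = iter-mono k (T-mono h)

    iter-cong : ∀ k {f g} → (∀ {y} → In y → f y ≡ g y) → ∀ {x} → In x → iter k f x ≡ iter k g x
    iter-cong k h x∈ = ℚ.≤-antisym (iter-mono k (ℚ.≤-reflexive ∘ h) x∈) (iter-mono k (ℚ.≤-reflexive ∘ sym ∘ h) x∈)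

    iter-const : ∀ k p {x} → In x → iter k (λ _ → p) x ≡ p
    iter-const zero p x∈ = refl
    iter-const (suc k) p x∈ = ≡.trans (iter-cong k (T-const p) x∈) (iter-const k p x∈)

    iter-affine : ∀ k p q f {x} → In x → iter k (λ y → p + q * f y) x ≡ p + q * iter k f x
    iter-affine zero p q f x∈ = refl
    iter-affine (suc k) p q f x∈ = ≡.trans
      (iter-cong k (λ {y} y∈ → ≡.trans (T-+ (λ _ → p) (λ y → q * f y) y) (cong₂ _+_ (T-const p y∈) (T-* q f y))) x∈)
      (iter-affine k p q (T f) x∈)

    Within : (X → ℚ) → ℚ → ℚ → Set
    Within f lo hi = ∀ {x} → In x → lo ≤ f x × f x ≤ hi

    within-iter : ∀ k → Within f lo hi → Within (iter k f) lo hi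
    within-iter {f} {lo} {hi} k w {x} x∈ =
        subst (_≤ iter k f x) (iter-const k lo x∈) (iter-mono k (proj₁ ∘ w) x∈)
      , subst (iter k f x ≤_) (iter-const k hi x∈) (iter-mono k (proj₂ ∘ w) x∈)

    NonNeg : (X → ℚ) → Set
    NonNeg f = ∀ {x} → In x → 0ℚ ≤ f x

    nonneg-iter : ∀ k → NonNeg f → NonNeg (iter k f)
    nonneg-iter {f} k h {x} x∈ = subst (_≤ iter k f x) (iter-const k 0ℚ x∈) (iter-mono k h x∈)

    -- The chain gets from x to y in t steps with probability at least c.
    record Reaches (t : ℕ) (c : ℚ) (x y : X) : Set where
      constructor reaches
      field
        bound : ∀ f → NonNeg f → c * f y ≤ iter t f x

    open Reaches

    reaches-step : ∀ {t c c′ x y z} → 0ℚ ≤ c′ → Reaches 1 c′ x y → Reaches t c y z → Reaches (suc t) (c′ * c) x z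
    reaches-step {t} {c} {c′} {x} {y} {z} 0≤c′ r r′ = reaches λ f h → begin
      c′ * c * f z          ≡⟨ ℚ.*-assoc c′ c (f z) ⟩
      c′ * (c * f z)        ≤⟨ *-monoˡ 0≤c′ (bound r′ f h) ⟩
      c′ * iter t f y       ≤⟨ bound r (iter t f) (nonneg-iter t h) ⟩
      T (iter t f) x        ≡⟨ iter-T t f x ⟨
      iter (suc t) f x      ∎
      where open ℚ.≤-Reasoning

    reaches-trans : ∀ {t s c c′ x y z} → 0ℚ ≤ c → Reaches t c x y → Reaches s c′ y z → Reaches (s ℕ.+ t) (c * c′) x z
    reaches-trans {t} {s} {c} {c′} {x} {y} {z} 0≤c r r′ = reaches λ f h → begin
      c * c′ * f z          ≡⟨ ℚ.*-assoc c c′ (f z) ⟩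
      c * (c′ * f z)        ≤⟨ *-monoˡ 0≤c (bound r′ f h) ⟩
      c * iter s f y        ≤⟨ bound r (iter s f) (nonneg-iter s h) ⟩
      iter t (iter s f) x   ≡⟨ cong (λ g → g x) (iter-+ s t f) ⟨
      iter (s ℕ.+ t) f x    ∎
      where open ℚ.≤-Reasoning

    reaches-weaken : ∀ {t c c′ x y} → In y → c′ ≤ c → Reaches t c x y → Reaches t c′ x y
    reaches-weaken y∈ c′≤c r = reaches λ f h → ℚ.≤-trans (*-monoʳ (h y∈) c′≤c) (bound r f h)

    reaches≤1 : ∀ {t c x y} → In x → Reaches t c x y → c ≤ 1ℚ
    reaches≤1 {t} {c} x∈ r = subst₂ _≤_ (ℚ.*-identityʳ c) (iter-const t 1ℚ x∈) (bound r (λ _ → 1ℚ) λ _ → ℚ.nonNegative⁻¹ 1ℚ)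

    module _ {x₀ : X} (x₀∈ : In x₀) {c₀ : ℚ} (0<c₀ : 0ℚ < c₀) (stay : Reaches 1 c₀ x₀ x₀) where

      private
        linger : ∀ s → ∃[ c ] 0ℚ < c × Reaches s c x₀ x₀
        linger zero = 1ℚ , ℚ.positive⁻¹ 1ℚ , reaches λ f h → ℚ.≤-reflexive (ℚ.*-identityˡ (f x₀))
        linger (suc s) = let c , 0<c , r = linger s
                         in c₀ * c , 0<* 0<c₀ 0<c , reaches-step (ℚ.<⇒≤ 0<c₀) stay r

      -- Waiting at `x₀` for the time that the other points need turns all arrival times into their
      -- sum; the smallest of the resulting probabilities is kept.
      uniformly-reaches : (xs : List X) → (∀ {x} → x ∈ xs → ∃[ t ] ∃[ c ] 0ℚ < c × Reaches t c x x₀) →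
                          ∃[ t ] ∃[ c ] 0ℚ < c × (∀ {x} → x ∈ xs → Reaches t c x x₀)
      uniformly-reaches [] h = 0 , 1ℚ , ℚ.positive⁻¹ 1ℚ , λ ()
      uniformly-reaches (x ∷ xs) h =
        let t , c , 0<c , r = h (here refl)
            t′ , c′ , 0<c′ , r′ = uniformly-reaches xs (h ∘ there)
            l , 0<l , stays = linger t′
            l′ , 0<l′ , stays′ = linger t
            d = c * l
            d′ = c′ * l′
        in t′ ℕ.+ t , d ℚ.⊓ d′ , smaller d d′ (0<* 0<c 0<l) (0<* 0<c′ 0<l′) , λ where
             (here refl) → reaches-weaken x₀∈ (ℚ.p⊓q≤p d d′) (reaches-trans (ℚ.<⇒≤ 0<c) r stays)
             (there y∈) → reaches-weaken x₀∈ (ℚ.p⊓q≤q d d′)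
               (commute t t′ (reaches-trans (ℚ.<⇒≤ 0<c′) (r′ y∈) stays′))
        where
        commute : ∀ s t {c x} → Reaches (s ℕ.+ t) c x x₀ → Reaches (t ℕ.+ s) c x x₀
        commute s t {c} {x} = subst (λ k → Reaches k c x x₀) (ℕ.+-comm s t)
        smaller : ∀ p q → 0ℚ < p → 0ℚ < q → 0ℚ < p ℚ.⊓ q
        smaller p q 0<p 0<q with ℚ.⊓-sel p q
        ... | inj₁ e = subst (0ℚ <_) (sym e) 0<p
        ... | inj₂ e = subst (0ℚ <_) (sym e) 0<q

      module _ {t : ℕ} {c : ℚ} (0<c : 0ℚ < c) (reach : ∀ {x} → In x → Reaches t c x x₀) where

        -- Both `f - lo` and `hi - f` are nonnegative, so their values at `x₀` lift the lower bound
        -- and depress the upper one. In the width the value `f x₀` cancels, which leaves the factor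
        -- `1 - c`.
        contract : Within f lo hi → ∃[ lo′ ] ∃[ hi′ ] Within (iter t f) lo′ hi′ × hi′ - lo′ ≡ (1ℚ - c) * (hi - lo)
        contract {f} {lo} {hi} w =
          lo + c * (f x₀ - lo) , hi - c * (hi - f x₀) , (λ x∈ → below x∈ , above x∈) , width lo hi c (f x₀)
          where
          open ℚ.≤-Reasoning
          width : ∀ lo hi c m → (hi - c * (hi - m)) - (lo + c * (m - lo)) ≡ (1ℚ - c) * (hi - lo)
          width = solve-∀ ringℚ
          l₁ : ∀ a b → - a + 1ℚ * b ≡ b - a
          l₁ = solve-∀ ringℚ
          l₂ : ∀ a b → a + - 1ℚ * b ≡ a - b
          l₂ = solve-∀ ringℚ
          l₃ : ∀ lo i → lo + (- lo + 1ℚ * i) ≡ i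
          l₃ = solve-∀ ringℚ
          l₄ : ∀ hi i → hi - (hi + - 1ℚ * i) ≡ i
          l₄ = solve-∀ ringℚ
          below : ∀ {x} → In x → lo + c * (f x₀ - lo) ≤ iter t f x
          below {x} x∈ = begin
            lo + c * (f x₀ - lo)                       ≡⟨ cong (λ k → lo + c * k) (l₁ lo (f x₀)) ⟨
            lo + c * (- lo + 1ℚ * f x₀)                ≤⟨ ℚ.+-monoʳ-≤ lo (bound (reach x∈) (λ y → - lo + 1ℚ * f y)
                                                          λ {y} y∈ → subst (0ℚ ≤_) (sym (l₁ lo (f y))) (≤⇒0≤- (proj₁ (w y∈)))) ⟩
            lo + iter t (λ y → - lo + 1ℚ * f y) x      ≡⟨ cong (_+_ lo) (iter-affine t (- lo) 1ℚ f x∈) ⟩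
            lo + (- lo + 1ℚ * iter t f x)              ≡⟨ l₃ lo (iter t f x) ⟩
            iter t f x                                 ∎
          above : ∀ {x} → In x → iter t f x ≤ hi - c * (hi - f x₀)
          above {x} x∈ = begin
            iter t f x                                 ≡⟨ l₄ hi (iter t f x) ⟨
            hi - (hi + - 1ℚ * iter t f x)              ≡⟨ cong (λ k → hi - k) (iter-affine t hi (- 1ℚ) f x∈) ⟨
            hi - iter t (λ y → hi + - 1ℚ * f y) x      ≤⟨ ℚ.+-monoʳ-≤ hi (ℚ.neg-antimono-≤ (bound (reach x∈) (λ y → hi + - 1ℚ * f y)
                                                          λ {y} y∈ → subst (0ℚ ≤_) (sym (l₂ hi (f y))) (≤⇒0≤- (proj₂ (w y∈))))) ⟩
            hi - c * (hi + - 1ℚ * f x₀)                ≡⟨ cong (λ k → hi - c * k) (l₂ hi (f x₀)) ⟩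
            hi - c * (hi - f x₀)                       ∎

        contract-iter : ∀ k → Within f lo hi →
          ∃[ lo′ ] ∃[ hi′ ] Within (iter (k ℕ.* t) f) lo′ hi′ × hi′ - lo′ ≡ (1ℚ - c) ^ k * (hi - lo)
        contract-iter {lo = lo} {hi} zero w = lo , hi , w , sym (ℚ.*-identityˡ (hi - lo))
        contract-iter {f} {lo} {hi} (suc k) w =
          let lo₁ , hi₁ , w₁ , e₁ = contract w
              lo₂ , hi₂ , w₂ , e₂ = contract-iter k w₁
          in lo₂ , hi₂ , (λ {x} x∈ → subst (λ g → lo₂ ≤ g x × g x ≤ hi₂) (sym (iter-+ t (k ℕ.* t) f)) (w₂ x∈))
           , ≡.trans e₂ (≡.trans (cong ((1ℚ - c) ^ k *_) e₁) (lemma ((1ℚ - c) ^ k) (1ℚ - c) (hi - lo)))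
          where
          lemma : ∀ r q d → r * (q * d) ≡ (q * r) * d
          lemma = solve-∀ ringℚ

        -- Contraction is known only at multiples of `t`; at later times the bounds persist because
        -- averaging never leaves an interval.
        settles : Within f 0ℚ 1ℚ → ∀ {η} → 0ℚ < η →
                  ∃[ K ] ∀ k → k ℕ.≥ K → ∃[ lo ] ∃[ hi ] Within (iter k f) lo hi × hi - lo < η
        settles {f} w 0<η =
          let n , small = powers-vanish 0<c (reaches≤1 x₀∈ (reach x₀∈)) 0<η
              lo , hi , w′ , e = contract-iter n w
          in n ℕ.* t , λ k k≥ → lo , hi ,
               subst (λ g → Within g lo hi)
                     (≡.trans (sym (iter-+ (n ℕ.* t) (k ℕ.∸ n ℕ.* t) f)) (cong (λ l → iter l f) (ℕ.m+[n∸m]≡n k≥)))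
                     (within-iter (k ℕ.∸ n ℕ.* t) w′)
             , subst (_< _) (sym (≡.trans e (ℚ.*-identityʳ ((1ℚ - c) ^ n)))) small

-- The shuffle chain: probabilities of moves, and invariance of the uniform measure on vectors.

module Chain where

  open import Defs
  open import Data.Bool.Base using (true; false; if_then_else_; _∧_)
  open import Data.Fin.Base as Fin using (Fin)
  import Data.Fin.Properties as Fin
  open import Data.List.Base using (List; [_]; filter; map; cartesianProduct; allFin)
  open import Data.List.Membership.Propositional using (_∈_)
  open import Data.List.Membership.Propositional.Properties
    using (∈-filter⁺; ∈-filter⁻; ∈-cartesianProduct⁺; ∈-cartesianProduct⁻; ∈-allFin; ∈-map⁺;
      ∈-map⁻)
  open import Data.List.Membership.Propositional.Properties.WithK using (unique∧set⇒bag)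
  open import Data.List.Properties using (filter-≐)
  open import Data.List.Relation.Binary.BagAndSetEquality using (∼bag⇒↭)
  open import Data.List.Relation.Binary.Permutation.Propositional using (_↭_)
  open import Data.List.Relation.Unary.Unique.Propositional using (Unique)
  import Data.List.Relation.Unary.Unique.Propositional.Properties as Unique
  open import Data.Nat.Base using (zero; suc)
  open import Data.Product.Base using (_×_; _,_; proj₁; proj₂; ∃-syntax)
  open import Data.Rational.Base as ℚ using (ℚ; 0ℚ; 1ℚ; ½; _+_; _*_; _-_; -_; _≤_; _<_)
  import Data.Rational.Properties as ℚ
  open import Data.Vec.Base as Vec using (Vec; lookup; _[_]≔_)
  import Data.Vec.Properties as Vec
  open import Function.Base using (_∘_)
  open import Function.Bundles using (mk⇔)
  open import Relation.Binary.Construct.Closure.ReflexiveTransitive using (Star; ε; _◅_)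
  open import Relation.Binary.PropositionalEquality as ≡
    using (_≡_; _≢_; refl; sym; cong; cong₂; subst; subst₂; ≢-sym; module ≡-Reasoning)
  open import Relation.Nullary.Decidable using (Dec; yes; no; does; _×-dec_; dec-true)
  open import Relation.Unary using (Decidable)
  open import Tactic.RingSolver using (solve-∀)
  open Expectation
  open Averages
  open Connectivity

  same-elements⇒↭ : {A : Set} {xs ys : List A} → Unique xs → Unique ys →
                    (∀ {x} → x ∈ xs → x ∈ ys) → (∀ {x} → x ∈ ys → x ∈ xs) → xs ↭ ys
  same-elements⇒↭ u v f g = ∼bag⇒↭ (unique∧set⇒bag u v (mk⇔ f g))

  self-negative : ∀ {p} → p ≡ - p → p ≡ 0ℚ
  self-negative {p} e = begin
    p              ≡⟨ l p ⟩
    ½ * (p + p)    ≡⟨ cong (λ q → ½ * (p + q)) e ⟩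
    ½ * (p - p)    ≡⟨ cong (½ *_) (ℚ.+-inverseʳ p) ⟩
    ½ * 0ℚ         ≡⟨ ℚ.*-zeroʳ ½ ⟩
    0ℚ             ∎
    where
    open ≡-Reasoning
    l : ∀ p → p ≡ ½ * (p + p)
    l p = sym (≡.trans (ℚ.*-distribˡ-+ ½ p p) (≡.trans (sym (ℚ.*-distribʳ-+ p ½ ½)) (ℚ.*-identityˡ p)))

  -- The involution `τ` permutes the list, so the sum equals its own negative.
  sumBy-antisymmetric : {A : Set} {xs : List A} → Unique xs → (τ : A → A) → (∀ x → τ (τ x) ≡ x) →
    (∀ {x} → x ∈ xs → τ x ∈ xs) → (u : A → ℚ) → (∀ {x} → x ∈ xs → u (τ x) ≡ - u x) → sumBy xs u ≡ 0ℚ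
  sumBy-antisymmetric {xs = xs} uniq τ ττ τ∈ u anti = self-negative (begin
    sumBy xs u                  ≡⟨ sumBy-↭ u (same-elements⇒↭ uniq
                                     (Unique.map⁺ (λ {x} {y} e → ≡.trans (sym (ττ x)) (≡.trans (cong τ e) (ττ y))) uniq)
                                     (λ {x} x∈ → subst (_∈ map τ xs) (ττ x) (∈-map⁺ τ (τ∈ x∈)))
                                     (λ x∈ → let y , y∈ , e = ∈-map⁻ τ x∈ in subst (_∈ xs) (sym e) (τ∈ y∈))) ⟩
    sumBy (map τ xs) u          ≡⟨ sumBy-map τ u xs ⟩
    sumBy xs (u ∘ τ)            ≡⟨ sumBy-cong xs anti ⟩
    sumBy xs (λ x → - u x)      ≡⟨ sumBy-cong xs (λ {x} _ → ≡.trans (cong -_ (sym (ℚ.*-identityˡ (u x)))) (ℚ.neg-distribˡ-* 1ℚ (u x))) ⟩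
    sumBy xs (λ x → - 1ℚ * u x) ≡⟨ sumBy-*ˡ (- 1ℚ) u xs ⟩
    - 1ℚ * sumBy xs u           ≡⟨ ℚ.neg-distribˡ-* 1ℚ (sumBy xs u) ⟨
    - (1ℚ * sumBy xs u)         ≡⟨ cong -_ (ℚ.*-identityˡ (sumBy xs u)) ⟩
    - sumBy xs u                ∎)
    where open ≡-Reasoning

  module _ (d : DegreeSequence) where
    open DegreeSequence d

    update : Hypergraph d → Fin arcs × Fin arcs → StubHyperarc d × StubHyperarc d → Hypergraph d
    update H (i , j) (â , b̂) = H [ i ]≔ â [ j ]≔ b̂

    next : Hypergraph d → Fin arcs × Fin arcs → StubHyperarc d × StubHyperarc d → Hypergraph d
    next H ij s = if does (inSpace? d (update H ij s)) then update H ij s else H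

    shuffles : Hypergraph d → Fin arcs × Fin arcs → List (StubHyperarc d × StubHyperarc d)
    shuffles H (i , j) = S d (lookup H i) (lookup H j)

    T : (Hypergraph d → ℚ) → Hypergraph d → ℚ
    T f H = E (step d H) f

    T-expand : ∀ f H → T f H ≡ E (uniform (pairs d)) λ ij → E (uniform (shuffles H ij)) λ s → f (next H ij s)
    T-expand f H = ≡.trans (E->>= (uniform (pairs d)) outer f) (E-cong (uniform (pairs d)) λ ij →
      ≡.trans (E->>= (uniform (shuffles H ij)) (inner ij) f) (E-cong (uniform (shuffles H ij)) λ s → E-point (next H ij s) f))
      where
      inner : Fin arcs × Fin arcs → StubHyperarc d × StubHyperarc d → Dist (Hypergraph d)
      inner ij s = point (next H ij s)
      outer : Fin arcs × Fin arcs → Dist (Hypergraph d)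
      outer ij = uniform (shuffles H ij) >>= inner ij

    next-inSpace : ∀ {H} → InSpace d H → ∀ ij s → InSpace d (next H ij s)
    next-inSpace {H} H∈ ij s = either (inSpace? d (update H ij s))
      where
      either : (P? : Dec (InSpace d (update H ij s))) → InSpace d (if does P? then update H ij s else H)
      either (yes p) = p
      either (no _) = H∈

    next-accept : ∀ {H ij s} → InSpace d (update H ij s) → next H ij s ≡ update H ij s
    next-accept {H} {ij} {s} p = cong (if_then update H ij s else H) (dec-true (inSpace? d (update H ij s)) p)

    -- Leaving both hyperarcs alone is a shuffle, so `S` is never empty and the inner draw has total
    -- mass 1.
    current : ∀ H i j → (lookup H i , lookup H j) ∈ shuffles H (i , j)
    current H i j = ∈-filter⁺ (isShuffle? d (lookup H i) (lookup H j))
      (∈-cartesianProduct⁺ (∈-hyperarcs d _) (∈-hyperarcs d _)) (refl , refl , refl , refl)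

    T-mono : ∀ {f g} → (∀ {H} → InSpace d H → f H ≤ g H) → ∀ {H} → InSpace d H → T f H ≤ T g H
    T-mono {f} {g} h {H} H∈ = subst₂ _≤_ (sym (T-expand f H)) (sym (T-expand g H))
      (E-uniform-mono (pairs d) λ {ij} _ → E-uniform-mono (shuffles H ij) λ {s} _ → h (next-inSpace H∈ ij s))

    -- The two positions keep `pairs` from being empty, in which case a step would have mass 0.
    module Walk {i₀ j₀ : Fin arcs} (i₀<j₀ : i₀ Fin.< j₀) where

      pair∈ : ∀ {i j} → i Fin.< j → (i , j) ∈ pairs d
      pair∈ i<j = ∈-filter⁺ (λ (i , j) → i Fin.<? j) (∈-cartesianProduct⁺ (∈-allFin _) (∈-allFin _)) i<j

      T-1 : ∀ {H} → InSpace d H → T (λ _ → 1ℚ) H ≡ 1ℚ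
      T-1 {H} _ = ≡.trans (T-expand (λ _ → 1ℚ) H) (≡.trans
        (E-cong (uniform (pairs d)) λ { (i , j) → E-uniform-const 1ℚ (current H i j) })
        (E-uniform-const 1ℚ (pair∈ i₀<j₀)))

      open Averaging (InSpace d) T (λ f g H → E-+ f g (step d H)) (λ p f H → E-* p f (step d H)) T-1 T-mono public

      method-iter : ∀ k H f → E (method d H k) f ≡ iter k f H
      method-iter zero H f = E-point H f
      method-iter (suc k) H f = ≡.trans (E->>= (method d H k) (step d) f) (method-iter k H (T f))

      -- Drawing the right pair and then the right shuffle already realises the move; all other
      -- terms of the expectation are nonnegative and are dropped.
      move-reaches : ∀ {H G} → InSpace d H → InSpaceMove d H G → ∃[ c ] 0ℚ < c × Reaches 1 c H G
      move-reaches {H} {G} H∈ (M , G∈) = wp * ws , 0<* (weight>0 (pair∈ i<j)) (weight>0 s∈) , reaches bound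
        where
        open Move M
        wp = weightOf (pairs d)
        ws = weightOf (shuffles H (i , j))
        s∈ : (â , b̂) ∈ shuffles H (i , j)
        s∈ = ∈-filter⁺ (isShuffle? d (lookup H i) (lookup H j)) (∈-cartesianProduct⁺ (∈-hyperarcs d _) (∈-hyperarcs d _)) shuffle
        bound : ∀ f → NonNeg f → wp * ws * f G ≤ T f H
        bound f h = begin
          wp * ws * f G                                ≡⟨ ℚ.*-assoc wp ws (f G) ⟩
          wp * (ws * f G)                              ≡⟨ cong (λ K → wp * (ws * f K)) (≡.trans (next-accept (subst (InSpace d) result G∈)) (sym result)) ⟨
          wp * (ws * f (next H (i , j) (â , b̂)))       ≤⟨ *-monoˡ (weight≥0 (pairs d)) (E-uniform-term (shuffles H (i , j)) (λ {s} _ → nonneg (i , j) s) s∈) ⟩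
          wp * E (uniform (shuffles H (i , j))) (λ s → f (next H (i , j) s))
            ≤⟨ E-uniform-term (pairs d) (λ {ij} _ → inner≥0 ij) (pair∈ i<j) ⟩
          E (uniform (pairs d)) (λ ij → E (uniform (shuffles H ij)) (λ s → f (next H ij s)))  ≡⟨ T-expand f H ⟨
          T f H                                        ∎
          where
          open ℚ.≤-Reasoning
          nonneg : ∀ ij s → 0ℚ ≤ f (next H ij s)
          nonneg ij s = h (next-inSpace H∈ ij s)
          inner≥0 : ∀ ij → 0ℚ ≤ E (uniform (shuffles H ij)) (λ s → f (next H ij s))
          inner≥0 ij = subst (0ℚ ≤_) (sym (E-uniform (shuffles H ij) _))
            (0≤* (weight≥0 (shuffles H ij)) (sumBy-nonneg (shuffles H ij) λ {s} _ → nonneg ij s))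

      path-reaches : ∀ {H G} → InSpace d H → Star (InSpaceMove d) H G → ∃[ t ] ∃[ c ] 0ℚ < c × Reaches t c H G
      path-reaches {H} H∈ ε = 0 , 1ℚ , ℚ.positive⁻¹ 1ℚ , reaches λ f h → ℚ.≤-reflexive (ℚ.*-identityˡ (f H))
      path-reaches H∈ (m ◅ path) =
        let c , 0<c , r = move-reaches H∈ m
            t , c′ , 0<c′ , r′ = path-reaches (proj₂ m) path
        in suc t , c * c′ , 0<* 0<c 0<c′ , reaches-step (ℚ.<⇒≤ 0<c) r r′

      stay : ∀ {H} → InSpace d H → InSpaceMove d H H
      stay {H} H∈ = record { i<j = i₀<j₀ ; shuffle = refl , refl , refl , refl
        ; result = sym (≡.trans (cong (_[ j₀ ]≔ lookup H j₀) (Vec.[]≔-lookup H i₀)) (Vec.[]≔-lookup H j₀)) } , H∈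

      states : List (Hypergraph d)
      states = filter (inSpace? d) (vectors (hyperarcs d) arcs)

      states-complete : ∀ {H} → InSpace d H → H ∈ states
      states-complete {H} H∈ = ∈-filter⁺ (inSpace? d) (∈-vectors (∈-hyperarcs d) H) H∈

      states-sound : ∀ {H} → H ∈ states → InSpace d H
      states-sound H∈ = proj₂ (∈-filter⁻ (inSpace? d) {xs = vectors (hyperarcs d) arcs} H∈)

      states-unique : Unique states
      states-unique = Unique.filter⁺ (inSpace? d) (vectors-unique (hyperarcs-unique d) arcs)

      module _ (f : Hypergraph d → ℚ) {i j : Fin arcs} (i≢j : i ≢ j) where

        private
          ij = i , j
          arcPairs = cartesianProduct (hyperarcs d) (hyperarcs d)
          Exchange = Hypergraph d × (StubHyperarc d × StubHyperarc d)

          Accepted : Exchange → Set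
          Accepted (H , s) = IsShuffle d (lookup H i) (lookup H j) s × InSpace d (update H ij s)

          accepted? : Decidable Accepted
          accepted? (H , s) = isShuffle? d (lookup H i) (lookup H j) s ×-dec inSpace? d (update H ij s)

          exchanges : List Exchange
          exchanges = filter accepted? (cartesianProduct states arcPairs)

          -- The exchange run backwards: it starts from the new hypergraph and puts the two old
          -- hyperarcs back.
          τ : Exchange → Exchange
          τ (H , s) = update H ij s , (lookup H i , lookup H j)

          at-i : ∀ H s → lookup (update H ij s) i ≡ proj₁ s
          at-i H (â , b̂) = ≡.trans (Vec.lookup∘updateAt′ i j i≢j (H [ i ]≔ â)) (Vec.lookup∘updateAt i H)

          at-j : ∀ H s → lookup (update H ij s) j ≡ proj₂ s
          at-j H (â , b̂) = Vec.lookup∘updateAt j (H [ i ]≔ â)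

          restore : ∀ H s → update (update H ij s) ij (lookup H i , lookup H j) ≡ H
          restore H (â , b̂) = begin
            H [ i ]≔ â [ j ]≔ b̂ [ i ]≔ lookup H i [ j ]≔ lookup H j
              ≡⟨ cong (_[ j ]≔ lookup H j) (Vec.[]≔-commutes (H [ i ]≔ â) j i (≢-sym i≢j)) ⟩
            H [ i ]≔ â [ i ]≔ lookup H i [ j ]≔ b̂ [ j ]≔ lookup H j
              ≡⟨ Vec.[]≔-idempotent (H [ i ]≔ â [ i ]≔ lookup H i) j ⟩
            H [ i ]≔ â [ i ]≔ lookup H i [ j ]≔ lookup H j
              ≡⟨ cong (_[ j ]≔ lookup H j) (≡.trans (Vec.[]≔-idempotent H i) (Vec.[]≔-lookup H i)) ⟩
            H [ j ]≔ lookup H j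
              ≡⟨ Vec.[]≔-lookup H j ⟩
            H ∎
            where open ≡-Reasoning

          ττ : ∀ x → τ (τ x) ≡ x
          ττ (H , s) = cong₂ _,_ (restore H s) (cong₂ _,_ (at-i H s) (at-j H s))

          shuffle-sym : ∀ a b s → IsShuffle d a b s → IsShuffle d (proj₁ s) (proj₂ s) (a , b)
          shuffle-sym a b s (p , q , r , t) = sym p , sym q , sym r , sym t

          shuffle-trans : ∀ a b s t → IsShuffle d a b s → IsShuffle d (proj₁ s) (proj₂ s) t → IsShuffle d a b t
          shuffle-trans a b s t (p , q , r , u) (p′ , q′ , r′ , u′) = ≡.trans p p′ , ≡.trans q q′ , ≡.trans r r′ , ≡.trans u u′

          -- Which shuffles a pair admits depends only on multiset unions and sizes, and shuffling
          -- preserves these. So an exchange and its reverse are drawn with the same weight.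
          same-S : ∀ a b s → IsShuffle d a b s → S d (proj₁ s) (proj₂ s) ≡ S d a b
          same-S a b s sh = filter-≐ (isShuffle? d (proj₁ s) (proj₂ s)) (isShuffle? d a b)
            ((λ {t} → shuffle-trans a b s t sh) , (λ {t} → shuffle-trans (proj₁ s) (proj₂ s) (a , b) t (shuffle-sym a b s sh))) arcPairs

          same-shuffles : ∀ H s → IsShuffle d (lookup H i) (lookup H j) s → shuffles (update H ij s) ij ≡ shuffles H ij
          same-shuffles H s sh = ≡.trans (cong₂ (S d) (at-i H s) (at-j H s)) (same-S (lookup H i) (lookup H j) s sh)

          τ∈ : ∀ {x} → x ∈ exchanges → τ x ∈ exchanges
          τ∈ {H , s} x∈ =
            let x∈cp , sh , H′∈ = ∈-filter⁻ accepted? {xs = cartesianProduct states arcPairs} x∈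
                H∈ , _ = ∈-cartesianProduct⁻ states arcPairs x∈cp
            in ∈-filter⁺ accepted?
                 (∈-cartesianProduct⁺ (states-complete H′∈) (∈-cartesianProduct⁺ (∈-hyperarcs d _) (∈-hyperarcs d _)))
                 ( subst₂ (λ a b → IsShuffle d a b (lookup H i , lookup H j)) (sym (at-i H s)) (sym (at-j H s)) (shuffle-sym (lookup H i) (lookup H j) s sh)
                 , subst (InSpace d) (sym (restore H s)) (states-sound H∈))

          gain : Exchange → ℚ
          gain (H , s) = weightOf (shuffles H ij) * (f (update H ij s) - f H)

          gain-τ : ∀ {x} → x ∈ exchanges → gain (τ x) ≡ - gain x
          gain-τ {H , s} x∈ =
            let _ , sh , _ = ∈-filter⁻ accepted? {xs = cartesianProduct states arcPairs} x∈
            in ≡.trans (cong₂ (λ l K → weightOf l * (f K - f (update H ij s))) (same-shuffles H s sh) (restore H s))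
                       (lemma (weightOf (shuffles H ij)) (f H) (f (update H ij s)))
            where
            lemma : ∀ w a b → w * (a - b) ≡ - (w * (b - a))
            lemma = solve-∀ ringℚ

        -- Shuffling positions i and j is symmetric, so the exchanges cancel in pairs.
        balanced : sumBy states (λ H → weightOf (shuffles H ij) * sumBy (shuffles H ij) (λ s → f (next H ij s) - f H)) ≡ 0ℚ
        balanced = begin
          sumBy states (λ H → weightOf (shuffles H ij) * sumBy (shuffles H ij) (λ s → f (next H ij s) - f H))
            ≡⟨ sumBy-cong states (λ {H} _ → expand H) ⟩
          sumBy states (λ H → sumBy arcPairs (λ s → if does (accepted? (H , s)) then gain (H , s) else 0ℚ))
            ≡⟨ sumBy-cartesianWith _,_ (λ x → if does (accepted? x) then gain x else 0ℚ) states arcPairs ⟨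
          sumBy (cartesianProduct states arcPairs) (λ x → if does (accepted? x) then gain x else 0ℚ)
            ≡⟨ sumBy-filter accepted? gain (cartesianProduct states arcPairs) ⟨
          sumBy exchanges gain
            ≡⟨ sumBy-antisymmetric (Unique.filter⁺ accepted? (Unique.cartesianProduct⁺ states-unique
                 (Unique.cartesianProduct⁺ (hyperarcs-unique d) (hyperarcs-unique d)))) τ ττ τ∈ gain gain-τ ⟩
          0ℚ ∎
          where
          open ≡-Reasoning
          accept : ∀ H s → (if does (isShuffle? d (lookup H i) (lookup H j) s) then weightOf (shuffles H ij) * (f (next H ij s) - f H) else 0ℚ)
                         ≡ (if does (accepted? (H , s)) then gain (H , s) else 0ℚ)
          accept H s = lemma (does (isShuffle? d (lookup H i) (lookup H j) s)) (does (inSpace? d (update H ij s))) (weightOf (shuffles H ij)) (update H ij s) H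
            where
            lemma : ∀ b c w G H → (if b then w * (f (if c then G else H) - f H) else 0ℚ) ≡ (if b ∧ c then w * (f G - f H) else 0ℚ)
            lemma true true w G H = refl
            -- A rejected shuffle leaves the hypergraph in place and gains nothing, so only accepted
            -- exchanges remain.
            lemma true false w G H = ≡.trans (cong (w *_) (ℚ.+-inverseʳ (f H))) (ℚ.*-zeroʳ w)
            lemma false c w G H = refl
          expand : ∀ H → weightOf (shuffles H ij) * sumBy (shuffles H ij) (λ s → f (next H ij s) - f H)
                       ≡ sumBy arcPairs (λ s → if does (accepted? (H , s)) then gain (H , s) else 0ℚ)
          expand H = begin
            weightOf (shuffles H ij) * sumBy (shuffles H ij) (λ s → f (next H ij s) - f H)
              ≡⟨ sumBy-*ˡ (weightOf (shuffles H ij)) _ (shuffles H ij) ⟨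
            sumBy (shuffles H ij) (λ s → weightOf (shuffles H ij) * (f (next H ij s) - f H))
              ≡⟨ sumBy-filter (isShuffle? d (lookup H i) (lookup H j)) _ arcPairs ⟩
            sumBy arcPairs (λ s → if does (isShuffle? d (lookup H i) (lookup H j) s) then weightOf (shuffles H ij) * (f (next H ij s) - f H) else 0ℚ)
              ≡⟨ sumBy-cong arcPairs (λ {s} _ → accept H s) ⟩
            sumBy arcPairs (λ s → if does (accepted? (H , s)) then gain (H , s) else 0ℚ) ∎

      drift : (Hypergraph d → ℚ) → Hypergraph d → Fin arcs × Fin arcs → ℚ
      drift f H ij = weightOf (shuffles H ij) * sumBy (shuffles H ij) (λ s → f (next H ij s) - f H)

      T-drift : ∀ f {H} → InSpace d H → T f H ≡ f H + weightOf (pairs d) * sumBy (pairs d) (drift f H)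
      T-drift f {H} H∈ = begin
        T f H                                             ≡⟨ l (f H) (T f H) ⟨
        f H + (- f H + 1ℚ * T f H)                        ≡⟨ cong (_+_ (f H)) (iter-affine 1 (- f H) 1ℚ f H∈) ⟨
        f H + T (λ G → - f H + 1ℚ * f G) H                ≡⟨ cong (_+_ (f H)) (E-cong (step d H) (λ G → l′ (f H) (f G))) ⟩
        f H + T (λ G → f G - f H) H                       ≡⟨ cong (_+_ (f H)) (T-expand (λ G → f G - f H) H) ⟩
        f H + E (uniform (pairs d)) (λ ij → E (uniform (shuffles H ij)) (λ s → f (next H ij s) - f H))
          ≡⟨ cong (_+_ (f H)) (E-cong (uniform (pairs d)) (λ ij → E-uniform (shuffles H ij) (λ s → f (next H ij s) - f H))) ⟩
        f H + E (uniform (pairs d)) (drift f H)           ≡⟨ cong (_+_ (f H)) (E-uniform (pairs d) (drift f H)) ⟩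
        f H + weightOf (pairs d) * sumBy (pairs d) (drift f H)  ∎
        where
        open ≡-Reasoning
        l : ∀ a b → a + (- a + 1ℚ * b) ≡ b
        l = solve-∀ ringℚ
        l′ : ∀ a b → - a + 1ℚ * b ≡ b - a
        l′ = solve-∀ ringℚ

      -- Balance holds for each pair of positions separately, so the sums over states and over pairs
      -- are interchanged first.
      sum-T : ∀ f → sumBy states (T f) ≡ sumBy states f
      sum-T f = begin
        sumBy states (T f)                                                        ≡⟨ sumBy-cong states (λ H∈ → T-drift f (states-sound H∈)) ⟩
        sumBy states (λ H → f H + wp * sumBy (pairs d) (drift f H))               ≡⟨ sumBy-+ f _ states ⟩
        sumBy states f + sumBy states (λ H → wp * sumBy (pairs d) (drift f H))    ≡⟨ cong (_+_ (sumBy states f)) (sumBy-*ˡ wp _ states) ⟩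
        sumBy states f + wp * sumBy states (λ H → sumBy (pairs d) (drift f H))    ≡⟨ cong (λ k → sumBy states f + wp * k) (sumBy-comm (drift f) states (pairs d)) ⟩
        sumBy states f + wp * sumBy (pairs d) (λ ij → sumBy states (λ H → drift f H ij))
          ≡⟨ cong (λ k → sumBy states f + wp * k) (sumBy-cong (pairs d) λ {ij} ij∈ → balanced f (Fin.<⇒≢ (proj₂ (∈-filter⁻ (λ (i , j) → i Fin.<? j) {xs = cartesianProduct (allFin arcs) (allFin arcs)} ij∈)))) ⟩
        sumBy states f + wp * sumBy (pairs d) (λ _ → 0ℚ)                          ≡⟨ cong (λ k → sumBy states f + wp * k) (sumBy-0 (pairs d)) ⟩
        sumBy states f + wp * 0ℚ                                                  ≡⟨ cong (_+_ (sumBy states f)) (ℚ.*-zeroʳ wp) ⟩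
        sumBy states f + 0ℚ                                                       ≡⟨ ℚ.+-identityʳ _ ⟩
        sumBy states f                                                            ∎
        where
        open ≡-Reasoning
        wp = weightOf (pairs d)

      sum-iter : ∀ k f → sumBy states (iter k f) ≡ sumBy states f
      sum-iter zero f = refl
      sum-iter (suc k) f = ≡.trans (sum-iter k (T f)) (sum-T f)

-- From vectors of hyperarcs to hypergraphs up to reordering.

module Classes where

  open import Defs
  open import Data.Bool.Base using (true; false; if_then_else_)
  open import Data.Fin.Subset.Properties using (_∈?_)
  open import Data.List.Base using (List; []; _∷_; _++_; filter; map; length)
  open import Data.List.Membership.Propositional using (_∈_)
  open import Data.List.Membership.DecPropositional using () renaming (_∈?_ to mem?)
  open import Data.List.Membership.Propositional.Properties using (∈-filter⁺; ∈-filter⁻; ∈-∃++)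
  open import Data.List.Relation.Binary.Permutation.Propositional
    using (_↭_; ↭-sym; ↭-trans; prep; ↭⇒↭ₛ)
  open import Data.List.Relation.Binary.Permutation.Propositional.Properties
    using (∈-resp-↭; All-resp-↭; ↭-length; filter-↭; shift; drop-∷; map⁺)
  import Data.List.Relation.Binary.Permutation.Setoid.Properties as ↭ₛ
  import Data.List.Relation.Unary.All as ListAll
  open import Data.List.Relation.Unary.AllPairs as AllPairs using (AllPairs; []; _∷_)
  open import Data.List.Relation.Unary.Any as ListAny using (here; there)
  open import Data.List.Relation.Unary.Unique.Propositional using (Unique)
  import Data.List.Relation.Unary.Unique.Propositional.Properties as Unique
  open import Data.Nat.Base as ℕ using (ℕ; zero; suc)
  import Data.Nat.Properties as ℕ
  open import Data.Product.Base using (_,_; proj₂; ∃-syntax)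
  open import Data.Rational.Base as ℚ using (ℚ; 0ℚ; 1ℚ; _+_; _*_)
  import Data.Rational.Properties as ℚ
  open import Data.Vec.Base as Vec using (Vec; []; _∷_; lookup; toList)
  import Data.Vec.Properties as Vec
  import Data.Vec.Relation.Unary.All.Properties as All
  open import Function.Bundles using (mk⇔)
  open import Relation.Binary.Definitions using (DecidableEquality)
  import Relation.Binary.Definitions as Binary
  open import Relation.Binary.PropositionalEquality as ≡
    using (_≡_; refl; sym; cong; cong₂; subst₂; module ≡-Reasoning)
  open import Relation.Nullary.Decidable using (Dec; yes; no; does; dec-true; dec-false; does-⇔)
  open import Relation.Nullary.Negation using (¬_; contradiction)
  open import Relation.Unary using (Decidable)
  open import Tactic.RingSolver using (solve-∀)
  open Expectation
  open Subsets
  open Chain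

  sumBy-const : {A : Set} (c : ℚ) (xs : List A) → sumBy xs (λ _ → c) ≡ fromℕ (length xs) * c
  sumBy-const c xs = begin
    sumBy xs (λ _ → c)            ≡⟨ sumBy-cong xs (λ _ → sym (ℚ.*-identityˡ c)) ⟩
    sumBy xs (λ _ → 1ℚ * c)       ≡⟨ sumBy-*ʳ c (λ _ → 1ℚ) xs ⟩
    sumBy xs (λ _ → 1ℚ) * c       ≡⟨ cong (_* c) (sumBy-1 xs) ⟩
    fromℕ (length xs) * c         ∎
    where open ≡-Reasoning

  factorial : ℕ → ℚ
  factorial zero = 1ℚ
  factorial (suc n) = fromℕ (suc n) * factorial n

  module _ {A : Set} (_≟_ : DecidableEquality A) {xs : List A} (unique-xs : Unique xs) (all-xs : ∀ x → x ∈ xs) where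

    -- The first entry must be one of the distinct elements of `l`, and the remaining entries
    -- arrange what is left.
    arrangements : ∀ n (l : List A) → Unique l → length l ≡ n →
                   sumBy (vectors xs n) (λ v → indicator (λ v → ↭-dec _≟_ (toList v) l) v) ≡ factorial n
    arrangements zero [] _ _ = refl
    arrangements (suc n) l u len = begin
      sumBy (vectors xs (suc n)) (λ v → indicator (λ v → ↭-dec _≟_ (toList v) l) v)
        ≡⟨ sumBy-cartesianWith _∷_ (λ v → indicator (λ v → ↭-dec _≟_ (toList v) l) v) xs (vectors xs n) ⟩
      sumBy xs (λ x → sumBy (vectors xs n) (λ v → if does (↭-dec _≟_ (x ∷ toList v) l) then 1ℚ else 0ℚ))
        ≡⟨ sumBy-cong xs (λ {x} _ → starting-with x (mem? _≟_ x l)) ⟩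
      sumBy xs (λ x → if does (mem? _≟_ x l) then factorial n else 0ℚ)
        ≡⟨ sumBy-filter (λ x → mem? _≟_ x l) (λ _ → factorial n) xs ⟨
      sumBy (filter (λ x → mem? _≟_ x l) xs) (λ _ → factorial n)
        ≡⟨ sumBy-↭ (λ _ → factorial n) (same-elements⇒↭ (Unique.filter⁺ (λ x → mem? _≟_ x l) unique-xs) u
             (λ x∈ → proj₂ (∈-filter⁻ (λ x → mem? _≟_ x l) {xs = xs} x∈)) (λ {x} x∈ → ∈-filter⁺ (λ x → mem? _≟_ x l) (all-xs x) x∈)) ⟩
      sumBy l (λ _ → factorial n)     ≡⟨ sumBy-const (factorial n) l ⟩
      fromℕ (length l) * factorial n  ≡⟨ cong (λ k → fromℕ k * factorial n) len ⟩
      factorial (suc n)               ∎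
      where
      open ≡-Reasoning
      starting-with : ∀ x (x∈? : Dec (x ∈ l)) → sumBy (vectors xs n) (λ v → if does (↭-dec _≟_ (x ∷ toList v) l) then 1ℚ else 0ℚ)
                                              ≡ (if does x∈? then factorial n else 0ℚ)
      starting-with x (no x∉) = ≡.trans
        (sumBy-cong (vectors xs n) (λ {v} _ → cong (if_then 1ℚ else 0ℚ) (dec-false (↭-dec _≟_ (x ∷ toList v) l) λ p → x∉ (∈-resp-↭ p (here refl)))))
        (sumBy-0 (vectors xs n))
      starting-with x (yes x∈) = split (∈-∃++ x∈)
        where
        split : (∃[ as ] ∃[ bs ] l ≡ as ++ x ∷ bs) → sumBy (vectors xs n) (λ v → if does (↭-dec _≟_ (x ∷ toList v) l) then 1ℚ else 0ℚ) ≡ factorial n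
        split (as , bs , refl) = ≡.trans
          (sumBy-cong (vectors xs n) (λ {v} _ → cong (if_then 1ℚ else 0ℚ) (does-⇔
            (mk⇔ (λ p → drop-∷ (↭-trans p (shift x as bs))) (λ p → ↭-trans (prep x p) (↭-sym (shift x as bs))))
            (↭-dec _≟_ (x ∷ toList v) l) (↭-dec _≟_ (toList v) (as ++ bs)))))
          (arrangements n (as ++ bs) (AllPairs.tail unique′) (ℕ.suc-injective (≡.trans (sym (↭-length (shift x as bs))) len)))
          where
          unique′ : Unique (x ∷ as ++ bs)
          unique′ = ↭ₛ.Unique-resp-↭ (≡.setoid A) (↭⇒↭ₛ (shift x as bs)) u

  module _ {A : Set} {_≈_ : A → A → Set} (_≈?_ : Binary.Decidable _≈_)
    (≈-sym : ∀ {x y} → x ≈ y → y ≈ x) (≈-trans : ∀ {x y z} → x ≈ y → y ≈ z → x ≈ z) where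

    one-representative : ∀ {v} rs → AllPairs (λ x y → ¬ x ≈ y) rs → ListAny.Any (v ≈_) rs → sumBy rs (λ r → indicator (v ≈?_) r) ≡ 1ℚ
    one-representative {v} (r ∷ rs) (r≉ ∷ u) (here v≈r) = ≡.trans
      (cong₂ _+_ (cong (if_then 1ℚ else 0ℚ) (dec-true (v ≈? r) v≈r))
        (≡.trans (sumBy-cong rs (λ {r′} r′∈ → cong (if_then 1ℚ else 0ℚ)
          (dec-false (v ≈? r′) λ v≈r′ → ListAll.lookup r≉ r′∈ (≈-trans (≈-sym v≈r) v≈r′)))) (sumBy-0 rs)))
      (ℚ.+-identityʳ 1ℚ)
    one-representative {v} (r ∷ rs) (r≉ ∷ u) (there v≈) = ≡.trans
      (cong₂ _+_ (cong (if_then 1ℚ else 0ℚ) (dec-false (v ≈? r) λ v≈r → not-head v≈r r≉ v≈)) (one-representative rs u v≈))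
      (ℚ.+-identityˡ 1ℚ)
      where
      not-head : ∀ {rs} → v ≈ r → ListAll.All (λ y → ¬ r ≈ y) rs → ¬ ListAny.Any (v ≈_) rs
      not-head v≈r (r≉ ListAll.∷ _) (here v≈y) = r≉ (≈-trans (≈-sym v≈r) v≈y)
      not-head v≈r (_ ListAll.∷ r≉) (there v≈) = not-head v≈r r≉ v≈

  count-filter : {A : Set} {P : A → Set} (P? : Decidable P) {k : ℕ} (v : Vec A k) → Vec.count P? v ≡ length (filter P? (toList v))
  count-filter P? [] = refl
  count-filter P? (x ∷ v) with does (P? x)
  ... | true = cong suc (count-filter P? v)
  ... | false = count-filter P? v

  module _ (d : DegreeSequence) where
    open DegreeSequence d

    inSpace-resp-≈ : ∀ {H G} → _≈_ d H G → InSpace d H → InSpace d G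
    inSpace-resp-≈ {H} {G} H≈G ((tails , heads) , degrees-ok , nondegenerate , no-multi) =
        ((λ s → count-resp (λ a → s ∈? tail d a) (tails s)) , (λ s → count-resp (λ a → s ∈? head d a) (heads s)))
      , ↭-trans (↭-sym (map-resp (degrees d))) degrees-ok
      , All.lookup⁻ (all-lookup {P = λ a → ¬ Degenerate (underlying d a)} G (All-resp-↭ H≈G (lookup-all H (All.lookup⁺ nondegenerate))))
      , ↭ₛ.Unique-resp-↭ (≡.setoid _) (↭⇒↭ₛ (map-resp (underlying d))) no-multi
      where
      count-resp : ∀ {P : StubHyperarc d → Set} (P? : Decidable P) → Vec.count P? H ≡ 1 → Vec.count P? G ≡ 1
      count-resp P? e = ≡.trans (count-filter P? G) (≡.trans (sym (↭-length (filter-↭ P? H≈G))) (≡.trans (sym (count-filter P? H)) e))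
      map-resp : ∀ {B : Set} (f : StubHyperarc d → B) → toList (Vec.map f H) ↭ toList (Vec.map f G)
      map-resp f = subst₂ _↭_ (sym (Vec.toList-map f H)) (sym (Vec.toList-map f G)) (map⁺ f H≈G)

    unique-arcs : ∀ {H} → InSpace d H → Unique (toList H)
    unique-arcs {H} (_ , _ , _ , no-multi) = injective⇒unique H λ i j e → unique⇒injective (Vec.map (underlying d) H) no-multi i j
      (≡.trans (Vec.lookup-map i (underlying d) H) (≡.trans (cong (underlying d) e) (sym (Vec.lookup-map j (underlying d) H))))

    private
      states : List (Hypergraph d)
      states = filter (inSpace? d) (vectors (hyperarcs d) arcs)

      ⟦_≈_⟧ : Hypergraph d → Hypergraph d → ℚ
      ⟦ H ≈ G ⟧ = indicator (_≈?_ d H) G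

    -- No two hyperarcs of `R` coincide, as even their underlying hyperarcs differ. So the
    -- reorderings of `R` are pairwise different vectors, and all of them stay in the space.
    class-size : ∀ {R} → InSpace d R → sumBy states (λ H → ⟦ H ≈ R ⟧) ≡ factorial arcs
    class-size {R} R∈ = begin
      sumBy states (λ H → ⟦ H ≈ R ⟧)
        ≡⟨ sumBy-filter (inSpace? d) (λ H → ⟦ H ≈ R ⟧) (vectors (hyperarcs d) arcs) ⟩
      sumBy (vectors (hyperarcs d) arcs) (λ H → if does (inSpace? d H) then ⟦ H ≈ R ⟧ else 0ℚ)
        ≡⟨ sumBy-cong (vectors (hyperarcs d) arcs) (λ {H} _ → restrict (inSpace? d H) (_≈?_ d H R) λ H≈R → inSpace-resp-≈ {R} {H} (↭-sym H≈R) R∈) ⟩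
      sumBy (vectors (hyperarcs d) arcs) (λ H → ⟦ H ≈ R ⟧)
        ≡⟨ arrangements (_≟ₐ_ d) (hyperarcs-unique d) (∈-hyperarcs d) arcs (toList R) (unique-arcs {R} R∈) (Vec.length-toList R) ⟩
      factorial arcs ∎
      where
      open ≡-Reasoning
      restrict : ∀ {P Q : Set} (P? : Dec P) (Q? : Dec Q) → (Q → P) →
                 (if does P? then (if does Q? then 1ℚ else 0ℚ) else 0ℚ) ≡ (if does Q? then 1ℚ else 0ℚ)
      restrict (yes _) Q? _ = refl
      restrict (no ¬p) (yes q) f = contradiction (f q) ¬p
      restrict (no _) (no _) _ = refl

    module _ (g : Hypergraph d → ℚ) (g-resp : ∀ {H G} → _≈_ d H G → g H ≡ g G) where

      -- Each vector has exactly one representative in `space`, so a sum equal to 1 over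
      -- representatives can be inserted and the two sums interchanged.
      sum-classes : sumBy states g ≡ factorial arcs * sumBy (space d) g
      sum-classes = begin
        sumBy states g                                                        ≡⟨ sumBy-cong states (λ {H} H∈ → sym (≡.trans (cong (_* g H) (one H∈)) (ℚ.*-identityˡ (g H)))) ⟩
        sumBy states (λ H → sumBy (space d) (λ R → ⟦ H ≈ R ⟧) * g H)          ≡⟨ sumBy-cong states (λ {H} _ → sumBy-*ʳ (g H) (λ R → ⟦ H ≈ R ⟧) (space d)) ⟨
        sumBy states (λ H → sumBy (space d) (λ R → ⟦ H ≈ R ⟧ * g H))          ≡⟨ sumBy-comm (λ H R → ⟦ H ≈ R ⟧ * g H) states (space d) ⟩
        sumBy (space d) (λ R → sumBy states (λ H → ⟦ H ≈ R ⟧ * g H))          ≡⟨ sumBy-cong (space d) (λ {R} R∈ → ≡.trans (sumBy-cong states (λ {H} _ → swap-in H R (_≈?_ d H R)))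
                                                                                   (≡.trans (sumBy-*ʳ (g R) (λ H → ⟦ H ≈ R ⟧) states) (cong (_* g R) (class-size (ListAll.lookup (space-sound d) R∈))))) ⟩
        sumBy (space d) (λ R → factorial arcs * g R)                          ≡⟨ sumBy-*ˡ (factorial arcs) g (space d) ⟩
        factorial arcs * sumBy (space d) g                                    ∎
        where
        open ≡-Reasoning
        one : ∀ {H} → H ∈ states → sumBy (space d) (λ R → ⟦ H ≈ R ⟧) ≡ 1ℚ
        one {H} H∈ = one-representative (_≈?_ d) ↭-sym ↭-trans (space d) (space-unique d)
          (space-complete d {H} (proj₂ (∈-filter⁻ (inSpace? d) {xs = vectors (hyperarcs d) arcs} H∈)))
        swap-in : ∀ H R (H≈?R : Dec (_≈_ d H R)) → (if does H≈?R then 1ℚ else 0ℚ) * g H ≡ (if does H≈?R then 1ℚ else 0ℚ) * g R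
        swap-in H R (yes H≈R) = cong (1ℚ *_) (g-resp {H} {R} H≈R)
        swap-in H R (no _) = ≡.trans (ℚ.*-zeroˡ (g H)) (sym (ℚ.*-zeroˡ (g R)))

    same-average : ∀ {H₀} → InSpace d H₀ → (g : Hypergraph d → ℚ) → (∀ {H G} → _≈_ d H G → g H ≡ g G) →
                   E (uniform states) g ≡ E (uniform (space d)) g
    same-average {H₀} H₀∈ g g-resp = begin
      E (uniform states) g                         ≡⟨ E-uniform states g ⟩
      wV * sumBy states g                          ≡⟨ cong (wV *_) (sum-classes g g-resp) ⟩
      wV * (C * sumBy (space d) g)                 ≡⟨ ℚ.*-assoc wV C _ ⟨
      wV * C * sumBy (space d) g                   ≡⟨ cong (_* sumBy (space d) g) weights ⟩
      wS * sumBy (space d) g                       ≡⟨ E-uniform (space d) g ⟨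
      E (uniform (space d)) g                      ∎
      where
      open ≡-Reasoning
      wV = weightOf states
      wS = weightOf (space d)
      C = factorial arcs
      N = sumBy (space d) (λ _ → 1ℚ)
      H₀∈states : H₀ ∈ states
      H₀∈states = ∈-filter⁺ (inSpace? d) (∈-vectors (∈-hyperarcs d) H₀) H₀∈
      total : wS * N ≡ 1ℚ
      total = from-any (space-complete d {H₀} H₀∈)
        where
        from-any : ∀ {P : Hypergraph d → Set} {rs} → ListAny.Any P rs → weightOf rs * sumBy rs (λ _ → 1ℚ) ≡ 1ℚ
        from-any {rs = r ∷ rs} _ = weight-total {xs = r ∷ rs} (here refl)
      lemma : ∀ v c s n → s * (v * (c * n)) ≡ v * c * (s * n)
      lemma = solve-∀ ringℚ
      -- Applying `sum-classes` to the constant 1 relates the two cardinalities without a division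
      -- by `factorial arcs`.
      weights : wV * C ≡ wS
      weights = begin
        wV * C                          ≡⟨ ℚ.*-identityʳ (wV * C) ⟨
        wV * C * 1ℚ                     ≡⟨ cong (wV * C *_) total ⟨
        wV * C * (wS * N)               ≡⟨ lemma wV C wS N ⟨
        wS * (wV * (C * N))             ≡⟨ cong (λ k → wS * (wV * k)) (sum-classes (λ _ → 1ℚ) (λ _ → refl)) ⟨
        wS * (wV * sumBy states (λ _ → 1ℚ))  ≡⟨ cong (wS *_) (weight-total H₀∈states) ⟩
        wS * 1ℚ                         ≡⟨ ℚ.*-identityʳ wS ⟩
        wS                              ∎

-- Convergence to the uniform distribution.

open import Defs
open import Data.Nat.Properties using (_<?_)
open import Data.Product.Base using (_×_; proj₁; proj₂)
open import Data.Vec.Base using (count)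
open import Data.Vec.Relation.Unary.All using (All)
open import Relation.Binary.PropositionalEquality using (_≡_)
open import Data.Fin.Base as Fin using (Fin)
open import Data.Bool.Base using (if_then_else_)
open import Data.List.Membership.Propositional using (_∈_)
open import Data.List.Relation.Binary.Permutation.Propositional using (↭-sym; ↭-trans)
open import Data.Nat.Base as ℕ using (ℕ)
import Data.Nat.Properties as ℕ
open import Data.Product.Base using (_×_; _,_; proj₁; proj₂; ∃-syntax)
open import Data.Rational.Base as ℚ using (ℚ; 0ℚ; 1ℚ; _*_; _-_; -_; _≤_; _<_; ∣_∣)
import Data.Rational.Properties as ℚ
open import Data.Sum.Base using (inj₁; inj₂)
open import Data.Vec.Base as Vec using (count)
open import Function.Bundles using (mk⇔)
open import Relation.Binary.PropositionalEquality as ≡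
  using (_≡_; sym; cong; subst; subst₂; module ≡-Reasoning)
open import Relation.Nullary.Decidable using (Dec; yes; no; does; does-⇔)
open import Tactic.RingSolver using (solve-∀)
open Expectation
open Averages
open Subsets
open Connectivity
open Chain
open Classes

∣-∣-between : ∀ {lo hi p q} → lo ≤ p → p ≤ hi → lo ≤ q → q ≤ hi → ∣ p - q ∣ ≤ hi - lo
∣-∣-between {lo} {hi} {p} {q} lo≤p p≤hi lo≤q q≤hi with ℚ.∣p∣≡p∨∣p∣≡-p (p - q)
... | inj₁ e = subst (_≤ hi - lo) (sym e) (ℚ.+-mono-≤ p≤hi (ℚ.neg-antimono-≤ lo≤q))
... | inj₂ e = subst (_≤ hi - lo) (sym (≡.trans e (lemma p q))) (ℚ.+-mono-≤ q≤hi (ℚ.neg-antimono-≤ lo≤p))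
  where
  lemma : ∀ p q → - (p - q) ≡ q - p
  lemma = solve-∀ ringℚ

module _ (d : DegreeSequence) {i₀ j₀ : Fin (DegreeSequence.arcs d)} (i₀<j₀ : i₀ Fin.< j₀) {H₀ : Hypergraph d} (H₀∈ : InSpace d H₀) where
  open DegreeSequence d
  open Walk d i₀<j₀

  mean-iter : ∀ k f → E (uniform states) (iter k f) ≡ E (uniform states) f
  mean-iter k f = ≡.trans (E-uniform states (iter k f)) (≡.trans (cong (weightOf states *_) (sum-iter k f)) (sym (E-uniform states f)))

  mean-within : ∀ {f lo hi} → Within f lo hi → lo ≤ E (uniform states) f × E (uniform states) f ≤ hi
  mean-within {f} {lo} {hi} w =
      subst (_≤ E (uniform states) f) (E-uniform-const lo H₀∈states) (E-uniform-mono states λ H∈ → proj₁ (w (states-sound H∈)))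
    , subst (E (uniform states) f ≤_) (E-uniform-const hi H₀∈states) (E-uniform-mono states λ H∈ → proj₂ (w (states-sound H∈)))
    where
    H₀∈states : H₀ ∈ states
    H₀∈states = states-complete H₀∈

  -- The value at `H₀` and the mean over all vectors lie in the same shrinking interval. The mean is
  -- the same for every `k` and equals the uniform probability, so it is the limit.
  converges : (∀ {H} → InSpace d H → ∃[ t ] ∃[ c ] 0ℚ < c × Reaches t c H H₀) →
              ConvergesInDistribution (_≈?_ d) (method d H₀) (uniform (space d))
  converges reach x ε 0<ε =
    let c₀ , 0<c₀ , stays = move-reaches H₀∈ (stay H₀∈)
        t , c , 0<c , r = uniformly-reaches H₀∈ 0<c₀ stays states (λ H∈ → reach (states-sound H∈))
        K , settled = settles H₀∈ 0<c₀ stays {t} {c} 0<c (λ H∈ → r (states-complete H∈)) g-within 0<ε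
    in K , λ k k≥K → close k (settled k k≥K)
    where
    g : Hypergraph d → ℚ
    g = indicator (_≈?_ d x)
    g-within : Within g 0ℚ 1ℚ
    g-within {H} _ = bounds (_≈?_ d x H)
      where
      bounds : ∀ {P : Set} (P? : Dec P) → 0ℚ ≤ (if does P? then 1ℚ else 0ℚ) × (if does P? then 1ℚ else 0ℚ) ≤ 1ℚ
      bounds (yes _) = ℚ.nonNegative⁻¹ 1ℚ , ℚ.≤-refl
      bounds (no _) = ℚ.≤-refl , ℚ.nonNegative⁻¹ 1ℚ
    g-resp : ∀ {H G} → _≈_ d H G → g H ≡ g G
    g-resp {H} {G} H≈G = cong (if_then 1ℚ else 0ℚ) (does-⇔ (mk⇔ (λ p → ↭-trans p H≈G) (λ p → ↭-trans p (↭-sym H≈G))) (_≈?_ d x H) (_≈?_ d x G))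
    limit : ∀ k → Pr (_≈?_ d x) (uniform (space d)) ≡ E (uniform states) (iter k g)
    limit k = begin
      Pr (_≈?_ d x) (uniform (space d))   ≡⟨ Pr-E (_≈?_ d x) (uniform (space d)) ⟩
      E (uniform (space d)) g             ≡⟨ same-average d H₀∈ g (λ {H} {G} → g-resp {H} {G}) ⟨
      E (uniform states) g                ≡⟨ mean-iter k g ⟨
      E (uniform states) (iter k g)       ∎
      where open ≡-Reasoning
    close : ∀ k → ∃[ lo ] ∃[ hi ] Within (iter k g) lo hi × hi - lo < ε →
            ∣ Pr (_≈?_ d x) (method d H₀ k) - Pr (_≈?_ d x) (uniform (space d)) ∣ < ε
    close k (lo , hi , w , width<ε) = subst₂ (λ p q → ∣ p - q ∣ < ε)
      (sym (≡.trans (Pr-E (_≈?_ d x) (method d H₀ k)) (method-iter k H₀ g))) (sym (limit k))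
      (ℚ.≤-<-trans (∣-∣-between (proj₁ (w H₀∈)) (proj₂ (w H₀∈)) (proj₁ (mean-within w)) (proj₂ (mean-within w))) width<ε)

theorem2 : (d : DegreeSequence) →
    let open DegreeSequence d in
    All (λ δₐ → proj₁ δₐ ≡ 1 × proj₂ δₐ ≡ 2) δ →
    count (0 <?_) dᵒᵘᵗ ≡ 2 →
    (H₀ : Hypergraph d) → InSpace d H₀ →
    ConvergesInDistribution (_≈?_ d) (method d H₀) (uniform (space d))
theorem2 d sizes two H₀ H₀∈ =
  let u , w , tails = count-positive≡2 (DegreeSequence.dᵒᵘᵗ d) two
      _ , _ , i<j = Encoding.two-positions d sizes u w tails
                      (subst (ℕ._≤ Vec.sum (DegreeSequence.dᵒᵘᵗ d)) two (count-positive≤sum (DegreeSequence.dᵒᵘᵗ d))) H₀∈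
  in converges d i<j H₀∈ λ H∈ → Walk.path-reaches d i<j H∈ (Encoding.space-connected d sizes u w tails H∈ H₀∈)
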